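{- There is an absolute constant $\varepsilon > 0$ such that the following holds. Let $C_0, c_1, C_1 > 0$. Then there is $c = c(C_0,c_1,C_1) > 0$ such that for every prime $q$, with $F := \mathbf{Z}/q\mathbf{Z}$: if $L$ is a collection of lines in $F^3$ with $c_1|F|^2 \leq |L| \leq C_1 |F|^2$ which obeys the Wolff axiom with constant $C_0$ (every 2-plane in $F^3$ contains at most $C_0|F|$ lines of $L$), and $P \subseteq F^3$ is a set of points containing every line of $L$, then $$|P| \geq c\,|F|^{5/2+\varepsilon}.$$
   Context: Lines in $F^3$ are sets $\{x + t v : t \in F\}$ with $x \in F^3$, $v \in F^3\setminus\{0\}$; 2-planes are sets $\{x + s v + t w : s,t\in F\}$ with $v,w$ linearly independent. A collection of lines obeys the Wolff axiom if every 2-plane contains $O(|F|)$ of its lines. (In particular, a Besicovitch set—a set of points in $F^3$ containing a line in every direction—has cardinality $\gtrsim |F|^{5/2+\varepsilon}$.) -}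

module Defs where

open import Data.Nat as ℕ using (ℕ; zero; suc; NonZero)
open import Data.Nat.DivMod using (_mod_)
open import Data.Fin using (Fin; toℕ)
open import Data.Integer as ℤ using (ℤ; +_)
open import Data.Rational as ℚ using (ℚ; ↥_; ↧ₙ_)
open import Data.Product using (_×_; _,_; ∃; ∃-syntax; Σ-syntax)
open import Data.List using (List; length)
open import Data.List.Membership.Propositional using (_∈_)
open import Data.List.Relation.Unary.All using (All)
open import Data.List.Relation.Unary.AllPairs using (AllPairs)
open import Data.List.Relation.Binary.Sublist.Propositional using (_⊆_)
open import Function.Bundles using (_⇔_)
open import Relation.Binary.PropositionalEquality using (_≡_)
open import Relation.Nullary using (¬_)

ℕ→ℚ : ℕ → ℚ
ℕ→ℚ n = (+ n) ℚ./ 1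

module _ (q : ℕ) .{{_ : NonZero q}} where

  F : Set
  F = Fin q

  _+F_ : F → F → F
  a +F b = (toℕ a ℕ.+ toℕ b) mod q

  _*F_ : F → F → F
  a *F b = (toℕ a ℕ.* toℕ b) mod q

  0F : F
  0F = 0 mod q

  Pt : Set
  Pt = F × F × F

  _+P_ : Pt → Pt → Pt
  (a₁ , a₂ , a₃) +P (b₁ , b₂ , b₃) = (a₁ +F b₁) , (a₂ +F b₂) , (a₃ +F b₃)

  _·P_ : F → Pt → Pt
  t ·P (a₁ , a₂ , a₃) = (t *F a₁) , (t *F a₂) , (t *F a₃)

  0P : Pt
  0P = 0F , 0F , 0F

  record Line : Set where
    constructor line
    field
      base : Pt
      dir  : Pt
      dir≢0 : ¬ (dir ≡ 0P)

  OnLine : Line → Pt → Set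
  OnLine ℓ p = ∃[ t ] (p ≡ Line.base ℓ +P (t ·P Line.dir ℓ))

  SameLine : Line → Line → Set
  SameLine ℓ ℓ′ = ∀ p → OnLine ℓ p ⇔ OnLine ℓ′ p

  LinIndep : Pt → Pt → Set
  LinIndep v w = ∀ a b → (a ·P v) +P (b ·P w) ≡ 0P → (a ≡ 0F) × (b ≡ 0F)

  record Plane : Set where
    constructor plane
    field
      base : Pt
      dir₁ : Pt
      dir₂ : Pt
      indep : LinIndep dir₁ dir₂

  OnPlane : Plane → Pt → Set
  OnPlane Π p = ∃[ s ] ∃[ t ]
    (p ≡ (Plane.base Π +P (s ·P Plane.dir₁ Π)) +P (t ·P Plane.dir₂ Π))

  LineInPlane : Line → Plane → Set
  LineInPlane ℓ Π = ∀ p → OnLine ℓ p → OnPlane Π p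

  -- A collection of lines: a list of pairwise distinct lines; |L| = length L.
  DistinctLines : List Line → Set
  DistinctLines L = AllPairs (λ ℓ ℓ′ → ¬ SameLine ℓ ℓ′) L

  -- Wolff axiom with constant C₀: every 2-plane contains at most C₀|F|
  -- lines of L (any sub-collection of L lying in a plane Π has ≤ C₀|F| lines).
  Wolff : ℚ → List Line → Set
  Wolff C₀ L = ∀ (Π : Plane) (S : List Line) → S ⊆ L →
    All (λ ℓ → LineInPlane ℓ Π) S →
    ℕ→ℚ (length S) ℚ.≤ C₀ ℚ.* ℕ→ℚ q

  ContainsLines : List Pt → List Line → Set
  ContainsLines P L = ∀ ℓ → ℓ ∈ L → ∀ p → OnLine ℓ p → p ∈ P

_^ℚ_ : ℚ → ℕ → ℚ
x ^ℚ zero = ℚ.1ℚ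
x ^ℚ suc n = x ℚ.* (x ^ℚ n)

-- "x ≥ c · q^(5/2 + ε)" for x, q ∈ ℕ, c > 0, ε = a/d > 0 rational
-- (a = numerator, d = denominator). Since both sides are nonnegative, this is
-- equivalent to raising both sides to the power 2d:
--   x^(2d) ≥ c^(2d) · q^(5d + 2a).
GeqPow : ℕ → ℚ → ℕ → ℚ → Set
GeqPow x c q ε =
  (c ^ℚ (2 ℕ.* d)) ℚ.* (ℕ→ℚ q ^ℚ (5 ℕ.* d ℕ.+ 2 ℕ.* a)) ℚ.≤ ℕ→ℚ x ^ℚ (2 ℕ.* d)
  where
    d = ↧ₙ ε
    a = ℤ.∣ ↥ ε ∣

{-# OPTIONS --safe #-}
-- The polynomial method gives the stronger bound |P| ≥ q³/M.
--
-- Deleting lines that have few rich points (points on at least μ of the remaining lines), one arrives at a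
-- subcollection in which every line has at least q/2 rich points, unless μ|P| ≥ (q/2)|L|.  If |P| < n³ with
-- n ≈ q/48, there is a nonzero polynomial f of degree at most 3n < q vanishing on P, hence on all lines.
-- Replacing f by partial derivatives as long as these vanish on all lines, one may assume that ∇f does not
-- vanish identically on some line ℓ.  At a rich point x of ℓ with ∇f(x) ≠ 0 all the lines through x lie in the
-- tangent plane of f; three of them force the second fundamental form to vanish on that plane, so the derivative
-- of ∇f along ℓ is proportional to ∇f.  The Wronskians of the components of ∇f along ℓ are therefore polynomials
-- of degree less than q with too many zeros, and as deg f < q the direction of ∇f, i.e. the tangent plane, is
-- constant along ℓ.  This plane contains all the lines through the rich noncritical points of ℓ, about μq/4 lines,
-- which contradicts the Wolff axiom for μ > 4C₀ + 1.
module Submission where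

-- Which line carries a noncritical point is decided by the differentiation and cannot be
-- prescribed. An average count of rich points would therefore not do: the deletion has to make
-- every surviving line rich.
--
-- Three lines through a point are the least that works. On a doubly ruled quadric every point
-- carries two lines of the surface, yet the tangent plane turns along each of them. The third
-- direction kills the mixed second derivative, after a division by 2.
--
-- Degrees stay below q because three facts fail beyond that: a polynomial that is zero at all
-- points of a line has zero restriction to it, a polynomial with zero gradient is constant, and a
-- vanishing Wronskian means proportionality (consider 1 and t^q). Primality makes the factors 1,
-- ..., q - 1 produced by differentiation invertible. A polynomial in space counts as nonzero when
-- it has a nonzero value somewhere, so no normal form of polynomials is needed.

open import Algebra.Bundles using (CommutativeRing)
open import Algebra.Core using (Op₁; Op₂)
import Algebra.Properties.Ring as RingProperties
import Algebra.Properties.Semiring.Mult.TCOptimised as Mult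
import Algebra.Solver.Ring
open import Algebra.Solver.Ring.AlmostCommutativeRing using (fromCommutativeRing; _-Raw-AlmostCommutative⟶_)
open import Algebra.Structures using (IsCommutativeRing)
open import Data.Empty using (⊥; ⊥-elim)
open import Data.Fin as Fin using (Fin; zero; suc; toℕ; combine; finToFun; funToFin)
open import Data.Fin.Patterns using (0F; 1F; 2F)
import Data.Fin.Properties as Finₚ
import Data.Integer as ℤ
import Data.Integer.Properties as ℤₚ
open import Data.List using (List; []; _∷_; _++_; length; map; filter; allFin; tabulate; lookup)
open import Data.List.Membership.Propositional using (_∈_; find; lose)
open import Data.List.Membership.Propositional.Properties using (∈-∃++; ∈-++⁻; ∈-++⁺ˡ; ∈-++⁺ʳ; ∈-filter⁺; ∈-filter⁻; ∈-map⁻)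
open import Data.List.Properties using (length-map; length-tabulate; length-filter; length-++; filter-none; tabulate-cong)
open import Data.List.Relation.Binary.Sublist.Propositional using (_⊆_; []; _∷_; _∷ʳ_; ⊆-refl; ⊆-trans)
open import Data.List.Relation.Binary.Sublist.Propositional.Properties using (filter-⊆; All-resp-⊆)
open import Data.List.Relation.Unary.All as All using (All; []; _∷_)
import Data.List.Relation.Unary.All.Properties as Allₚ
open import Data.List.Relation.Unary.AllPairs using (AllPairs; []; _∷_)
import Data.List.Relation.Unary.AllPairs.Properties as AllPairsₚ
open import Data.List.Relation.Unary.Any using (Any; here; there; any?; index)
open import Data.List.Relation.Unary.Any.Properties using (lookup-index)
open import Data.List.Relation.Unary.Unique.Propositional using (Unique)
open import Data.List.Relation.Unary.Unique.Propositional.Properties using (filter⁺; map⁺; allFin⁺)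
open import Data.Maybe.Base using (just; nothing)
open import Data.Nat as ℕ using (ℕ; zero; suc; pred; z≤n; s≤s; _⊔_; _∸_; _^_; NonZero)
open import Data.Nat.Coprimality as Coprimality using (1-coprimeTo; prime⇒coprime; coprime-Bézout)
open import Data.Nat.DivMod using (_/_; _%_; _mod_; %-distribˡ-+; %-distribˡ-*; m<n⇒m%n≡m; n%n≡0; m*n%n≡0; m%n<n; m≡m%n+[m/n]*n; m/n*n≤m)
open import Data.Nat.GCD using (module Bézout)
open import Data.Nat.GeneralisedArithmetic using (fold)
open import Data.Nat.ListAction using (sum)
open import Data.Nat.Primality using (Prime)
import Data.Nat.Properties as ℕₚ
open import Data.Nat.Tactic.RingSolver using (solve-∀)
open import Data.Product using (_×_; _,_; proj₁; proj₂; ∃; Σ-syntax; ∃-syntax)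
open import Data.Product.Properties using (≡-dec)
import Data.Sign as Sign
open import Data.Sum using (_⊎_; inj₁; inj₂; [_,_]′)
open import Defs using (_+F_; _*F_)
open import Function using (_∘_; id)
open import Function.Bundles using (Equivalence; mk⇔; _⇔_)
open import Relation.Binary.Definitions using (WeaklyDecidable)
open import Relation.Binary.PropositionalEquality using (_≡_; _≢_; refl; sym; trans; cong; cong₂; subst; subst₂; isEquivalence; module ≡-Reasoning)
open import Relation.Nullary using (¬_; Dec; yes; no; ¬?)
open import Relation.Nullary.Decidable using (decidable-stable; map′; _×-dec_)
open import Relation.Unary using (Pred; Decidable)
open import Algebra.Properties.CommutativeSemigroup ℕₚ.+-commutativeSemigroup using (x∙yz≈y∙xz)

-- Integer coefficients let the solver cancel terms, which coefficients in R without decidable equality do not.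
module IntegerCoefficients {c ℓ} (R : CommutativeRing c ℓ) where
  open CommutativeRing R renaming (refl to ≈-refl; sym to ≈-sym; trans to ≈-trans)
  open RingProperties ring
  open Mult semiring renaming (_×_ to _⊗_)
  open import Relation.Binary.Reasoning.Setoid setoid
  open ℤ using (ℤ; +_; -[1+_]; _⊖_; _◃_)

  ⟦_⟧ : ℤ → Carrier
  ⟦ + n ⟧      = n ⊗ 1#
  ⟦ -[1+ n ] ⟧ = - (suc n ⊗ 1#)

  ⟦⊖⟧ : ∀ m n → ⟦ m ⊖ n ⟧ ≈ m ⊗ 1# + - (n ⊗ 1#)
  ⟦⊖⟧ m zero = ≈-sym (≈-trans (+-congˡ -0#≈0#) (+-identityʳ _))
  ⟦⊖⟧ zero (suc n) = ≈-sym (+-identityˡ _)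
  ⟦⊖⟧ (suc m) (suc n) rewrite ℤₚ.[1+m]⊖[1+n]≡m⊖n m n = begin
    ⟦ m ⊖ n ⟧                                         ≈⟨ ⟦⊖⟧ m n ⟩
    m ⊗ 1# + - (n ⊗ 1#)                               ≈⟨ +-congʳ (+-identityˡ _) ⟨
    (0# + m ⊗ 1#) + - (n ⊗ 1#)                        ≈⟨ +-congʳ (+-congʳ (-‿inverseʳ 1#)) ⟨
    ((1# + - 1#) + m ⊗ 1#) + - (n ⊗ 1#)               ≈⟨ +-congʳ (+-congʳ (+-comm _ _)) ⟩
    ((- 1# + 1#) + m ⊗ 1#) + - (n ⊗ 1#)               ≈⟨ +-congʳ (+-assoc _ _ _) ⟩
    (- 1# + (1# + m ⊗ 1#)) + - (n ⊗ 1#)               ≈⟨ +-congʳ (+-comm _ _) ⟩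
    ((1# + m ⊗ 1#) + - 1#) + - (n ⊗ 1#)               ≈⟨ +-assoc _ _ _ ⟩
    (1# + m ⊗ 1#) + (- 1# + - (n ⊗ 1#))               ≈⟨ +-congˡ (-‿+-comm 1# _) ⟩
    (1# + m ⊗ 1#) + - (1# + n ⊗ 1#)                   ≈⟨ +-cong (×-homo-+ 1# 1 m) (-‿cong (×-homo-+ 1# 1 n)) ⟨
    suc m ⊗ 1# + - (suc n ⊗ 1#)                       ∎

  ⟦◃⟧ : ∀ n → ⟦ Sign.- ◃ n ⟧ ≈ - (n ⊗ 1#)
  ⟦◃⟧ zero    = ≈-sym -0#≈0#
  ⟦◃⟧ (suc n) = ≈-refl

  ⟦+◃⟧ : ∀ n → ⟦ Sign.+ ◃ n ⟧ ≈ n ⊗ 1#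
  ⟦+◃⟧ zero    = ≈-refl
  ⟦+◃⟧ (suc n) = ≈-refl

  +-homo : ∀ i j → ⟦ i ℤ.+ j ⟧ ≈ ⟦ i ⟧ + ⟦ j ⟧
  +-homo (+ m)    (+ n)    = ×-homo-+ 1# m n
  +-homo (+ m)    -[1+ n ] = ⟦⊖⟧ m (suc n)
  +-homo -[1+ m ] (+ n)    = ≈-trans (⟦⊖⟧ n (suc m)) (+-comm _ _)
  +-homo -[1+ m ] -[1+ n ] = begin
    - (suc (suc (m ℕ.+ n)) ⊗ 1#)            ≈⟨ -‿cong (×-homo-+ 1# 1 (suc m ℕ.+ n)) ⟩
    - (1# + (suc m ℕ.+ n) ⊗ 1#)             ≈⟨ -‿cong (+-congˡ (×-homo-+ 1# (suc m) n)) ⟩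
    - (1# + (suc m ⊗ 1# + n ⊗ 1#))          ≈⟨ -‿cong (≈-trans (≈-sym (+-assoc _ _ _)) (≈-trans (+-congʳ (+-comm _ _)) (+-assoc _ _ _))) ⟩
    - (suc m ⊗ 1# + (1# + n ⊗ 1#))          ≈⟨ -‿cong (+-congˡ (×-homo-+ 1# 1 n)) ⟨
    - (suc m ⊗ 1# + suc n ⊗ 1#)             ≈⟨ -‿+-comm _ _ ⟨
    - (suc m ⊗ 1#) + - (suc n ⊗ 1#)         ∎

  *-homo : ∀ i j → ⟦ i ℤ.* j ⟧ ≈ ⟦ i ⟧ * ⟦ j ⟧
  *-homo (+ m)    (+ n)    = ≈-trans (⟦+◃⟧ (m ℕ.* n)) (×1-homo-* m n)
  *-homo (+ m)    -[1+ n ] = ≈-trans (⟦◃⟧ (m ℕ.* suc n)) (≈-trans (-‿cong (×1-homo-* m (suc n))) (-‿distribʳ-* _ _))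
  *-homo -[1+ m ] (+ n)    = ≈-trans (⟦◃⟧ (suc m ℕ.* n)) (≈-trans (-‿cong (×1-homo-* (suc m) n)) (-‿distribˡ-* _ _))
  *-homo -[1+ m ] -[1+ n ] = begin
    ⟦ -[1+ m ] ℤ.* -[1+ n ] ⟧              ≈⟨ ⟦+◃⟧ (suc m ℕ.* suc n) ⟩
    (suc m ℕ.* suc n) ⊗ 1#                 ≈⟨ ×1-homo-* (suc m) (suc n) ⟩
    suc m ⊗ 1# * suc n ⊗ 1#                ≈⟨ -‿involutive _ ⟨
    - - (suc m ⊗ 1# * suc n ⊗ 1#)          ≈⟨ -‿cong (-‿distribʳ-* _ _) ⟩
    - (suc m ⊗ 1# * - (suc n ⊗ 1#))        ≈⟨ -‿distribˡ-* _ _ ⟩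
    - (suc m ⊗ 1#) * - (suc n ⊗ 1#)        ∎

  -‿homo : ∀ i → ⟦ ℤ.- i ⟧ ≈ - ⟦ i ⟧
  -‿homo (+ zero)  = ≈-sym -0#≈0#
  -‿homo (+ suc n) = ≈-refl
  -‿homo -[1+ n ]  = ≈-sym (-‿involutive _)

  homomorphism : CommutativeRing.rawRing ℤₚ.+-*-commutativeRing
                   -Raw-AlmostCommutative⟶ fromCommutativeRing R
  homomorphism = record
    { ⟦_⟧ = ⟦_⟧ ; +-homo = +-homo ; *-homo = *-homo ; -‿homo = -‿homo
    ; 0-homo = ≈-refl ; 1-homo = ≈-refl }

  _coeff≟_ : WeaklyDecidable (λ i j → ⟦ i ⟧ ≈ ⟦ j ⟧)
  i coeff≟ j with i ℤ.≟ j
  ... | yes refl = just ≈-refl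
  ... | no  _    = nothing

  open Algebra.Solver.Ring _ _ homomorphism _coeff≟_ public
    using (solve; _:=_; _:+_; _:*_; _:-_; :-_; con)

-- Counting in lists and incidence structures

length-filter-split : ∀ {a p} {A : Set a} {P : Pred A p} (P? : Decidable P) xs →
  length xs ≡ length (filter P? xs) ℕ.+ length (filter (λ x → ¬? (P? x)) xs)
length-filter-split P? []       = refl
length-filter-split P? (x ∷ xs) with P? x
... | yes _ = cong suc (length-filter-split P? xs)
... | no  _ = trans (cong suc (length-filter-split P? xs)) (sym (ℕₚ.+-suc _ _))

unique-length-≤ : ∀ {a} {A : Set a} (xs : List A) {ys} → Unique xs → (∀ {x} → x ∈ xs → x ∈ ys) → length xs ℕ.≤ length ys
unique-length-≤ []       _           _   = z≤n
unique-length-≤ (x ∷ xs) (x∉ ∷ uni)  sub with as , bs , refl ← ∈-∃++ (sub (here refl)) =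
  ℕₚ.≤-trans (s≤s (unique-length-≤ xs uni sub′)) (ℕₚ.≤-reflexive (trans (cong suc (length-++ as)) (trans (sym (ℕₚ.+-suc _ _)) (sym (length-++ as)))))
  where
  sub′ : ∀ {y} → y ∈ xs → y ∈ as ++ bs
  sub′ y∈ with ∈-++⁻ as (sub (there y∈))
  ... | inj₁ y∈as         = ∈-++⁺ˡ y∈as
  ... | inj₂ (here refl)  = ⊥-elim (All.lookup x∉ y∈ refl)
  ... | inj₂ (there y∈bs) = ∈-++⁺ʳ as y∈bs

sum-map-≤ : ∀ {a} {A : Set a} {f : A → ℕ} {m} (xs : List A) → (∀ x → f x ℕ.≤ m) → sum (map f xs) ℕ.≤ m ℕ.* length xs
sum-map-≤         {m = m} []       f≤m = z≤n
sum-map-≤ {f = f} {m = m} (x ∷ xs) f≤m =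
  ℕₚ.≤-trans (ℕₚ.+-mono-≤ (f≤m x) (sum-map-≤ xs f≤m)) (ℕₚ.≤-reflexive (sym (ℕₚ.*-suc m (length xs))))

sum-map-≥ : ∀ {a} {A : Set a} {f : A → ℕ} {m} {xs : List A} → All (λ x → m ℕ.≤ f x) xs → m ℕ.* length xs ℕ.≤ sum (map f xs)
sum-map-≥ {m = m} []                       = ℕₚ.≤-reflexive (ℕₚ.*-zeroʳ m)
sum-map-≥ {m = m} {xs = x ∷ xs} (m≤ ∷ rest) =
  ℕₚ.≤-trans (ℕₚ.≤-reflexive (ℕₚ.*-suc m (length xs))) (ℕₚ.+-mono-≤ m≤ (sum-map-≥ rest))

sum-map-gain : ∀ {a p} {A : Set a} {P : Pred A p} (P? : Decidable P) (f g : A → ℕ) →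
  (∀ x → g x ℕ.≤ f x) → (∀ x → P x → suc (g x) ℕ.≤ f x) →
  ∀ xs → sum (map g xs) ℕ.+ length (filter P? xs) ℕ.≤ sum (map f xs)
sum-map-gain P? f g g≤f g<f []       = z≤n
sum-map-gain P? f g g≤f g<f (x ∷ xs) with P? x
... | no  _  = ℕₚ.≤-trans (ℕₚ.≤-reflexive (ℕₚ.+-assoc (g x) _ _)) (ℕₚ.+-mono-≤ (g≤f x) (sum-map-gain P? f g g≤f g<f xs))
... | yes px = ℕₚ.≤-trans
  (ℕₚ.≤-reflexive (trans (ℕₚ.+-suc _ _) (cong suc (ℕₚ.+-assoc (g x) _ _))))
  (ℕₚ.+-mono-≤ (g<f x px) (sum-map-gain P? f g g≤f g<f xs))

double-count : ∀ {A B : Set} {R : A → B → Set} (R? : ∀ x y → Dec (R x y)) xs ys →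
  sum (map (λ x → length (filter (R? x) ys)) xs) ≡ sum (map (λ y → length (filter (λ x → R? x y) xs)) ys)
double-count         R? []       ys = sym (ℕₚ.n≤0⇒n≡0 (sum-map-≤ {m = 0} ys (λ _ → z≤n)))
double-count {A} {B} R? (x ∷ xs) ys = trans (cong (length (filter (R? x) ys) ℕ.+_) (double-count R? xs ys)) (sym (add-row ys))
  where
  column : List A → B → ℕ
  column zs y = length (filter (λ x → R? x y) zs)
  add-row : ∀ ys → sum (map (column (x ∷ xs)) ys) ≡ length (filter (R? x) ys) ℕ.+ sum (map (column xs) ys)
  add-row []       = refl
  add-row (y ∷ ys) with R? x y
  ... | no  _ = trans (cong (column xs y ℕ.+_) (add-row ys)) (x∙yz≈y∙xz (column xs y) (length (filter (R? x) ys)) _)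
  ... | yes _ = cong suc (trans (cong (column xs y ℕ.+_) (add-row ys)) (x∙yz≈y∙xz (column xs y) (length (filter (R? x) ys)) _))

filter-subsingleton : ∀ {p} {A : Set} {P : Pred A p} (P? : Decidable P) {xs} → Unique xs →
  (∀ {x y} → P x → P y → x ≡ y) → length (filter P? xs) ℕ.≤ 1
filter-subsingleton P? {xs} uni eq with filter P? xs | filter⁺ P? uni | Allₚ.all-filter P? xs
... | []         | _                 | _            = z≤n
... | _ ∷ []     | _                 | _            = s≤s z≤n
... | _ ∷ _ ∷ _  | (x≢y ∷ _) ∷ _     | px ∷ py ∷ _  = ⊥-elim (x≢y (eq px py))

-- Here `A` stands for lines and `B` for points. No geometry enters beyond an injective
-- parametrisation of each line by `Fin q` and a decidable incidence.
module Incidences {A B : Set} {q : ℕ} (point : A → Fin q → B) (point-injective : ∀ a {s t} → point a s ≡ point a t → s ≡ t)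
  {_on_ : B → A → Set} (on? : ∀ b a → Dec (b on a)) (point-on : ∀ a t → point a t on a) where

  multiplicity : List A → B → ℕ
  multiplicity L b = length (filter (on? b) L)

  rich : ℕ → List A → A → List (Fin q)
  rich μ L a = filter (λ t → μ ℕ.≤? multiplicity L (point a t)) (allFin q)

  multiplicity-remove : ∀ xs a ys b →
    multiplicity (xs ++ a ∷ ys) b ≡ multiplicity (xs ++ ys) b ℕ.+ length (filter (on? b) (a ∷ []))
  multiplicity-remove []       a ys b with on? b a
  ... | yes _ = ℕₚ.+-comm 1 _
  ... | no  _ = sym (ℕₚ.+-identityʳ _)
  multiplicity-remove (x ∷ xs) a ys b with on? b x
  ... | yes _ = cong suc (multiplicity-remove xs a ys b)
  ... | no  _ = multiplicity-remove xs a ys b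

  remove-⊆ : ∀ xs (a : A) {ys} → xs ++ ys ⊆ xs ++ a ∷ ys
  remove-⊆ []       a = a ∷ʳ ⊆-refl
  remove-⊆ (x ∷ xs) a = refl ∷ remove-⊆ xs a

  module _ (P : List B) (μ R : ℕ) where

    -- Truncating at `μ` bounds the total by `μ` times the number of points, while a point lying on
    -- fewer than `μ` lines still notices the loss of each of them.
    potential : List A → ℕ
    potential L = sum (map (λ b → multiplicity L b ℕ.⊓ μ) P)

    -- Fewer than `R` rich points leave at least `q ∸ R` poor ones on `a`. At a poor point the
    -- truncation is inactive, so its contribution drops by one.
    potential-remove : ∀ xs a ys → (∀ t → point a t ∈ P) → length (rich μ (xs ++ a ∷ ys) a) ℕ.< R →
      potential (xs ++ ys) ℕ.+ (q ∸ R) ℕ.≤ potential (xs ++ a ∷ ys)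
    potential-remove xs a ys a⊆P few = ℕₚ.≤-trans (ℕₚ.+-monoʳ-≤ _ many)
      (sum-map-gain poor? (λ b → multiplicity L b ℕ.⊓ μ) (λ b → multiplicity (xs ++ ys) b ℕ.⊓ μ)
        (λ b → ℕₚ.⊓-monoˡ-≤ μ (subst (multiplicity (xs ++ ys) b ℕ.≤_) (sym (multiplicity-remove xs a ys b)) (ℕₚ.m≤m+n _ _)))
        gain P)
      where
      L = xs ++ a ∷ ys
      Poor : B → Set
      Poor b = b on a × ¬ (μ ℕ.≤ multiplicity L b)
      poor? : Decidable Poor
      poor? b = on? b a ×-dec ¬? (μ ℕ.≤? multiplicity L b)
      gain : ∀ b → Poor b → suc (multiplicity (xs ++ ys) b ℕ.⊓ μ) ℕ.≤ multiplicity L b ℕ.⊓ μ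
      gain b (b∈a , poor) with on? b a | multiplicity-remove xs a ys b
      ... | no b∉a | _  = ⊥-elim (b∉a b∈a)
      ... | yes _  | eq rewrite ℕₚ.m≤n⇒m⊓n≡m (ℕₚ.<⇒≤ (ℕₚ.≰⇒> poor)) | eq | ℕₚ.+-comm (multiplicity (xs ++ ys) b) 1 =
        s≤s (ℕₚ.m⊓n≤m _ μ)
      poorParams = filter (λ t → ¬? (μ ℕ.≤? multiplicity L (point a t))) (allFin q)
      poorPoints⊆ : ∀ {b} → b ∈ map (point a) poorParams → b ∈ filter poor? P
      poorPoints⊆ b∈ with t , t∈ , refl ← ∈-map⁻ (point a) b∈ =
        ∈-filter⁺ poor? (a⊆P t) (point-on a t , proj₂ (∈-filter⁻ (λ t → ¬? (μ ℕ.≤? multiplicity L (point a t))) {xs = allFin q} t∈))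
      many : q ∸ R ℕ.≤ length (filter poor? P)
      many = begin
        q ∸ R
          ≡⟨ cong (_∸ R) (trans (sym (length-tabulate id)) (length-filter-split (λ t → μ ℕ.≤? multiplicity L (point a t)) (allFin q))) ⟩
        length (rich μ L a) ℕ.+ length poorParams ∸ R
          ≤⟨ ℕₚ.∸-monoˡ-≤ R (ℕₚ.+-monoˡ-≤ (length poorParams) (ℕₚ.<⇒≤ few)) ⟩
        R ℕ.+ length poorParams ∸ R
          ≡⟨ ℕₚ.m+n∸m≡n R _ ⟩
        length poorParams
          ≡⟨ length-map (point a) poorParams ⟨
        length (map (point a) poorParams)
          ≤⟨ unique-length-≤ (map (point a) poorParams) (map⁺ (point-injective a) (filter⁺ _ (allFin⁺ q))) poorPoints⊆ ⟩
        length (filter poor? P) ∎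
        where open ℕₚ.≤-Reasoning

    -- Richness is measured in the current list, since a deletion can make points of other lines
    -- poor. Each deletion is paid for by `q ∸ R` units of potential; if the deletions exhaust the
    -- list, all `n` payments fit into the initial potential.
    prune : ∀ n L → length L ≡ n → All (λ a → ∀ t → point a t ∈ P) L →
      (Σ[ L′ ∈ List A ] (L′ ⊆ L × 0 ℕ.< length L′ × All (λ a → R ℕ.≤ length (rich μ L′ a)) L′))
      ⊎ (n ℕ.* (q ∸ R) ℕ.≤ potential L)
    prune zero    L eq L⊆P = inj₂ z≤n
    prune (suc n) L eq L⊆P with any? (λ a → length (rich μ L a) ℕ.<? R) L
    ... | no none = inj₁ (L , ⊆-refl , subst (0 ℕ.<_) (sym eq) (s≤s z≤n) , All.map ℕₚ.≮⇒≥ (Allₚ.¬Any⇒All¬ L none))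
    ... | yes some = go (find-split some)
      where
      find-split : ∀ {Q : A → Set} {L} → Any Q L → ∃[ xs ] ∃[ a ] ∃[ ys ] (L ≡ xs ++ a ∷ ys × Q a)
      find-split {L = a ∷ ys} (here qa) = [] , a , ys , refl , qa
      find-split {L = x ∷ _} (there p) with xs , a , ys , refl , qa ← find-split p = x ∷ xs , a , ys , refl , qa
      go : ∃[ xs ] ∃[ a ] ∃[ ys ] (L ≡ xs ++ a ∷ ys × length (rich μ L a) ℕ.< R) → _
      go (xs , a , ys , refl , few) with prune n (xs ++ ys)
             (ℕₚ.suc-injective (trans (sym (trans (length-++ xs) (trans (ℕₚ.+-suc _ _) (cong suc (sym (length-++ xs)))))) eq))
             (Allₚ.++⁺ (Allₚ.++⁻ˡ xs L⊆P) (All.tail (Allₚ.++⁻ʳ xs L⊆P)))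
      ... | inj₁ (L′ , L′⊆ , rest) = inj₁ (L′ , ⊆-trans L′⊆ (remove-⊆ xs a) , rest)
      ... | inj₂ le = inj₂ (ℕₚ.≤-trans (ℕₚ.≤-reflexive (ℕₚ.+-comm (q ∸ R) _)) (ℕₚ.≤-trans (ℕₚ.+-monoˡ-≤ (q ∸ R) le)
              (potential-remove xs a ys (All.head (Allₚ.++⁻ʳ xs L⊆P)) few)))

    potential≤ : ∀ L → potential L ℕ.≤ μ ℕ.* length P
    potential≤ L = sum-map-≤ P (λ b → ℕₚ.m⊓n≤n (multiplicity L b) μ)

  -- Incidences between the points `ts` of `a` and the lines of `L`, counted both ways: `a` itself
  -- accounts for at most `length ts` of them, any other line for at most one. `AllPairs` relates
  -- entries in list order only, hence the two alternatives for distinctness.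
  pencil-count : ∀ {Distinct : A → A → Set} {L} a → a ∈ L → AllPairs Distinct L → ∀ {ts} → Unique ts →
    (∀ {b} → Distinct a b ⊎ Distinct b a → ∀ {s t} → point a s on b → point a t on b → s ≡ t) →
    ∀ {μ} → All (λ t → μ ℕ.≤ multiplicity L (point a t)) ts →
    μ ℕ.* length ts ℕ.≤ length ts ℕ.+ length (filter (λ b → any? (λ t → on? (point a t) b) ts) L)
  pencil-count {Distinct} {L} a a∈L distinct {ts} uni once {μ} rich = begin
    μ ℕ.* length ts                                     ≤⟨ sum-map-≥ rich ⟩
    sum (map (λ t → multiplicity L (point a t)) ts)     ≡⟨ double-count (λ t b → on? (point a t) b) ts L ⟩
    sum (map meets L)                                   ≤⟨ with-a L a∈L distinct ⟩
    length ts ℕ.+ length (filter meets? L)              ∎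
    where
    open ℕₚ.≤-Reasoning
    meets : A → ℕ
    meets b = length (filter (λ t → on? (point a t) b) ts)
    meets? = λ b → any? (λ t → on? (point a t) b) ts
    meets≡0 : ∀ {b} → ¬ Any (λ t → point a t on b) ts → meets b ≡ 0
    meets≡0 {b} none = cong length (filter-none (λ t → on? (point a t) b) (Allₚ.¬Any⇒All¬ ts none))
    meets≤1 : ∀ {b} → Distinct a b ⊎ Distinct b a → meets b ℕ.≤ 1
    meets≤1 {b} d = filter-subsingleton (λ t → on? (point a t) b) uni (once d)
    others : ∀ M → All (λ b → Distinct a b ⊎ Distinct b a) M → sum (map meets M) ℕ.≤ length (filter meets? M)
    others []      []       = z≤n
    others (b ∷ M) (d ∷ ds) with meets? b
    ... | yes _    = ℕₚ.+-mono-≤ (meets≤1 d) (others M ds)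
    ... | no  none = ℕₚ.≤-trans (ℕₚ.≤-reflexive (cong (ℕ._+ sum (map meets M)) (meets≡0 none))) (others M ds)
    with-a : ∀ M → a ∈ M → AllPairs Distinct M → sum (map meets M) ℕ.≤ length ts ℕ.+ length (filter meets? M)
    with-a (_ ∷ M) (here refl) (d ∷ _) = ℕₚ.+-mono-≤ (length-filter _ ts) (ℕₚ.≤-trans (others M (All.map inj₁ d)) head≤)
      where
      head≤ : length (filter meets? M) ℕ.≤ length (filter meets? (a ∷ M))
      head≤ with meets? a
      ... | yes _ = ℕₚ.n≤1+n _
      ... | no  _ = ℕₚ.≤-refl
    with-a (b ∷ M) (there a∈M) (d ∷ ds) with meets? b
    ... | yes _    = ℕₚ.≤-trans (ℕₚ.+-mono-≤ (meets≤1 (inj₂ (All.lookup d a∈M))) (with-a M a∈M ds)) (ℕₚ.≤-reflexive (sym (ℕₚ.+-suc _ _)))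
    ... | no  none = ℕₚ.≤-trans (ℕₚ.≤-reflexive (cong (ℕ._+ sum (map meets M)) (meets≡0 none))) (with-a M a∈M ds)

-- Among the first three positions at least two differ from that of `a`.
two-others : ∀ {A : Set} {D : A → A → Set} {a} {L : List A} → a ∈ L → AllPairs D L → 3 ℕ.≤ length L →
  ∃[ b ] ∃[ c ] (b ∈ L × c ∈ L × (D a b ⊎ D b a) × (D a c ⊎ D c a) × D b c)
two-others {L = _ ∷ b ∷ c ∷ _} (here refl) ((ab ∷ ac ∷ _) ∷ (bc ∷ _) ∷ _) _ =
  b , c , there (here refl) , there (there (here refl)) , inj₁ ab , inj₁ ac , bc
two-others {L = b ∷ _ ∷ c ∷ _} (there (here refl)) ((ba ∷ bc ∷ _) ∷ (ac ∷ _) ∷ _) _ =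
  b , c , here refl , there (there (here refl)) , inj₂ ba , inj₁ ac , bc
two-others {L = b ∷ c ∷ _} (there (there a∈)) ((bc ∷ b∷) ∷ c∷ ∷ _) _ =
  b , c , here refl , there (here refl) , inj₂ (All.lookup b∷ a∈) , inj₂ (All.lookup c∷ a∈) , bc
two-others {L = _ ∷ []}     (here refl)         _ (s≤s ())
two-others {L = _ ∷ _ ∷ []} (here refl)         _ (s≤s (s≤s ()))
two-others {L = _ ∷ _ ∷ []} (there (here refl)) _ (s≤s (s≤s ()))

-- Prime fields with abstract operations

-- The carrier is `Fin q` itself, which gives enumeration and decidable equality. `nat≢0` says that
-- 1, ..., q - 1 are nonzero in the field, the form in which differentiation meets the
-- characteristic.
record PrimeField (q : ℕ) : Set where
  infixl 6 _+_
  infixl 7 _*_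
  infix  8 -_
  field
    _+_ _*_           : Op₂ (Fin q)
    -_                : Op₁ (Fin q)
    0# 1#             : Fin q
    isCommutativeRing : IsCommutativeRing _≡_ _+_ _*_ -_ 0# 1#
    inverse           : ∀ x → x ≢ 0# → ∃[ y ] x * y ≡ 1#
    nat≢0             : ∀ n → suc n ℕ.< q → fold 0# (1# +_) (suc n) ≢ 0#

  nat : ℕ → Fin q
  nat = fold 0# (1# +_)

module FieldProperties {q : ℕ} (K : PrimeField q) where
  open PrimeField K public

  commutativeRing : CommutativeRing _ _
  commutativeRing = record { isCommutativeRing = isCommutativeRing }

  open CommutativeRing commutativeRing public
    using (+-identityˡ; +-identityʳ; *-identityˡ; zeroˡ; zeroʳ; *-comm)
  open IntegerCoefficients commutativeRing public
    using (solve; _:=_; _:+_; _:*_; _:-_; :-_; con)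

  _≟_ : (x y : Fin q) → Dec (x ≡ y)
  _≟_ = Finₚ._≟_

  *-nonzeroˡ : ∀ {x y} → x ≢ 0# → x * y ≡ 0# → y ≡ 0#
  *-nonzeroˡ {x} {y} x≢0 xy≡0 with x⁻¹ , eq ← inverse x x≢0 = begin
    y              ≡⟨ *-identityˡ y ⟨
    1# * y         ≡⟨ cong (_* y) eq ⟨
    x * x⁻¹ * y    ≡⟨ solve 3 (λ x z y → x :* z :* y := z :* (x :* y)) refl x x⁻¹ y ⟩
    x⁻¹ * (x * y)  ≡⟨ cong (x⁻¹ *_) xy≡0 ⟩
    x⁻¹ * 0#       ≡⟨ zeroʳ x⁻¹ ⟩
    0#             ∎
    where open ≡-Reasoning

  x-y≡0⇒x≡y : ∀ {x y} → x + - y ≡ 0# → x ≡ y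
  x-y≡0⇒x≡y {x} {y} eq = begin
    x              ≡⟨ solve 2 (λ x y → x := (x :- y) :+ y) refl x y ⟩
    x + - y + y    ≡⟨ cong (_+ y) eq ⟩
    0# + y         ≡⟨ +-identityˡ y ⟩
    y              ∎
    where open ≡-Reasoning

  x≡y⇒x-y≡0 : ∀ {x y} → x ≡ y → x + - y ≡ 0#
  x≡y⇒x-y≡0 {x} refl = solve 1 (λ x → x :- x := con (ℤ.+ 0)) refl x

-- Univariate polynomials, as lists of coefficients in increasing degree

module Univariate {q : ℕ} (K : PrimeField q) where
  open FieldProperties K

  Poly : Set
  Poly = List (Fin q)

  eval : Poly → Fin q → Fin q
  eval []      x = 0#
  eval (a ∷ p) x = a + x * eval p x

  infixl 6 _⊞_
  _⊞_ : Poly → Poly → Poly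
  []      ⊞ p       = p
  (a ∷ p) ⊞ []      = a ∷ p
  (a ∷ p) ⊞ (b ∷ r) = (a + b) ∷ (p ⊞ r)

  scale : Fin q → Poly → Poly
  scale c = map (c *_)

  infixl 7 _⊠_
  _⊠_ : Poly → Poly → Poly
  []      ⊠ r = []
  (a ∷ p) ⊠ r = scale a r ⊞ (0# ∷ p ⊠ r)

  -- This is (t^k p)' divided by t^(k-1): `k` is the exponent carried by the first coefficient.
  derivFrom : ℕ → Poly → Poly
  derivFrom k []      = []
  derivFrom k (a ∷ p) = nat k * a ∷ derivFrom (suc k) p

  deriv : Poly → Poly
  deriv []      = []
  deriv (a ∷ p) = derivFrom 1 p

  -- Coefficient lists are not normalised, so any list of zeros is a zero polynomial, and the length
  -- only bounds the degree from above.
  IsZero : Poly → Set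
  IsZero = All (_≡ 0#)

  eval-zero : ∀ {p} → IsZero p → ∀ x → eval p x ≡ 0#
  eval-zero []           x = refl
  eval-zero (refl ∷ p≡0) x = trans (+-identityˡ _) (trans (cong (x *_) (eval-zero p≡0 x)) (zeroʳ x))

  eval-⊞ : ∀ p r x → eval (p ⊞ r) x ≡ eval p x + eval r x
  eval-⊞ []      r       x = sym (+-identityˡ _)
  eval-⊞ (a ∷ p) []      x = sym (+-identityʳ _)
  eval-⊞ (a ∷ p) (b ∷ r) x rewrite eval-⊞ p r x =
    solve 5 (λ a b x P R → (a :+ b) :+ x :* (P :+ R) := (a :+ x :* P) :+ (b :+ x :* R)) refl a b x (eval p x) (eval r x)

  eval-scale : ∀ c p x → eval (scale c p) x ≡ c * eval p x
  eval-scale c []      x = sym (zeroʳ c)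
  eval-scale c (a ∷ p) x rewrite eval-scale c p x =
    solve 4 (λ c a x P → c :* a :+ x :* (c :* P) := c :* (a :+ x :* P)) refl c a x (eval p x)

  eval-⊠ : ∀ p r x → eval (p ⊠ r) x ≡ eval p x * eval r x
  eval-⊠ []      r x = sym (zeroˡ _)
  eval-⊠ (a ∷ p) r x
    rewrite eval-⊞ (scale a r) (0# ∷ p ⊠ r) x | eval-scale a r x | eval-⊠ p r x =
    solve 4 (λ a x P R → a :* R :+ (con (ℤ.+ 0) :+ x :* (P :* R)) := (a :+ x :* P) :* R) refl a x (eval p x) (eval r x)

  length-⊞ : ∀ p r → length (p ⊞ r) ≡ length p ⊔ length r
  length-⊞ []      r       = refl
  length-⊞ (a ∷ p) []      = refl
  length-⊞ (a ∷ p) (b ∷ r) = cong suc (length-⊞ p r)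

  length-⊠ : ∀ p r → length (p ⊠ r) ℕ.≤ length p ℕ.+ length r
  length-⊠ []      r = z≤n
  length-⊠ (a ∷ p) r rewrite length-⊞ (scale a r) (0# ∷ p ⊠ r) | length-map (a *_) r =
    ℕₚ.⊔-lub (ℕₚ.≤-trans (ℕₚ.m≤n+m _ (length p)) (ℕₚ.n≤1+n _)) (s≤s (length-⊠ p r))

  length-derivFrom : ∀ k p → length (derivFrom k p) ≡ length p
  length-derivFrom k []      = refl
  length-derivFrom k (a ∷ p) = cong suc (length-derivFrom (suc k) p)

  length-deriv : ∀ p → length (deriv p) ≡ pred (length p)
  length-deriv []      = refl
  length-deriv (a ∷ p) = length-derivFrom 1 p

  eval-derivFrom-suc : ∀ k p x → eval (derivFrom (suc k) p) x ≡ eval p x + eval (derivFrom k p) x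
  eval-derivFrom-suc k []      x = sym (+-identityˡ _)
  eval-derivFrom-suc k (a ∷ p) x rewrite eval-derivFrom-suc (suc k) p x =
    solve 5 (λ n a x P D → (con (ℤ.+ 1) :+ n) :* a :+ x :* (P :+ D) := (a :+ x :* P) :+ (n :* a :+ x :* D))
      refl (nat k) a x (eval p x) (eval (derivFrom (suc k) p) x)

  eval-derivFrom-zero : ∀ p x → eval (derivFrom 0 p) x ≡ x * eval (deriv p) x
  eval-derivFrom-zero []      x = sym (zeroʳ x)
  eval-derivFrom-zero (a ∷ p) x =
    solve 3 (λ a x D → con (ℤ.+ 0) :* a :+ x :* D := x :* D) refl a x (eval (derivFrom 1 p) x)

  eval-deriv-∷ : ∀ a p x → eval (deriv (a ∷ p)) x ≡ eval p x + x * eval (deriv p) x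
  eval-deriv-∷ a p x = trans (eval-derivFrom-suc 0 p x) (cong (λ e → eval p x + e) (eval-derivFrom-zero p x))

  derivFrom-⊞ : ∀ k p r x → eval (derivFrom k (p ⊞ r)) x ≡ eval (derivFrom k p) x + eval (derivFrom k r) x
  derivFrom-⊞ k []      r       x = sym (+-identityˡ _)
  derivFrom-⊞ k (a ∷ p) []      x = sym (+-identityʳ _)
  derivFrom-⊞ k (a ∷ p) (b ∷ r) x rewrite derivFrom-⊞ (suc k) p r x =
    solve 6 (λ n a b x P R → n :* (a :+ b) :+ x :* (P :+ R) := (n :* a :+ x :* P) :+ (n :* b :+ x :* R))
      refl (nat k) a b x (eval (derivFrom (suc k) p) x) (eval (derivFrom (suc k) r) x)

  deriv-⊞ : ∀ p r x → eval (deriv (p ⊞ r)) x ≡ eval (deriv p) x + eval (deriv r) x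
  deriv-⊞ []      r       x = sym (+-identityˡ _)
  deriv-⊞ (a ∷ p) []      x = sym (+-identityʳ _)
  deriv-⊞ (a ∷ p) (b ∷ r) x = derivFrom-⊞ 1 p r x

  derivFrom-scale : ∀ k c p x → eval (derivFrom k (scale c p)) x ≡ c * eval (derivFrom k p) x
  derivFrom-scale k c []      x = sym (zeroʳ c)
  derivFrom-scale k c (a ∷ p) x rewrite derivFrom-scale (suc k) c p x =
    solve 5 (λ n c a x P → n :* (c :* a) :+ x :* (c :* P) := c :* (n :* a :+ x :* P))
      refl (nat k) c a x (eval (derivFrom (suc k) p) x)

  deriv-scale : ∀ c p x → eval (deriv (scale c p)) x ≡ c * eval (deriv p) x
  deriv-scale c []      x = sym (zeroʳ c)
  deriv-scale c (a ∷ p) x = derivFrom-scale 1 c p x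

  -- The factors are k + 1, ..., k + length p. The length bound keeps them below q, so each can be
  -- cancelled.
  derivFrom-isZero : ∀ k p → suc k ℕ.+ length p ℕ.≤ q → IsZero (derivFrom (suc k) p) → IsZero p
  derivFrom-isZero k []      _  []          = []
  derivFrom-isZero k (a ∷ p) le (eq ∷ rest) =
    *-nonzeroˡ (nat≢0 k (ℕₚ.≤-trans (s≤s (s≤s (ℕₚ.m≤m+n k (length p)))) le′)) eq ∷ derivFrom-isZero (suc k) p le′ rest
    where le′ = subst (ℕ._≤ q) (ℕₚ.+-suc (suc k) (length p)) le

  deriv-zero : ∀ {p} → IsZero p → IsZero (deriv p)
  deriv-zero []           = []
  deriv-zero (refl ∷ p≡0) = go 1 p≡0
    where
    go : ∀ k {p} → IsZero p → IsZero (derivFrom k p)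
    go k []           = []
    go k (refl ∷ p≡0) = zeroʳ (nat k) ∷ go (suc k) p≡0

  -- Synthetic division by t - x. The quotient of `a ∷ p` depends on `p` alone; `a` enters only the
  -- remainder.
  quotient : Poly → Fin q → Poly
  quotient []      x = []
  quotient (b ∷ p) x = eval (b ∷ p) x ∷ quotient p x

  quotient-spec : ∀ a p x y → eval (a ∷ p) y ≡ eval (a ∷ p) x + (y + - x) * eval (quotient p x) y
  quotient-spec a []      x y =
    solve 3 (λ a x y → a :+ y :* con (ℤ.+ 0) := (a :+ x :* con (ℤ.+ 0)) :+ (y :- x) :* con (ℤ.+ 0)) refl a x y
  quotient-spec a (b ∷ p) x y rewrite quotient-spec b p x y =
    solve 5 (λ a x y P Q → a :+ y :* (P :+ (y :- x) :* Q) := (a :+ x :* P) :+ (y :- x) :* (P :+ y :* Q))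
      refl a x y (eval (b ∷ p) x) (eval (quotient p x) y)

  length-quotient : ∀ p x → length (quotient p x) ≡ length p
  length-quotient []      x = refl
  length-quotient (b ∷ p) x = cong suc (length-quotient p x)

  quotient-isZero : ∀ p x → IsZero (quotient p x) → IsZero p
  quotient-isZero []      x []          = []
  quotient-isZero (b ∷ p) x (eq ∷ rest) = b≡0 ∷ p≡0
    where
    p≡0 = quotient-isZero p x rest
    b≡0 : b ≡ 0#
    b≡0 = trans (sym (trans (cong (λ e → b + x * e) (eval-zero p≡0 x)) (trans (cong (b +_) (zeroʳ x)) (+-identityʳ b)))) eq

  roots : ∀ n p xs → length p ≡ n → Unique xs → All (λ x → eval p x ≡ 0#) xs → n ℕ.≤ length xs → IsZero p
  roots zero    []      xs       _    _          _            _        = []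
  roots (suc n) (a ∷ p) (x ∷ xs) refl (x∉ ∷ uni) (root ∷ rts) (s≤s le) = a≡0 ∷ p≡0
    where
    rest : ∀ {ys} → All (x ≢_) ys → All (λ y → eval (a ∷ p) y ≡ 0#) ys → All (λ y → eval (quotient p x) y ≡ 0#) ys
    rest []           []           = []
    rest {y ∷ _} (x≢y ∷ ne) (eq ∷ eqs) = *-nonzeroˡ (λ y-x≡0 → x≢y (sym (x-y≡0⇒x≡y y-x≡0))) prod ∷ rest ne eqs
      where
      prod : (y + - x) * eval (quotient p x) y ≡ 0#
      prod = trans (sym (trans (quotient-spec a p x y) (trans (cong (_+ (y + - x) * eval (quotient p x) y) root) (+-identityˡ _)))) eq
    p≡0 = quotient-isZero p x (roots n (quotient p x) xs (length-quotient p x) uni (rest x∉ rts) le)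
    a≡0 : a ≡ 0#
    a≡0 = trans (sym (trans (cong (λ e → a + x * e) (eval-zero p≡0 x)) (trans (cong (a +_) (zeroʳ x)) (+-identityʳ a)))) root

  vanishing : ∀ p → length p ℕ.≤ q → (∀ x → eval p x ≡ 0#) → IsZero p
  vanishing p le eqs = roots _ p (allFin q) refl (allFin⁺ q) (All.tabulate (λ {x} _ → eqs x))
    (subst (length p ℕ.≤_) (sym (length-tabulate id)) le)

  -- The bound is attached to a function, so that composite expressions can be handled pointwise and
  -- their representing lists forgotten.
  HasDegree< : ℕ → (Fin q → Fin q) → Set
  HasDegree< n f = Σ[ p ∈ Poly ] (length p ℕ.≤ n × (∀ x → eval p x ≡ f x))

  *-hasDegree : ∀ {m n f g} → HasDegree< m f → HasDegree< n g → HasDegree< (m ℕ.+ n) (λ x → f x * g x)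
  *-hasDegree (p , p≤ , p≡) (r , r≤ , r≡) =
    p ⊠ r , ℕₚ.≤-trans (length-⊠ p r) (ℕₚ.+-mono-≤ p≤ r≤) , λ x → trans (eval-⊠ p r x) (cong₂ _*_ (p≡ x) (r≡ x))

  +-hasDegree : ∀ {n f g} → HasDegree< n f → HasDegree< n g → HasDegree< n (λ x → f x + g x)
  +-hasDegree (p , p≤ , p≡) (r , r≤ , r≡) =
    p ⊞ r , ℕₚ.≤-trans (ℕₚ.≤-reflexive (length-⊞ p r)) (ℕₚ.⊔-lub p≤ r≤) , λ x → trans (eval-⊞ p r x) (cong₂ _+_ (p≡ x) (r≡ x))

  scale-hasDegree : ∀ {n f} c → HasDegree< n f → HasDegree< n (λ x → c * f x)
  scale-hasDegree c (p , p≤ , p≡) =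
    scale c p , ℕₚ.≤-trans (ℕₚ.≤-reflexive (length-map (c *_) p)) p≤ , λ x → trans (eval-scale c p x) (cong (c *_) (p≡ x))

  shift-hasDegree : ∀ {n f} → HasDegree< n f → HasDegree< (suc n) (λ x → x * f x)
  shift-hasDegree (p , p≤ , p≡) = 0# ∷ p , s≤s p≤ , λ x → trans (+-identityˡ _) (cong (x *_) (p≡ x))

  minus-hasDegree : ∀ {n f g} → HasDegree< n f → HasDegree< n g → HasDegree< n (λ x → f x + - g x)
  minus-hasDegree {g = g} f< g< with p , p≤ , p≡ ← +-hasDegree f< (scale-hasDegree (- 1#) g<) =
    p , p≤ , λ x → trans (p≡ x) (cong (_ +_) (solve 1 (λ y → (:- con (ℤ.+ 1)) :* y := :- y) refl (g x)))

  weaken-hasDegree : ∀ {m n f} → m ℕ.≤ n → HasDegree< m f → HasDegree< n f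
  weaken-hasDegree m≤n (p , p≤ , p≡) = p , ℕₚ.≤-trans p≤ m≤n , p≡

  roots-hasDegree : ∀ {n f} → HasDegree< n f → ∀ xs → Unique xs → All (λ x → f x ≡ 0#) xs → n ℕ.≤ length xs → ∀ x → f x ≡ 0#
  roots-hasDegree (p , p≤ , p≡) xs uni rts n≤ x =
    trans (sym (p≡ x)) (eval-zero (roots _ p xs refl uni (All.map (λ {y} → trans (p≡ y)) rts) (ℕₚ.≤-trans p≤ n≤)) x)

  -- Otherwise `xs` would contain `n` roots, and `f` would be zero everywhere, in particular at `x`.
  nonroots : ∀ n f → HasDegree< n f → ∀ {x} → f x ≢ 0# → ∀ xs → Unique xs →
             length xs ℕ.≤ length (filter (λ y → ¬? (f y ≟ 0#)) xs) ℕ.+ n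
  nonroots n f f< {x} fx≢0 xs uni with n ℕ.≤? length (filter (λ y → f y ≟ 0#) xs)
  ... | yes le = ⊥-elim (fx≢0 (roots-hasDegree f< _ (filter⁺ _ uni) (Allₚ.all-filter (λ y → f y ≟ 0#) xs) le x))
  ... | no ¬le = ℕₚ.≤-trans (ℕₚ.≤-reflexive (length-filter-split (λ y → f y ≟ 0#) xs))
    (ℕₚ.≤-trans (ℕₚ.+-monoˡ-≤ _ (ℕₚ.<⇒≤ (ℕₚ.≰⇒> ¬le))) (ℕₚ.≤-reflexive (ℕₚ.+-comm n _)))

-- Vanishing Wronskians in degree below q

module Wronskian {q : ℕ} (K : PrimeField q) where
  open FieldProperties K
  open Univariate K

  -- Comparing lowest-order terms in g (t^k s)' = g' (t^k s), with the common factor t^(k-1) removed.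
  ode-isZero : ∀ k g s → eval g 0# ≢ 0# → suc k ℕ.+ length s ℕ.≤ q → 2 ℕ.+ (length g ℕ.+ length s) ℕ.≤ q →
    (∀ t → eval g t * (nat (suc k) * eval s t + t * eval (deriv s) t) ≡ t * (eval (deriv g) t * eval s t)) →
    IsZero s
  ode-isZero k g []      _    _  _   _   = []
  ode-isZero k g (a ∷ s) g0≢0 k≤ 2+≤ eqn = a≡0 ∷ ode-isZero (suc k) g s g0≢0 k≤′ 2+≤′ eqn′
    where
    k≤′ = subst (ℕ._≤ q) (ℕₚ.+-suc (suc k) (length s)) k≤
    2+≤′ = ℕₚ.≤-trans (s≤s (s≤s (ℕₚ.+-monoʳ-≤ (length g) (ℕₚ.n≤1+n _)))) 2+≤
    -- At t = 0 the equation reads g(0) (k + 1) a = 0.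
    a≡0 : a ≡ 0#
    a≡0 = *-nonzeroˡ (nat≢0 k (ℕₚ.≤-trans (s≤s (s≤s (ℕₚ.m≤m+n k (length s)))) k≤′)) (*-nonzeroˡ g0≢0 (begin
      eval g 0# * (nat (suc k) * a)
        ≡⟨ solve 5 (λ G n a S D → G :* (n :* a) := G :* (n :* (a :+ con (ℤ.+ 0) :* S) :+ con (ℤ.+ 0) :* D)) refl
             (eval g 0#) (nat (suc k)) a (eval s 0#) (eval (deriv (a ∷ s)) 0#) ⟩
      eval g 0# * (nat (suc k) * (a + 0# * eval s 0#) + 0# * eval (deriv (a ∷ s)) 0#)
        ≡⟨ eqn 0# ⟩
      0# * (eval (deriv g) 0# * eval (a ∷ s) 0#)
        ≡⟨ zeroˡ _ ⟩
      0# ∎))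
      where open ≡-Reasoning
    -- With a = 0 both sides of the equation carry a factor t, and `Δ` is the difference of the
    -- sides after its removal. It vanishes at every t ≠ 0; the degree bound extends this to t = 0.
    Δ : Fin q → Fin q
    Δ t = eval g t * (nat (suc (suc k)) * eval s t + t * eval (deriv s) t) + - (t * (eval (deriv g) t * eval s t))
    t*Δ≡0 : ∀ t → t * Δ t ≡ 0#
    t*Δ≡0 t = begin
      t * Δ t
        ≡⟨ solve 6 (λ t G n S D H →
             t :* (G :* ((con (ℤ.+ 1) :+ n) :* S :+ t :* D) :- t :* (H :* S)) :=
             G :* (n :* (con (ℤ.+ 0) :+ t :* S) :+ t :* (S :+ t :* D)) :- t :* (H :* (con (ℤ.+ 0) :+ t :* S))) refl
             t (eval g t) (nat (suc k)) (eval s t) (eval (deriv s) t) (eval (deriv g) t) ⟩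
      eval g t * (nat (suc k) * (0# + t * eval s t) + t * (eval s t + t * eval (deriv s) t))
        + - (t * (eval (deriv g) t * (0# + t * eval s t)))
        ≡⟨ x≡y⇒x-y≡0 (subst (λ b → eval g t * (nat (suc k) * (b + t * eval s t) + t * (eval s t + t * eval (deriv s) t))
             ≡ t * (eval (deriv g) t * (b + t * eval s t))) a≡0
             (trans (cong (λ d → eval g t * (nat (suc k) * eval (a ∷ s) t + t * d)) (sym (eval-deriv-∷ a s t))) (eqn t))) ⟩
      0# ∎
      where open ≡-Reasoning
    hasDegree : HasDegree< (length g ℕ.+ suc (length s)) Δ
    hasDegree = minus-hasDegree
      (*-hasDegree (g , ℕₚ.≤-refl , λ _ → refl) (+-hasDegree
        (scale-hasDegree (nat (suc (suc k))) (s , ℕₚ.n≤1+n _ , λ _ → refl))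
        (shift-hasDegree (deriv s , ℕₚ.≤-trans (ℕₚ.≤-reflexive (length-deriv s)) ℕₚ.pred[n]≤n , λ _ → refl))))
      (weaken-hasDegree (ℕₚ.≤-reflexive (sym (ℕₚ.+-suc _ _)))
        (shift-hasDegree (*-hasDegree (deriv g , ℕₚ.≤-trans (ℕₚ.≤-reflexive (length-deriv g)) ℕₚ.pred[n]≤n , λ _ → refl)
          (s , ℕₚ.≤-refl , λ _ → refl))))
    -- `nonroots` for the polynomial t, of length 2, yields at least q - 2 nonzero elements instead
    -- of q - 1; the summand 2 in the length hypothesis pays for this.
    nonzeros = filter (λ y → ¬? (y ≟ 0#)) (allFin q)
    q≤ : q ℕ.≤ length nonzeros ℕ.+ 2
    q≤ = subst (ℕ._≤ length nonzeros ℕ.+ 2) (length-tabulate id)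
      (nonroots 2 id (0# ∷ 1# ∷ [] , ℕₚ.≤-refl ,
         solve 1 (λ x → con (ℤ.+ 0) :+ x :* (con (ℤ.+ 1) :+ x :* con (ℤ.+ 0)) := x) refl)
        {1#} 1≢0 (allFin q) (allFin⁺ q))
      where
      1≢0 : 1# ≢ 0#
      1≢0 1≡0 = nat≢0 0 (ℕₚ.≤-trans (s≤s (s≤s z≤n)) 2+≤) (trans (+-identityʳ 1#) 1≡0)
    Δ≡0 : ∀ t → Δ t ≡ 0#
    Δ≡0 = roots-hasDegree hasDegree nonzeros (filter⁺ _ (allFin⁺ q))
      (All.map (λ {t} t≢0 → *-nonzeroˡ t≢0 (t*Δ≡0 t)) (Allₚ.all-filter (λ y → ¬? (y ≟ 0#)) (allFin q)))
      (ℕₚ.+-cancelʳ-≤ 2 _ _ (ℕₚ.≤-trans (ℕₚ.≤-reflexive (ℕₚ.+-comm _ 2)) (ℕₚ.≤-trans 2+≤ q≤)))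
    eqn′ : ∀ t → eval g t * (nat (suc (suc k)) * eval s t + t * eval (deriv s) t) ≡ t * (eval (deriv g) t * eval s t)
    eqn′ t = x-y≡0⇒x≡y (Δ≡0 t)

  -- Writing r = t s turns the equation into the case k = 0 of `ode-isZero`. The length bound is
  -- essential: g = 1 and r = t^q satisfy everything else.
  wronskian-zero : ∀ g r → eval g 0# ≢ 0# → eval r 0# ≡ 0# → 2 ℕ.+ (length g ℕ.+ length r) ℕ.≤ q →
    (∀ t → eval g t * eval (deriv r) t ≡ eval (deriv g) t * eval r t) → ∀ t → eval r t ≡ 0#
  wronskian-zero g []      _    _    _  _   t = refl
  wronskian-zero g (a ∷ s) g0≢0 r0≡0 le eqn t = eval-zero (a≡0 ∷
      ode-isZero 0 g s g0≢0
        (ℕₚ.≤-trans (ℕₚ.n≤1+n _) (ℕₚ.≤-trans (s≤s (s≤s (ℕₚ.≤-trans (ℕₚ.n≤1+n _) (ℕₚ.m≤n+m _ (length g))))) le))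
        (ℕₚ.≤-trans (s≤s (s≤s (ℕₚ.+-monoʳ-≤ (length g) (ℕₚ.n≤1+n _)))) le) eqn′) t
    where
    a≡0 : a ≡ 0#
    a≡0 = trans (solve 2 (λ a S → a := a :+ con (ℤ.+ 0) :* S) refl a (eval s 0#)) r0≡0
    eqn′ : ∀ t → eval g t * (nat 1 * eval s t + t * eval (deriv s) t) ≡ t * (eval (deriv g) t * eval s t)
    eqn′ t = begin
      eval g t * (nat 1 * eval s t + t * eval (deriv s) t)
        ≡⟨ solve 4 (λ t G S D → G :* ((con (ℤ.+ 1) :+ con (ℤ.+ 0)) :* S :+ t :* D) := G :* (S :+ t :* D)) refl
             t (eval g t) (eval s t) (eval (deriv s) t) ⟩
      eval g t * (eval s t + t * eval (deriv s) t)
        ≡⟨ cong (eval g t *_) (eval-deriv-∷ a s t) ⟨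
      eval g t * eval (deriv (a ∷ s)) t
        ≡⟨ eqn t ⟩
      eval (deriv g) t * (a + t * eval s t)
        ≡⟨ cong (λ b → eval (deriv g) t * (b + t * eval s t)) a≡0 ⟩
      eval (deriv g) t * (0# + t * eval s t)
        ≡⟨ solve 3 (λ t H S → H :* (con (ℤ.+ 0) :+ t :* S) := t :* (H :* S)) refl t (eval (deriv g) t) (eval s t) ⟩
      t * (eval (deriv g) t * eval s t) ∎
      where open ≡-Reasoning

-- Polynomials in three variables, directional derivatives, restriction to lines

module Trivariate {q : ℕ} (K : PrimeField q) where
  open FieldProperties K
  open Univariate K

  V : Set
  V = Fin q × Fin q × Fin q

  infixl 6 _+ᵥ_
  infixl 7 _·ᵥ_

  _+ᵥ_ : V → V → V
  (a₁ , a₂ , a₃) +ᵥ (b₁ , b₂ , b₃) = (a₁ + b₁) , (a₂ + b₂) , (a₃ + b₃)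

  _·ᵥ_ : Fin q → V → V
  t ·ᵥ (a₁ , a₂ , a₃) = (t * a₁) , (t * a₂) , (t * a₃)

  0ᵥ : V
  0ᵥ = 0# , 0# , 0#

  coord : Fin 3 → V → Fin q
  coord 0F (x , _ , _) = x
  coord 1F (_ , y , _) = y
  coord 2F (_ , _ , z) = z

  coord-+ᵥ : ∀ i u v → coord i (u +ᵥ v) ≡ coord i u + coord i v
  coord-+ᵥ 0F u v = refl
  coord-+ᵥ 1F u v = refl
  coord-+ᵥ 2F u v = refl

  coord-·ᵥ : ∀ i t v → coord i (t ·ᵥ v) ≡ t * coord i v
  coord-·ᵥ 0F t v = refl
  coord-·ᵥ 1F t v = refl
  coord-·ᵥ 2F t v = refl

  ext : ∀ {u v} → (∀ i → coord i u ≡ coord i v) → u ≡ v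
  ext {u} {v} eq = cong₂ _,_ (eq 0F) (cong₂ _,_ (eq 1F) (eq 2F))

  -- Polynomials in three variables of total degree at most the index

  data Expr : ℕ → Set where
    const  : ∀ {n} → Fin q → Expr n
    _⊕_    : ∀ {n} → Expr n → Expr n → Expr n
    var_⊙_ : ∀ {n} → Fin 3 → Expr n → Expr (suc n)

  ⟦_⟧ : ∀ {n} → Expr n → V → Fin q
  ⟦ const c ⟧   x = c
  ⟦ e ⊕ e′ ⟧    x = ⟦ e ⟧ x + ⟦ e′ ⟧ x
  ⟦ var i ⊙ e ⟧ x = coord i x * ⟦ e ⟧ x

  scaleE : ∀ {n} → Fin q → Expr n → Expr n
  scaleE c (const d)   = const (c * d)
  scaleE c (e ⊕ e′)    = scaleE c e ⊕ scaleE c e′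
  scaleE c (var i ⊙ e) = var i ⊙ scaleE c e

  raise : ∀ {n} → Expr n → Expr (suc n)
  raise (const c)   = const c
  raise (e ⊕ e′)    = raise e ⊕ raise e′
  raise (var i ⊙ e) = var i ⊙ raise e

  ⟦scaleE⟧ : ∀ {n} c (e : Expr n) x → ⟦ scaleE c e ⟧ x ≡ c * ⟦ e ⟧ x
  ⟦scaleE⟧ c (const d)   x = refl
  ⟦scaleE⟧ c (e ⊕ e′)    x rewrite ⟦scaleE⟧ c e x | ⟦scaleE⟧ c e′ x =
    solve 3 (λ c a b → c :* a :+ c :* b := c :* (a :+ b)) refl c (⟦ e ⟧ x) (⟦ e′ ⟧ x)
  ⟦scaleE⟧ c (var i ⊙ e) x rewrite ⟦scaleE⟧ c e x =
    solve 3 (λ c a b → a :* (c :* b) := c :* (a :* b)) refl c (coord i x) (⟦ e ⟧ x)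

  ⟦raise⟧ : ∀ {n} (e : Expr n) x → ⟦ raise e ⟧ x ≡ ⟦ e ⟧ x
  ⟦raise⟧ (const c)   x = refl
  ⟦raise⟧ (e ⊕ e′)    x = cong₂ _+_ (⟦raise⟧ e x) (⟦raise⟧ e′ x)
  ⟦raise⟧ (var i ⊙ e) x = cong (coord i x *_) (⟦raise⟧ e x)

  ∂ : ∀ {n} → V → Expr n → Expr (pred n)
  ∂ {zero}        u e           = const 0#
  ∂ {suc n}       u (const c)   = const 0#
  ∂ {suc n}       u (e ⊕ e′)    = ∂ u e ⊕ ∂ u e′
  -- Here `e` has degree 0, so the term of the product rule that differentiates it is absent; it
  -- would not fit into degree 0 either.
  ∂ {suc zero}    u (var i ⊙ e) = scaleE (coord i u) e
  ∂ {suc (suc n)} u (var i ⊙ e) = scaleE (coord i u) e ⊕ (var i ⊙ ∂ u e)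

  ⟦∂-⊕⟧ : ∀ {n} u (e e′ : Expr n) x → ⟦ ∂ u (e ⊕ e′) ⟧ x ≡ ⟦ ∂ u e ⟧ x + ⟦ ∂ u e′ ⟧ x
  ⟦∂-⊕⟧ {zero}  u e e′ x = sym (+-identityˡ 0#)
  ⟦∂-⊕⟧ {suc n} u e e′ x = refl

  ⟦∂-var⟧ : ∀ {n} u i (e : Expr n) x → ⟦ ∂ u (var i ⊙ e) ⟧ x ≡ coord i u * ⟦ e ⟧ x + coord i x * ⟦ ∂ u e ⟧ x
  ⟦∂-var⟧ {zero}  u i e x = trans (⟦scaleE⟧ (coord i u) e x)
    (solve 2 (λ a b → a := a :+ b :* con (ℤ.+ 0)) refl _ (coord i x))
  ⟦∂-var⟧ {suc n} u i e x = cong (_+ coord i x * ⟦ ∂ u e ⟧ x) (⟦scaleE⟧ (coord i u) e x)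

  ⟦∂-const⟧ : ∀ n u c x → ⟦ ∂ {n} u (const c) ⟧ x ≡ 0#
  ⟦∂-const⟧ zero    u c x = refl
  ⟦∂-const⟧ (suc n) u c x = refl

  ⟦∂-scaleE⟧ : ∀ {n} u c (e : Expr n) x → ⟦ ∂ u (scaleE c e) ⟧ x ≡ c * ⟦ ∂ u e ⟧ x
  ⟦∂-scaleE⟧ {zero}  u c e           x = sym (zeroʳ c)
  ⟦∂-scaleE⟧ {suc n} u c (const d)   x = sym (zeroʳ c)
  ⟦∂-scaleE⟧ {suc n} u c (e ⊕ e′)    x rewrite ⟦∂-scaleE⟧ u c e x | ⟦∂-scaleE⟧ u c e′ x =
    solve 3 (λ c a b → c :* a :+ c :* b := c :* (a :+ b)) refl c (⟦ ∂ u e ⟧ x) (⟦ ∂ u e′ ⟧ x)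
  ⟦∂-scaleE⟧ {suc n} u c (var i ⊙ e) x
    rewrite ⟦∂-var⟧ u i (scaleE c e) x | ⟦∂-var⟧ u i e x | ⟦scaleE⟧ c e x | ⟦∂-scaleE⟧ u c e x =
    solve 5 (λ c a b X D → a :* (c :* b) :+ X :* (c :* D) := c :* (a :* b :+ X :* D)) refl
      c (coord i u) (⟦ e ⟧ x) (coord i x) (⟦ ∂ u e ⟧ x)

  ∂-linear : ∀ {n} a u b v (e : Expr n) x →
    ⟦ ∂ (a ·ᵥ u +ᵥ b ·ᵥ v) e ⟧ x ≡ a * ⟦ ∂ u e ⟧ x + b * ⟦ ∂ v e ⟧ x
  ∂-linear {zero}  a u b v e           x = solve 2 (λ a b → con (ℤ.+ 0) := a :* con (ℤ.+ 0) :+ b :* con (ℤ.+ 0)) refl a b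
  ∂-linear {suc n} a u b v (const c)   x = solve 2 (λ a b → con (ℤ.+ 0) := a :* con (ℤ.+ 0) :+ b :* con (ℤ.+ 0)) refl a b
  ∂-linear {suc n} a u b v (e ⊕ e′)    x rewrite ∂-linear a u b v e x | ∂-linear a u b v e′ x =
    solve 6 (λ a b p q r s → (a :* p :+ b :* q) :+ (a :* r :+ b :* s) := a :* (p :+ r) :+ b :* (q :+ s)) refl
      a b (⟦ ∂ u e ⟧ x) (⟦ ∂ v e ⟧ x) (⟦ ∂ u e′ ⟧ x) (⟦ ∂ v e′ ⟧ x)
  ∂-linear {suc n} a u b v (var i ⊙ e) x
    rewrite ⟦∂-var⟧ (a ·ᵥ u +ᵥ b ·ᵥ v) i e x | ⟦∂-var⟧ u i e x | ⟦∂-var⟧ v i e x | ∂-linear a u b v e x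
          | coord-+ᵥ i (a ·ᵥ u) (b ·ᵥ v) | coord-·ᵥ i a u | coord-·ᵥ i b v =
    solve 8 (λ a b p q y X r s →
      (a :* p :+ b :* q) :* y :+ X :* (a :* r :+ b :* s) := a :* (p :* y :+ X :* r) :+ b :* (q :* y :+ X :* s)) refl
      a b (coord i u) (coord i v) (⟦ e ⟧ x) (coord i x) (⟦ ∂ u e ⟧ x) (⟦ ∂ v e ⟧ x)

  ∂-comm : ∀ {n} u v (e : Expr n) x → ⟦ ∂ u (∂ v e) ⟧ x ≡ ⟦ ∂ v (∂ u e) ⟧ x
  ∂-comm {zero}        u v e           x = refl
  ∂-comm {suc zero}    u v e           x = refl
  ∂-comm {suc (suc n)} u v (const c)   x = refl
  ∂-comm {suc (suc n)} u v (e ⊕ e′)    x = cong₂ _+_ (∂-comm u v e x) (∂-comm u v e′ x)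
  ∂-comm {suc (suc n)} u v (var i ⊙ e) x
    rewrite ⟦∂-var⟧ u i (∂ v e) x | ⟦∂-var⟧ v i (∂ u e) x
          | ⟦∂-scaleE⟧ u (coord i v) e x | ⟦∂-scaleE⟧ v (coord i u) e x | ∂-comm u v e x =
    solve 6 (λ a b p q X r → a :* p :+ (b :* q :+ X :* r) := b :* q :+ (a :* p :+ X :* r)) refl
      (coord i v) (coord i u) (⟦ ∂ u e ⟧ x) (⟦ ∂ v e ⟧ x) (coord i x) (⟦ ∂ v (∂ u e) ⟧ x)

  restrict : ∀ {n} → Expr n → V → V → Poly
  restrict (const c)   b v = c ∷ []
  restrict (e ⊕ e′)    b v = restrict e b v ⊞ restrict e′ b v
  restrict (var i ⊙ e) b v = scale (coord i b) (restrict e b v) ⊞ (0# ∷ scale (coord i v) (restrict e b v))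

  length-restrict : ∀ {n} (e : Expr n) b v → length (restrict e b v) ℕ.≤ suc n
  length-restrict (const c)   b v = s≤s z≤n
  length-restrict (e ⊕ e′)    b v rewrite length-⊞ (restrict e b v) (restrict e′ b v) =
    ℕₚ.⊔-lub (length-restrict e b v) (length-restrict e′ b v)
  length-restrict (var i ⊙ e) b v
    rewrite length-⊞ (scale (coord i b) (restrict e b v)) (0# ∷ scale (coord i v) (restrict e b v))
          | length-map (coord i b *_) (restrict e b v) | length-map (coord i v *_) (restrict e b v) =
    ℕₚ.⊔-lub (ℕₚ.m≤n⇒m≤1+n (length-restrict e b v)) (s≤s (length-restrict e b v))

  eval-restrict : ∀ {n} (e : Expr n) b v t → eval (restrict e b v) t ≡ ⟦ e ⟧ (b +ᵥ t ·ᵥ v)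
  eval-restrict (const c)   b v t = solve 2 (λ c t → c :+ t :* con (ℤ.+ 0) := c) refl c t
  eval-restrict (e ⊕ e′)    b v t rewrite eval-⊞ (restrict e b v) (restrict e′ b v) t =
    cong₂ _+_ (eval-restrict e b v t) (eval-restrict e′ b v t)
  eval-restrict (var i ⊙ e) b v t
    rewrite eval-⊞ (scale (coord i b) (restrict e b v)) (0# ∷ scale (coord i v) (restrict e b v)) t
          | eval-scale (coord i b) (restrict e b v) t | eval-scale (coord i v) (restrict e b v) t
          | eval-restrict e b v t | coord-+ᵥ i b (t ·ᵥ v) | coord-·ᵥ i t v =
    solve 4 (λ B C t p → B :* p :+ (con (ℤ.+ 0) :+ t :* (C :* p)) := (B :+ t :* C) :* p) refl
      (coord i b) (coord i v) t (⟦ e ⟧ (b +ᵥ t ·ᵥ v))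

  -- The chain rule along a line, which links formal derivatives of coefficient lists to directional
  -- derivatives.
  deriv-restrict : ∀ {n} (e : Expr n) b v t → eval (deriv (restrict e b v)) t ≡ ⟦ ∂ v e ⟧ (b +ᵥ t ·ᵥ v)
  deriv-restrict {n} (const c)   b v t = sym (⟦∂-const⟧ n v c _)
  deriv-restrict (e ⊕ e′)    b v t
    rewrite deriv-⊞ (restrict e b v) (restrict e′ b v) t | ⟦∂-⊕⟧ v e e′ (b +ᵥ t ·ᵥ v) =
    cong₂ _+_ (deriv-restrict e b v t) (deriv-restrict e′ b v t)
  deriv-restrict (var i ⊙ e) b v t
    rewrite deriv-⊞ (scale (coord i b) (restrict e b v)) (0# ∷ scale (coord i v) (restrict e b v)) t
          | deriv-scale (coord i b) (restrict e b v) t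
          | eval-deriv-∷ 0# (scale (coord i v) (restrict e b v)) t
          | deriv-scale (coord i v) (restrict e b v) t
          | eval-scale (coord i v) (restrict e b v) t
          | ⟦∂-var⟧ v i e (b +ᵥ t ·ᵥ v)
          | eval-restrict e b v t | deriv-restrict e b v t | coord-+ᵥ i b (t ·ᵥ v) | coord-·ᵥ i t v =
    solve 5 (λ B C t p d → B :* d :+ (C :* p :+ t :* (C :* d)) := C :* p :+ (B :+ t :* C) :* d) refl
      (coord i b) (coord i v) t (⟦ e ⟧ (b +ᵥ t ·ᵥ v)) (⟦ ∂ v e ⟧ (b +ᵥ t ·ᵥ v))

  VanishesOn : ∀ {n} → Expr n → V → V → Set
  VanishesOn e b v = ∀ t → ⟦ e ⟧ (b +ᵥ t ·ᵥ v) ≡ 0#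

  -- The q zeros exceed the degree, so the restriction has only zero coefficients, and so has its
  -- derivative.
  ∂-vanishesOn : ∀ {n} (e : Expr n) b v → suc n ℕ.≤ q → VanishesOn e b v → VanishesOn (∂ v e) b v
  ∂-vanishesOn e b v n<q e≡0 t = trans (sym (deriv-restrict e b v t)) (eval-zero (deriv-zero
    (vanishing (restrict e b v) (ℕₚ.≤-trans (length-restrict e b v) n<q) (λ s → trans (eval-restrict e b v s) (e≡0 s)))) t)

  -- In degree below q a zero derivative kills every coefficient except the constant one.
  zero-gradient : ∀ {n} (e : Expr n) b v → suc n ℕ.≤ q → VanishesOn (∂ v e) b v → ∀ t → ⟦ e ⟧ (b +ᵥ t ·ᵥ v) ≡ ⟦ e ⟧ (b +ᵥ 0# ·ᵥ v)
  zero-gradient e b v n<q ∂e≡0 t with restrict e b v | length-restrict e b v | eval-restrict e b v | deriv-restrict e b v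
  ... | []    | _  | ev | _  = trans (sym (ev t)) (ev 0#)
  ... | a ∷ p | le | ev | dv = begin
    ⟦ e ⟧ (b +ᵥ t ·ᵥ v)   ≡⟨ ev t ⟨
    a + t * eval p t      ≡⟨ cong (λ y → a + t * y) (eval-zero p≡0 t) ⟩
    a + t * 0#            ≡⟨ solve 2 (λ a t → a :+ t :* con (ℤ.+ 0) := a :+ con (ℤ.+ 0) :* con (ℤ.+ 0)) refl a t ⟩
    a + 0# * 0#           ≡⟨ cong (λ y → a + 0# * y) (eval-zero p≡0 0#) ⟨
    a + 0# * eval p 0#    ≡⟨ ev 0# ⟩
    ⟦ e ⟧ (b +ᵥ 0# ·ᵥ v)  ∎
    where
    open ≡-Reasoning
    le′ = ℕₚ.≤-trans le n<q
    p≡0 : IsZero p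
    p≡0 = derivFrom-isZero 0 p le′ (vanishing (derivFrom 1 p)
      (ℕₚ.≤-trans (ℕₚ.≤-reflexive (length-derivFrom 1 p)) (ℕₚ.<⇒≤ le′)) (λ s → trans (dv s) (∂e≡0 s)))

-- Polynomials vanishing on lines

module Tangency {q : ℕ} (K : PrimeField q) where
  open FieldProperties K
  open Univariate K
  open Wronskian K
  open Trivariate K

  basis : Fin 3 → V
  basis 0F = 1# , 0# , 0#
  basis 1F = 0# , 1# , 0#
  basis 2F = 0# , 0# , 1#

  +ᵥ0·ᵥ : ∀ x v → x +ᵥ 0# ·ᵥ v ≡ x
  +ᵥ0·ᵥ (x₁ , x₂ , x₃) (v₁ , v₂ , v₃) = cong₂ _,_ (eq x₁ v₁) (cong₂ _,_ (eq x₂ v₂) (eq x₃ v₃))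
    where
    eq : ∀ x v → x + 0# * v ≡ x
    eq = solve 2 (λ x v → x :+ con (ℤ.+ 0) :* v := x) refl

  +ᵥ-+ᵥ : ∀ b t s v → b +ᵥ t ·ᵥ v +ᵥ s ·ᵥ v ≡ b +ᵥ (t + s) ·ᵥ v
  +ᵥ-+ᵥ (b₁ , b₂ , b₃) t s (v₁ , v₂ , v₃) = cong₂ _,_ (eq b₁ t s v₁) (cong₂ _,_ (eq b₂ t s v₂) (eq b₃ t s v₃))
    where
    eq : ∀ b t s v → b + t * v + s * v ≡ b + (t + s) * v
    eq = solve 4 (λ b t s v → b :+ t :* v :+ s :* v := b :+ (t :+ s) :* v) refl

  -- The gradient of f at x is treated as the linear form sending u to `⟦ ∂ u f ⟧ x`; its kernel is
  -- the tangent plane.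
  Linear : (V → Fin q) → Set
  Linear φ = ∀ a u b v → φ (a ·ᵥ u +ᵥ b ·ᵥ v) ≡ a * φ u + b * φ v

  ∂-Linear : ∀ {n} (f : Expr n) x → Linear (λ u → ⟦ ∂ u f ⟧ x)
  ∂-Linear f x a u b v = ∂-linear a u b v f x

  coord-lin : ∀ i → Linear (coord i)
  coord-lin i a u b v = trans (coord-+ᵥ i (a ·ᵥ u) (b ·ᵥ v)) (cong₂ _+_ (coord-·ᵥ i a u) (coord-·ᵥ i b v))

  linear-zero : ∀ {φ} → Linear φ → (∀ i → φ (basis i) ≡ 0#) → ∀ u → φ u ≡ 0#
  linear-zero {φ} φ-linear φ≡0 (u₁ , u₂ , u₃) = begin
    φ (u₁ , u₂ , u₃)
      ≡⟨ cong φ (cong₂ _,_ (eq₁ u₁ u₂ u₃) (cong₂ _,_ (eq₂ u₁ u₂ u₃) (eq₃ u₁ u₂ u₃))) ⟩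
    φ (1# ·ᵥ (u₁ ·ᵥ basis 0F +ᵥ u₂ ·ᵥ basis 1F) +ᵥ u₃ ·ᵥ basis 2F)
      ≡⟨ φ-linear 1# _ u₃ _ ⟩
    1# * φ (u₁ ·ᵥ basis 0F +ᵥ u₂ ·ᵥ basis 1F) + u₃ * φ (basis 2F)
      ≡⟨ cong₂ (λ s t → 1# * s + u₃ * t) (trans (φ-linear u₁ _ u₂ _) (cong₂ (λ s t → u₁ * s + u₂ * t) (φ≡0 0F) (φ≡0 1F))) (φ≡0 2F) ⟩
    1# * (u₁ * 0# + u₂ * 0#) + u₃ * 0#
      ≡⟨ solve 3 (λ a b c → con (ℤ.+ 1) :* (a :* con (ℤ.+ 0) :+ b :* con (ℤ.+ 0)) :+ c :* con (ℤ.+ 0) := con (ℤ.+ 0)) refl u₁ u₂ u₃ ⟩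
    0# ∎
    where
    open ≡-Reasoning
    eq₁ : ∀ a b c → a ≡ 1# * (a * 1# + b * 0#) + c * 0#
    eq₁ = solve 3 (λ a b c → a := con (ℤ.+ 1) :* (a :* con (ℤ.+ 1) :+ b :* con (ℤ.+ 0)) :+ c :* con (ℤ.+ 0)) refl
    eq₂ : ∀ a b c → b ≡ 1# * (a * 0# + b * 1#) + c * 0#
    eq₂ = solve 3 (λ a b c → b := con (ℤ.+ 1) :* (a :* con (ℤ.+ 0) :+ b :* con (ℤ.+ 1)) :+ c :* con (ℤ.+ 0)) refl
    eq₃ : ∀ a b c → c ≡ 1# * (a * 0# + b * 0#) + c * 1#
    eq₃ = solve 3 (λ a b c → c := con (ℤ.+ 1) :* (a :* con (ℤ.+ 0) :+ b :* con (ℤ.+ 0)) :+ c :* con (ℤ.+ 1)) refl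

  any-V? : ∀ {p} {P : Pred V p} → Decidable P → Dec (∃ P)
  any-V? P? = map′ (λ (a , b , c , p) → (a , b , c) , p) (λ ((a , b , c) , p) → a , b , c , p)
    (Finₚ.any? λ a → Finₚ.any? λ b → Finₚ.any? λ c → P? (a , b , c))

  noncritical? : ∀ {n} (f : Expr n) x → Dec (∃[ i ] ⟦ ∂ (basis i) f ⟧ x ≢ 0#)
  noncritical? f x = Finₚ.any? λ i → ¬? (⟦ ∂ (basis i) f ⟧ x ≟ 0#)

  critical⇒gradient≡0 : ∀ {n} (f : Expr n) x → ¬ (∃[ i ] ⟦ ∂ (basis i) f ⟧ x ≢ 0#) → ∀ u → ⟦ ∂ u f ⟧ x ≡ 0#
  critical⇒gradient≡0 f x none = linear-zero (∂-Linear f x) is0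
    where
    is0 : ∀ i → ⟦ ∂ (basis i) f ⟧ x ≡ 0#
    is0 i = decidable-stable (⟦ ∂ (basis i) f ⟧ x ≟ 0#) (λ ne → none (i , ne))

  constant : ∀ {n} (f : Expr n) → suc n ℕ.≤ q → (∀ x u → ⟦ ∂ u f ⟧ x ≡ 0#) → ∀ x y → ⟦ f ⟧ y ≡ ⟦ f ⟧ x
  constant f n<q ∂f≡0 x@(x₁ , x₂ , x₃) y@(y₁ , y₂ , y₃) = begin
    ⟦ f ⟧ y                 ≡⟨ cong ⟦ f ⟧ (cong₂ _,_ (eq x₁ y₁) (cong₂ _,_ (eq x₂ y₂) (eq x₃ y₃))) ⟩
    ⟦ f ⟧ (x +ᵥ 1# ·ᵥ d)    ≡⟨ zero-gradient f x d n<q (λ t → ∂f≡0 _ d) 1# ⟩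
    ⟦ f ⟧ (x +ᵥ 0# ·ᵥ d)    ≡⟨ cong ⟦ f ⟧ (+ᵥ0·ᵥ x d) ⟩
    ⟦ f ⟧ x                 ∎
    where
    open ≡-Reasoning
    d = y₁ + - x₁ , y₂ + - x₂ , y₃ + - x₃
    eq : ∀ x y → y ≡ x + 1# * (y + - x)
    eq = solve 2 (λ x y → y := x :+ con (ℤ.+ 1) :* (y :- x)) refl

  module _ {z} {Z : Pred V z} (Z? : Decidable Z) {x₀ : V} (x₀∈Z : Z x₀) where

    -- Differentiating lowers the degree, so it cannot go on producing nonzero polynomials that vanish on Z.
    noncritical : ∀ n (f : Expr n) → suc n ℕ.≤ q → (∀ x → Z x → ⟦ f ⟧ x ≡ 0#) → ∀ y → ⟦ f ⟧ y ≢ 0# →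
      Σ[ m ∈ ℕ ] Σ[ g ∈ Expr m ] (m ℕ.≤ n × (∀ x → Z x → ⟦ g ⟧ x ≡ 0#) ×
        (∃[ x ] (Z x × ∃[ i ] ⟦ ∂ (basis i) g ⟧ x ≢ 0#)))
    noncritical n f n<q f≡0 y fy≢0 with any-V? (λ x → Z? x ×-dec noncritical? f x)
    ... | yes found = n , f , ℕₚ.≤-refl , f≡0 , found
    ... | no  none  with any-V? (noncritical? f)
    -- A gradient that is zero everywhere makes f constant, equal to its value 0 at x₀, against f(y)
    -- ≠ 0.
    ...   | no  flat = ⊥-elim (fy≢0 (trans
                 (constant f n<q (λ x → critical⇒gradient≡0 f x (λ c → flat (x , c))) x₀ y) (f≡0 x₀ x₀∈Z)))
    noncritical zero    f n<q f≡0 y fy≢0 | no none | yes (x , i , ne) = ⊥-elim (ne refl)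
    noncritical (suc n) f n<q f≡0 y fy≢0 | no none | yes (x , i , ne)
      with m , g , m≤n , rest ← noncritical n (∂ (basis i) f) (ℕₚ.<⇒≤ n<q)
             (λ z z∈Z → decidable-stable (_ ≟ 0#) (λ nz → none (z , z∈Z , i , nz))) x ne
      = m , g , ℕₚ.m≤n⇒m≤1+n m≤n , rest

  -- Not symmetric: `0ᵥ` is parallel to every vector, but only `0ᵥ` is parallel to `0ᵥ`.
  Parallel : V → V → Set
  Parallel u v = ∃[ s ] u ≡ s ·ᵥ v

  cross : V → V → V
  cross (a₁ , a₂ , a₃) (b₁ , b₂ , b₃) = a₂ * b₃ + - (a₃ * b₂) , a₃ * b₁ + - (a₁ * b₃) , a₁ * b₂ + - (a₂ * b₁)

  nonzero-coord : ∀ {v} → v ≢ 0ᵥ → ∃[ i ] coord i v ≢ 0#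
  nonzero-coord {v@(v₁ , v₂ , v₃)} v≢0 with v₁ ≟ 0# | v₂ ≟ 0# | v₃ ≟ 0#
  ... | no ne    | _        | _        = 0F , ne
  ... | yes refl | no ne    | _        = 1F , ne
  ... | yes refl | yes refl | no ne    = 2F , ne
  ... | yes refl | yes refl | yes refl = ⊥-elim (v≢0 refl)

  cross-zero⇒parallel : ∀ {u v} → v ≢ 0ᵥ → cross u v ≡ 0ᵥ → Parallel u v
  cross-zero⇒parallel {u} {v} v≢0 eq = go (nonzero-coord v≢0)
    where
    minor : ∀ i j → coord i u * coord j v ≡ coord j u * coord i v
    minor 0F 0F = refl
    minor 0F 1F = x-y≡0⇒x≡y (cong (coord 2F) eq)
    minor 0F 2F = sym (x-y≡0⇒x≡y (cong (coord 1F) eq))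
    minor 1F 0F = sym (x-y≡0⇒x≡y (cong (coord 2F) eq))
    minor 1F 1F = refl
    minor 1F 2F = x-y≡0⇒x≡y (cong (coord 0F) eq)
    minor 2F 0F = x-y≡0⇒x≡y (cong (coord 1F) eq)
    minor 2F 1F = sym (x-y≡0⇒x≡y (cong (coord 0F) eq))
    minor 2F 2F = refl
    go : ∃[ i ] coord i v ≢ 0# → Parallel u v
    go (i , vi≢0) with vi⁻¹ , inv ← inverse (coord i v) vi≢0 = coord i u * vi⁻¹ , ext λ j → begin
      coord j u                          ≡⟨ *-identityˡ _ ⟨
      1# * coord j u                     ≡⟨ cong (_* coord j u) inv ⟨
      coord i v * vi⁻¹ * coord j u       ≡⟨ solve 3 (λ a b c → a :* b :* c := b :* (c :* a)) refl (coord i v) vi⁻¹ (coord j u) ⟩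
      vi⁻¹ * (coord j u * coord i v)     ≡⟨ cong (vi⁻¹ *_) (minor i j) ⟨
      vi⁻¹ * (coord i u * coord j v)     ≡⟨ solve 3 (λ a b c → a :* (b :* c) := b :* a :* c) refl vi⁻¹ (coord i u) (coord j v) ⟩
      coord i u * vi⁻¹ * coord j v       ≡⟨ coord-·ᵥ j (coord i u * vi⁻¹) v ⟨
      coord j (coord i u * vi⁻¹ ·ᵥ v)    ∎
      where open ≡-Reasoning

  det : V → V → V → Fin q
  det (u₁ , u₂ , u₃) (v₁ , v₂ , v₃) (w₁ , w₂ , w₃) =
    u₁ * (v₂ * w₃ + - (v₃ * w₂)) + v₁ * (w₂ * u₃ + - (w₃ * u₂)) + w₁ * (u₂ * v₃ + - (u₃ * v₂))

  -- This is coordinate j of (v × w)_k u + (w × u)_k v + (u × v)_k w = det(u, v, w) e_k, the product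
  -- of the matrix with columns u, v, w and its adjugate. Off the diagonal the left side is a
  -- determinant with two equal rows, isolated in `repeatedˡ` and `repeatedʳ`.
  expansion : ∀ k j u v w →
    coord j u * coord k (cross v w) + coord j v * coord k (cross w u) + coord j w * coord k (cross u v) ≡ det u v w * coord j (basis k)
  expansion k j (u₁ , u₂ , u₃) (v₁ , v₂ , v₃) (w₁ , w₂ , w₃) = go k j
    where
    D : Fin q
    D = u₁ * (v₂ * w₃ + - (v₃ * w₂)) + v₁ * (w₂ * u₃ + - (w₃ * u₂)) + w₁ * (u₂ * v₃ + - (u₃ * v₂))
    repeatedˡ : ∀ a b c x y z → a * (b * z + - (y * c)) + b * (c * x + - (z * a)) + c * (a * y + - (x * b)) ≡ D * 0#
    repeatedˡ a b c x y z = trans (solve 6 (λ a b c x y z →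
      a :* (b :* z :- y :* c) :+ b :* (c :* x :- z :* a) :+ c :* (a :* y :- x :* b) := con (ℤ.+ 0)) refl a b c x y z) (sym (zeroʳ D))
    repeatedʳ : ∀ a b c x y z → a * (y * c + - (b * z)) + b * (z * a + - (c * x)) + c * (x * b + - (a * y)) ≡ D * 0#
    repeatedʳ a b c x y z = trans (solve 6 (λ a b c x y z →
      a :* (y :* c :- b :* z) :+ b :* (z :* a :- c :* x) :+ c :* (x :* b :- a :* y) := con (ℤ.+ 0)) refl a b c x y z) (sym (zeroʳ D))
    go : ∀ k j → coord j (u₁ , u₂ , u₃) * coord k (cross (v₁ , v₂ , v₃) (w₁ , w₂ , w₃))
      + coord j (v₁ , v₂ , v₃) * coord k (cross (w₁ , w₂ , w₃) (u₁ , u₂ , u₃))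
      + coord j (w₁ , w₂ , w₃) * coord k (cross (u₁ , u₂ , u₃) (v₁ , v₂ , v₃)) ≡ D * coord j (basis k)
    go 0F 0F = solve 1 (λ d → d := d :* con (ℤ.+ 1)) refl D
    go 1F 1F = solve 9 (λ u₁ u₂ u₃ v₁ v₂ v₃ w₁ w₂ w₃ →
      u₂ :* (v₃ :* w₁ :- v₁ :* w₃) :+ v₂ :* (w₃ :* u₁ :- w₁ :* u₃) :+ w₂ :* (u₃ :* v₁ :- u₁ :* v₃) :=
      (u₁ :* (v₂ :* w₃ :- v₃ :* w₂) :+ v₁ :* (w₂ :* u₃ :- w₃ :* u₂) :+ w₁ :* (u₂ :* v₃ :- u₃ :* v₂)) :* con (ℤ.+ 1))
      refl u₁ u₂ u₃ v₁ v₂ v₃ w₁ w₂ w₃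
    go 2F 2F = solve 9 (λ u₁ u₂ u₃ v₁ v₂ v₃ w₁ w₂ w₃ →
      u₃ :* (v₁ :* w₂ :- v₂ :* w₁) :+ v₃ :* (w₁ :* u₂ :- w₂ :* u₁) :+ w₃ :* (u₁ :* v₂ :- u₂ :* v₁) :=
      (u₁ :* (v₂ :* w₃ :- v₃ :* w₂) :+ v₁ :* (w₂ :* u₃ :- w₃ :* u₂) :+ w₁ :* (u₂ :* v₃ :- u₃ :* v₂)) :* con (ℤ.+ 1))
      refl u₁ u₂ u₃ v₁ v₂ v₃ w₁ w₂ w₃
    go 0F 1F = repeatedˡ u₂ v₂ w₂ u₃ v₃ w₃
    go 0F 2F = repeatedʳ u₃ v₃ w₃ u₂ v₂ w₂
    go 1F 2F = repeatedˡ u₃ v₃ w₃ u₁ v₁ w₁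
    go 1F 0F = repeatedʳ u₁ v₁ w₁ u₃ v₃ w₃
    go 2F 0F = repeatedˡ u₁ v₁ w₁ u₂ v₂ w₂
    go 2F 1F = repeatedʳ u₂ v₂ w₂ u₁ v₁ w₁

  -- The kernel of a nonzero form is a plane. Applying `φ` to the adjugate identity gives det ·
  -- φ(e_i) = 0, so the determinant vanishes. The identity then becomes a linear relation between u,
  -- v and w whose coefficient at w is a coordinate of u × v, nonzero for a suitable k.
  span : ∀ {φ} → Linear φ → ∃[ i ] φ (basis i) ≢ 0# → ∀ {u v} w → v ≢ 0ᵥ → ¬ Parallel u v →
    φ u ≡ 0# → φ v ≡ 0# → φ w ≡ 0# → ∃[ α ] ∃[ β ] w ≡ α ·ᵥ u +ᵥ β ·ᵥ v
  span {φ} φ-linear (i , φi≢0) {u} {v} w v≢0 u∦v φu≡0 φv≡0 φw≡0 =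
    solution (nonzero-coord (λ eq → u∦v (cross-zero⇒parallel v≢0 eq)))
    where
    open ≡-Reasoning
    combination : Fin 3 → V
    combination k = 1# ·ᵥ (coord k (cross v w) ·ᵥ u +ᵥ coord k (cross w u) ·ᵥ v) +ᵥ coord k (cross u v) ·ᵥ w
    -- The summand with coefficient `0#` gives the right side the two-term shape that `Linear`
    -- speaks of.
    combination≡ : ∀ k → combination k ≡ det u v w ·ᵥ basis k +ᵥ 0# ·ᵥ basis k
    combination≡ k = ext λ j → begin
      coord j (combination k)
        ≡⟨ coord-lin j 1# _ (coord k (cross u v)) w ⟩
      1# * coord j (coord k (cross v w) ·ᵥ u +ᵥ coord k (cross w u) ·ᵥ v) + coord k (cross u v) * coord j w
        ≡⟨ cong (λ y → 1# * y + coord k (cross u v) * coord j w) (coord-lin j (coord k (cross v w)) u (coord k (cross w u)) v) ⟩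
      1# * (coord k (cross v w) * coord j u + coord k (cross w u) * coord j v) + coord k (cross u v) * coord j w
        ≡⟨ solve 6 (λ A x B y C z → con (ℤ.+ 1) :* (A :* x :+ B :* y) :+ C :* z := x :* A :+ y :* B :+ z :* C) refl
             (coord k (cross v w)) (coord j u) (coord k (cross w u)) (coord j v) (coord k (cross u v)) (coord j w) ⟩
      coord j u * coord k (cross v w) + coord j v * coord k (cross w u) + coord j w * coord k (cross u v)
        ≡⟨ expansion k j u v w ⟩
      det u v w * coord j (basis k)
        ≡⟨ solve 2 (λ d b → d :* b := d :* b :+ con (ℤ.+ 0) :* b) refl (det u v w) (coord j (basis k)) ⟩
      det u v w * coord j (basis k) + 0# * coord j (basis k)
        ≡⟨ coord-lin j (det u v w) (basis k) 0# (basis k) ⟨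
      coord j (det u v w ·ᵥ basis k +ᵥ 0# ·ᵥ basis k) ∎
    φ-zero : ∀ a {x} b {y} → φ x ≡ 0# → φ y ≡ 0# → φ (a ·ᵥ x +ᵥ b ·ᵥ y) ≡ 0#
    φ-zero a {x} b {y} φx≡0 φy≡0 = trans (φ-linear a x b y) (trans (cong₂ (λ s t → a * s + b * t) φx≡0 φy≡0)
      (solve 2 (λ a b → a :* con (ℤ.+ 0) :+ b :* con (ℤ.+ 0) := con (ℤ.+ 0)) refl a b))
    det≡0 : det u v w ≡ 0#
    det≡0 = *-nonzeroˡ φi≢0 (begin
      φ (basis i) * det u v w
        ≡⟨ solve 2 (λ a d → a :* d := d :* a :+ con (ℤ.+ 0) :* a) refl (φ (basis i)) (det u v w) ⟩
      det u v w * φ (basis i) + 0# * φ (basis i)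
        ≡⟨ φ-linear (det u v w) (basis i) 0# (basis i) ⟨
      φ (det u v w ·ᵥ basis i +ᵥ 0# ·ᵥ basis i)
        ≡⟨ cong φ (combination≡ i) ⟨
      φ (combination i)
        ≡⟨ φ-zero 1# (coord i (cross u v)) (φ-zero (coord i (cross v w)) (coord i (cross w u)) φu≡0 φv≡0) φw≡0 ⟩
      0# ∎)
    module _ (k : Fin 3) (n⁻¹ : Fin q) (inv : coord k (cross u v) * n⁻¹ ≡ 1#) where
      A = coord k (cross v w)
      B = coord k (cross w u)
      C = coord k (cross u v)
      relation : ∀ j → coord j u * A + coord j v * B + coord j w * C ≡ 0#
      relation j = trans (expansion k j u v w) (trans (cong (_* coord j (basis k)) det≡0) (zeroˡ _))
      solved : ∀ j → coord j w ≡ coord j (- (n⁻¹ * A) ·ᵥ u +ᵥ - (n⁻¹ * B) ·ᵥ v)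
      solved j = x-y≡0⇒x≡y (begin
        coord j w + - coord j (- (n⁻¹ * A) ·ᵥ u +ᵥ - (n⁻¹ * B) ·ᵥ v)
          ≡⟨ cong₂ (λ x y → x + - y) (trans (sym (*-identityˡ _)) (cong (_* coord j w) (sym inv)))
               (coord-lin j (- (n⁻¹ * A)) u (- (n⁻¹ * B)) v) ⟩
        C * n⁻¹ * coord j w + - (- (n⁻¹ * A) * coord j u + - (n⁻¹ * B) * coord j v)
          ≡⟨ solve 7 (λ n A B C x y z → C :* n :* z :- ((:- (n :* A)) :* x :+ (:- (n :* B)) :* y) := n :* (x :* A :+ y :* B :+ z :* C))
               refl n⁻¹ A B C (coord j u) (coord j v) (coord j w) ⟩
        n⁻¹ * (coord j u * A + coord j v * B + coord j w * C)
          ≡⟨ trans (cong (n⁻¹ *_) (relation j)) (zeroʳ n⁻¹) ⟩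
        0# ∎)
    solution : ∃[ k ] coord k (cross u v) ≢ 0# → ∃[ α ] ∃[ β ] w ≡ α ·ᵥ u +ᵥ β ·ᵥ v
    solution (k , nk≢0) with inverse (coord k (cross u v)) nk≢0
    ... | n⁻¹ , inv = - (n⁻¹ * coord k (cross v w)) , - (n⁻¹ * coord k (cross w u)) , ext (solved k n⁻¹ inv)

  ∂∂-linear : ∀ {n} y a u b v (e : Expr n) x →
    ⟦ ∂ y (∂ (a ·ᵥ u +ᵥ b ·ᵥ v) e) ⟧ x ≡ a * ⟦ ∂ y (∂ u e) ⟧ x + b * ⟦ ∂ y (∂ v e) ⟧ x
  ∂∂-linear y a u b v e x = begin
    ⟦ ∂ y (∂ (a ·ᵥ u +ᵥ b ·ᵥ v) e) ⟧ x              ≡⟨ ∂-comm y _ e x ⟩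
    ⟦ ∂ (a ·ᵥ u +ᵥ b ·ᵥ v) (∂ y e) ⟧ x              ≡⟨ ∂-linear a u b v (∂ y e) x ⟩
    a * ⟦ ∂ u (∂ y e) ⟧ x + b * ⟦ ∂ v (∂ y e) ⟧ x   ≡⟨ cong₂ (λ s t → a * s + b * t) (∂-comm u y e x) (∂-comm v y e x) ⟩
    a * ⟦ ∂ y (∂ u e) ⟧ x + b * ⟦ ∂ y (∂ v e) ⟧ x   ∎
    where open ≡-Reasoning

  kernel-span : ∀ {n} (f : Expr n) x {y} → ⟦ ∂ y f ⟧ x ≢ 0# → ∀ {u v} → v ≢ 0ᵥ → ¬ Parallel u v →
    ⟦ ∂ u f ⟧ x ≡ 0# → ⟦ ∂ v f ⟧ x ≡ 0# → ∀ w → ⟦ ∂ w f ⟧ x ≡ 0# → ∃[ α ] ∃[ β ] w ≡ α ·ᵥ u +ᵥ β ·ᵥ v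
  kernel-span f x {y} ne v≢0 u∦v u∈ v∈ w w∈ with noncritical? f x
  ... | yes basis≢0 = span (∂-Linear f x) basis≢0 w v≢0 u∦v u∈ v∈ w∈
  ... | no  none    = ⊥-elim (ne (critical⇒gradient≡0 f x none y))

  module _ {n : ℕ} (f : Expr n) (n<q : suc n ℕ.≤ q) (x : V) where

    tangent : ∀ {y} → VanishesOn f x y → ⟦ ∂ y f ⟧ x ≡ 0#
    tangent {y} f≡0 = trans (cong ⟦ ∂ y f ⟧ (sym (+ᵥ0·ᵥ x y))) (∂-vanishesOn f x y n<q f≡0 0#)

    second-tangent : ∀ {y} → VanishesOn f x y → ⟦ ∂ y (∂ y f) ⟧ x ≡ 0#
    second-tangent {y} f≡0 = trans (cong ⟦ ∂ y (∂ y f) ⟧ (sym (+ᵥ0·ᵥ x y)))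
      (∂-vanishesOn (∂ y f) x y (ℕₚ.≤-trans (s≤s ℕₚ.pred[n]≤n) n<q) (∂-vanishesOn f x y n<q f≡0) 0#)

    module _ (2<q : 2 ℕ.< q) {u v w : V} (v≢0 : v ≢ 0ᵥ)
             (u∦v : ¬ Parallel u v) (w∦u : ¬ Parallel w u) (w∦v : ¬ Parallel w v)
             (f≡0-u : VanishesOn f x u) (f≡0-v : VanishesOn f x v) (f≡0-w : VanishesOn f x w) where

      -- The second fundamental form vanishes in three directions of the tangent plane, hence on all of it.
      mixed≡0 : ∀ {y} → ⟦ ∂ y f ⟧ x ≢ 0# → ⟦ ∂ v (∂ u f) ⟧ x ≡ 0#
      mixed≡0 ne with α , β , refl ← kernel-span f x ne v≢0 u∦v (tangent f≡0-u) (tangent f≡0-v) w (tangent f≡0-w) =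
        -- Along w = α u + β v the second derivative is 2 α β times the mixed one, since those along
        -- u and v vanish.
        *-nonzeroˡ (nat≢0 1 2<q) (*-nonzeroˡ β≢0 (*-nonzeroˡ α≢0 (trans (sym form) (second-tangent f≡0-w))))
        where
        open ≡-Reasoning
        α≢0 : α ≢ 0#
        α≢0 refl = w∦v (β , ext λ i → trans (coord-+ᵥ i (0# ·ᵥ u) _)
          (trans (cong (_+ coord i (β ·ᵥ v)) (trans (coord-·ᵥ i 0# u) (zeroˡ _))) (+-identityˡ _)))
        β≢0 : β ≢ 0#
        β≢0 refl = w∦u (α , ext λ i → trans (coord-+ᵥ i _ (0# ·ᵥ v))
          (trans (cong (coord i (α ·ᵥ u) +_) (trans (coord-·ᵥ i 0# v) (zeroˡ _))) (+-identityʳ _)))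
        form : ⟦ ∂ (α ·ᵥ u +ᵥ β ·ᵥ v) (∂ (α ·ᵥ u +ᵥ β ·ᵥ v) f) ⟧ x ≡ α * (β * (nat 2 * ⟦ ∂ v (∂ u f) ⟧ x))
        form = begin
          ⟦ ∂ (α ·ᵥ u +ᵥ β ·ᵥ v) (∂ (α ·ᵥ u +ᵥ β ·ᵥ v) f) ⟧ x
            ≡⟨ ∂-linear α u β v (∂ (α ·ᵥ u +ᵥ β ·ᵥ v) f) x ⟩
          α * ⟦ ∂ u (∂ (α ·ᵥ u +ᵥ β ·ᵥ v) f) ⟧ x + β * ⟦ ∂ v (∂ (α ·ᵥ u +ᵥ β ·ᵥ v) f) ⟧ x
            ≡⟨ cong₂ (λ a b → α * a + β * b) (∂∂-linear u α u β v f x) (∂∂-linear v α u β v f x) ⟩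
          α * (α * ⟦ ∂ u (∂ u f) ⟧ x + β * ⟦ ∂ u (∂ v f) ⟧ x) + β * (α * ⟦ ∂ v (∂ u f) ⟧ x + β * ⟦ ∂ v (∂ v f) ⟧ x)
            ≡⟨ cong₂ (λ a b → α * a + β * b)
                 (cong₂ (λ a b → α * a + β * b) (second-tangent f≡0-u) (∂-comm u v f x))
                 (cong (λ b → α * ⟦ ∂ v (∂ u f) ⟧ x + β * b) (second-tangent f≡0-v)) ⟩
          α * (α * 0# + β * ⟦ ∂ v (∂ u f) ⟧ x) + β * (α * ⟦ ∂ v (∂ u f) ⟧ x + β * 0#)
            ≡⟨ solve 3 (λ a b m → a :* (a :* con (ℤ.+ 0) :+ b :* m) :+ b :* (a :* m :+ b :* con (ℤ.+ 0)) :=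
                 a :* (b :* ((con (ℤ.+ 1) :+ (con (ℤ.+ 1) :+ con (ℤ.+ 0))) :* m))) refl α β _ ⟩
          α * (β * (nat 2 * ⟦ ∂ v (∂ u f) ⟧ x)) ∎

      -- The direction e = (∂y f) z - (∂z f) y lies in the kernel of the gradient, which u and v
      -- span. The Hessian pairs v with both u and v to zero, hence also with e, and expanding e
      -- gives the identity. At a critical point both sides are zero.
      wronskian≡0 : ∀ y z → ⟦ ∂ y f ⟧ x * ⟦ ∂ v (∂ z f) ⟧ x ≡ ⟦ ∂ v (∂ y f) ⟧ x * ⟦ ∂ z f ⟧ x
      wronskian≡0 y z with noncritical? f x
      ... | no none = trans (trans (cong (_* ⟦ ∂ v (∂ z f) ⟧ x) (critical⇒gradient≡0 f x none y)) (zeroˡ _))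
                        (sym (trans (cong (⟦ ∂ v (∂ y f) ⟧ x *_) (critical⇒gradient≡0 f x none z)) (zeroʳ _)))
      ... | yes (i , ne) = go (kernel-span f x ne v≢0 u∦v (tangent f≡0-u) (tangent f≡0-v) e e∈ker)
        where
        open ≡-Reasoning
        e = ⟦ ∂ y f ⟧ x ·ᵥ z +ᵥ - ⟦ ∂ z f ⟧ x ·ᵥ y
        e∈ker : ⟦ ∂ e f ⟧ x ≡ 0#
        e∈ker = trans (∂-linear (⟦ ∂ y f ⟧ x) z (- ⟦ ∂ z f ⟧ x) y f x)
          (solve 2 (λ a b → a :* b :+ (:- b) :* a := con (ℤ.+ 0)) refl (⟦ ∂ y f ⟧ x) (⟦ ∂ z f ⟧ x))
        go : ∃[ α ] ∃[ β ] e ≡ α ·ᵥ u +ᵥ β ·ᵥ v → ⟦ ∂ y f ⟧ x * ⟦ ∂ v (∂ z f) ⟧ x ≡ ⟦ ∂ v (∂ y f) ⟧ x * ⟦ ∂ z f ⟧ x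
        go (α , β , e≡) = x-y≡0⇒x≡y (begin
          ⟦ ∂ y f ⟧ x * ⟦ ∂ v (∂ z f) ⟧ x + - (⟦ ∂ v (∂ y f) ⟧ x * ⟦ ∂ z f ⟧ x)
            ≡⟨ solve 4 (λ a b c d → a :* b :- c :* d := a :* b :+ (:- d) :* c) refl _ _ _ _ ⟩
          ⟦ ∂ y f ⟧ x * ⟦ ∂ v (∂ z f) ⟧ x + - ⟦ ∂ z f ⟧ x * ⟦ ∂ v (∂ y f) ⟧ x
            ≡⟨ ∂∂-linear v (⟦ ∂ y f ⟧ x) z (- ⟦ ∂ z f ⟧ x) y f x ⟨
          ⟦ ∂ v (∂ e f) ⟧ x
            ≡⟨ cong (λ w → ⟦ ∂ v (∂ w f) ⟧ x) e≡ ⟩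
          ⟦ ∂ v (∂ (α ·ᵥ u +ᵥ β ·ᵥ v) f) ⟧ x
            ≡⟨ ∂∂-linear v α u β v f x ⟩
          α * ⟦ ∂ v (∂ u f) ⟧ x + β * ⟦ ∂ v (∂ v f) ⟧ x
            ≡⟨ cong₂ (λ a b → α * a + β * b) (mixed≡0 ne) (second-tangent f≡0-v) ⟩
          α * 0# + β * 0#
            ≡⟨ solve 2 (λ a b → a :* con (ℤ.+ 0) :+ b :* con (ℤ.+ 0) := con (ℤ.+ 0)) refl α β ⟩
          0# ∎)

  -- Two further lines through `x` on which `f` vanishes, their directions and `v` pairwise not
  -- parallel: the data for `wronskian≡0`.
  Rich : ∀ {n} → Expr n → V → V → Set
  Rich f v x = ∃[ u ] ∃[ w ] (¬ Parallel u v × ¬ Parallel w u × ¬ Parallel w v × VanishesOn f x u × VanishesOn f x w)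

  -- Along a line with many rich points the Wronskians of the components of the gradient vanish, so the
  -- direction of the gradient is constant.
  tangent-plane-constant : ∀ {n} (f : Expr n) b v → v ≢ 0ᵥ → 2 ℕ.+ (suc n ℕ.+ suc n) ℕ.≤ q → VanishesOn f b v →
    ∀ ts → Unique ts → suc n ℕ.+ suc n ℕ.≤ length ts → All (λ t → Rich f v (b +ᵥ t ·ᵥ v)) ts →
    ∀ e → ⟦ ∂ e f ⟧ b ≢ 0# → ∀ t y → ⟦ ∂ e f ⟧ (b +ᵥ t ·ᵥ v) ≢ 0# → ⟦ ∂ y f ⟧ (b +ᵥ t ·ᵥ v) ≡ 0# → ⟦ ∂ y f ⟧ b ≡ 0#
  tangent-plane-constant {n} f b v v≢0 le f≡0 ts uni enough rich e ge≢0 t y gt≢0 yt≡0 =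
    *-nonzeroˡ gt≢0 (begin
      ⟦ ∂ e f ⟧ (b +ᵥ t ·ᵥ v) * ⟦ ∂ y f ⟧ b
        ≡⟨ solve 3 (λ a b c → b :* c := :- (a :* con (ℤ.+ 0) :+ (:- c) :* b)) refl (⟦ ∂ e f ⟧ b) _ _ ⟩
      - (⟦ ∂ e f ⟧ b * 0# + - ⟦ ∂ y f ⟧ b * ⟦ ∂ e f ⟧ (b +ᵥ t ·ᵥ v))
        ≡⟨ cong (λ s → - (⟦ ∂ e f ⟧ b * s + - ⟦ ∂ y f ⟧ b * ⟦ ∂ e f ⟧ (b +ᵥ t ·ᵥ v))) yt≡0 ⟨
      - (⟦ ∂ e f ⟧ b * ⟦ ∂ y f ⟧ (b +ᵥ t ·ᵥ v) + - ⟦ ∂ y f ⟧ b * ⟦ ∂ e f ⟧ (b +ᵥ t ·ᵥ v))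
        ≡⟨ cong -_ (∂-linear (⟦ ∂ e f ⟧ b) y (- ⟦ ∂ y f ⟧ b) e f (b +ᵥ t ·ᵥ v)) ⟨
      - ⟦ ∂ z f ⟧ (b +ᵥ t ·ᵥ v)
        ≡⟨ cong -_ (trans (sym (eval-restrict (∂ z f) b v t)) (r≡0 t)) ⟩
      - 0#
        ≡⟨ solve 0 (:- con (ℤ.+ 0) := con (ℤ.+ 0)) refl ⟩
      0# ∎)
    where
    open ≡-Reasoning
    -- Chosen so that the derivative along z vanishes at b. Once it vanishes on the whole line,
    -- f_e(b) f_y(t) = f_y(b) f_e(t), and f_y(t) = 0 with f_e(t) ≠ 0 gives f_y(b) = 0.
    z = ⟦ ∂ e f ⟧ b ·ᵥ y +ᵥ - ⟦ ∂ y f ⟧ b ·ᵥ e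
    z≡0 : ⟦ ∂ z f ⟧ b ≡ 0#
    z≡0 = trans (∂-linear (⟦ ∂ e f ⟧ b) y (- ⟦ ∂ y f ⟧ b) e f b)
      (solve 2 (λ a c → a :* c :+ (:- c) :* a := con (ℤ.+ 0)) refl (⟦ ∂ e f ⟧ b) (⟦ ∂ y f ⟧ b))
    g = restrict (∂ e f) b v
    r = restrict (∂ z f) b v
    n<q : suc n ℕ.≤ q
    n<q = ℕₚ.≤-trans (ℕₚ.m≤n+m _ (2 ℕ.+ suc n)) le
    2<q : 2 ℕ.< q
    2<q = ℕₚ.≤-trans (s≤s (s≤s (s≤s z≤n))) le
    length-∂ : ∀ u → length (restrict (∂ u f) b v) ℕ.≤ suc n
    length-∂ u = ℕₚ.≤-trans (length-restrict (∂ u f) b v) (s≤s ℕₚ.pred[n]≤n)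
    length-deriv-∂ : ∀ u → length (deriv (restrict (∂ u f) b v)) ℕ.≤ suc n
    length-deriv-∂ u = ℕₚ.≤-trans (ℕₚ.≤-reflexive (length-deriv (restrict (∂ u f) b v))) (ℕₚ.≤-trans ℕₚ.pred[n]≤n (length-∂ u))
    vanishes-at : ∀ t → VanishesOn f (b +ᵥ t ·ᵥ v) v
    vanishes-at t s = trans (cong ⟦ f ⟧ (+ᵥ-+ᵥ b t s v)) (f≡0 (t + s))
    W : Fin q → Fin q
    W t = eval g t * eval (deriv r) t + - (eval (deriv g) t * eval r t)
    W≡0-rich : ∀ {t} → Rich f v (b +ᵥ t ·ᵥ v) → W t ≡ 0#
    W≡0-rich {t} (u , w , u∦v , w∦u , w∦v , f≡0-u , f≡0-w) = x≡y⇒x-y≡0 (begin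
      eval g t * eval (deriv r) t
        ≡⟨ cong₂ _*_ (eval-restrict (∂ e f) b v t) (deriv-restrict (∂ z f) b v t) ⟩
      ⟦ ∂ e f ⟧ (b +ᵥ t ·ᵥ v) * ⟦ ∂ v (∂ z f) ⟧ (b +ᵥ t ·ᵥ v)
        ≡⟨ wronskian≡0 f n<q (b +ᵥ t ·ᵥ v) 2<q v≢0 u∦v w∦u w∦v f≡0-u (vanishes-at t) f≡0-w e z ⟩
      ⟦ ∂ v (∂ e f) ⟧ (b +ᵥ t ·ᵥ v) * ⟦ ∂ z f ⟧ (b +ᵥ t ·ᵥ v)
        ≡⟨ cong₂ _*_ (deriv-restrict (∂ e f) b v t) (eval-restrict (∂ z f) b v t) ⟨
      eval (deriv g) t * eval r t ∎)
    W≡0 : ∀ t → W t ≡ 0#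
    -- Each product of two lists of length at most n + 1 has length at most 2n + 2, and that many
    -- rich parameters are supplied.
    W≡0 = roots-hasDegree
      (minus-hasDegree
        (*-hasDegree (g , length-∂ e , λ _ → refl) (deriv r , length-deriv-∂ z , λ _ → refl))
        (*-hasDegree (deriv g , length-deriv-∂ e , λ _ → refl) (r , length-∂ z , λ _ → refl)))
      ts uni (All.map W≡0-rich rich) enough
    at0 : ∀ u → eval (restrict (∂ u f) b v) 0# ≡ ⟦ ∂ u f ⟧ b
    at0 u = trans (eval-restrict (∂ u f) b v 0#) (cong ⟦ ∂ u f ⟧ (+ᵥ0·ᵥ b v))
    r≡0 : ∀ t → eval r t ≡ 0#
    r≡0 = wronskian-zero g r (λ eq → ge≢0 (trans (sym (at0 e)) eq)) (trans (at0 z) z≡0)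
      (ℕₚ.≤-trans (s≤s (s≤s (ℕₚ.+-mono-≤ (length-∂ e) (length-∂ z)))) le) (λ t → x-y≡0⇒x≡y (W≡0 t))

-- Nonzero polynomials vanishing on few points

funToFin-cong : ∀ {m n} {f g : Fin m → Fin n} → (∀ i → f i ≡ g i) → funToFin f ≡ funToFin g
funToFin-cong {zero}  eq = refl
funToFin-cong {suc m} eq = cong₂ combine (eq zero) (funToFin-cong (λ i → eq (suc i)))

module Interpolation {q : ℕ} (K : PrimeField q) where
  open FieldProperties K
  open Univariate K
  open Trivariate K
  open Tangency K

  raiseBy : ∀ {m} n → Expr m → Expr (n ℕ.+ m)
  raiseBy zero    e = e
  raiseBy (suc n) e = raise (raiseBy n e)

  ⟦raiseBy⟧ : ∀ {m} n (e : Expr m) x → ⟦ raiseBy n e ⟧ x ≡ ⟦ e ⟧ x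
  ⟦raiseBy⟧ zero    e x = refl
  ⟦raiseBy⟧ (suc n) e x = trans (⟦raise⟧ (raiseBy n e) x) (⟦raiseBy⟧ n e x)

  horner : ∀ {m} → Fin 3 → ∀ n → (Fin n → Expr m) → Expr (n ℕ.+ m)
  horner i zero    c = const 0#
  horner i (suc n) c = raiseBy (suc n) (c zero) ⊕ (var i ⊙ horner i n (c ∘ suc))

  ⟦horner⟧ : ∀ {m} i n (c : Fin n → Expr m) x → ⟦ horner i n c ⟧ x ≡ eval (tabulate (λ j → ⟦ c j ⟧ x)) (coord i x)
  ⟦horner⟧ i zero    c x = refl
  ⟦horner⟧ i (suc n) c x = cong₂ _+_ (⟦raiseBy⟧ (suc n) (c zero) x) (cong (coord i x *_) (⟦horner⟧ i n (c ∘ suc) x))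

  eval-tabulate-minus : ∀ {n} (f g : Fin n → Fin q) x →
    eval (tabulate f) x + - eval (tabulate g) x ≡ eval (tabulate (λ i → f i + - g i)) x
  eval-tabulate-minus {zero}  f g x = x≡y⇒x-y≡0 refl
  eval-tabulate-minus {suc n} f g x =
    trans (solve 5 (λ a b x F G → (a :+ x :* F) :- (b :+ x :* G) := (a :- b) :+ x :* (F :- G)) refl
             (f zero) (g zero) x _ _)
      (cong (λ e → f zero + - g zero + x * e) (eval-tabulate-minus (f ∘ suc) (g ∘ suc) x))

  eval-cong : ∀ {n} {f g : Fin n → Fin q} x → (∀ i → f i ≡ g i) → eval (tabulate f) x ≡ eval (tabulate g) x
  eval-cong x eq = cong (λ p → eval p x) (tabulate-cong eq)

  module _ (n : ℕ) (n≤q : n ℕ.≤ q) where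

    Coefficients : Set
    Coefficients = Fin n → Fin n → Fin n → Fin q

    value : Coefficients → V → Fin q
    value c (x , y , z) = eval (tabulate λ i → eval (tabulate λ j → eval (tabulate λ k → c i j k) z) y) x

    expr : Coefficients → Expr (n ℕ.+ (n ℕ.+ (n ℕ.+ 0)))
    expr c = horner 0F n λ i → horner 1F n λ j → horner 2F n λ k → const (c i j k)

    ⟦expr⟧ : ∀ c x → ⟦ expr c ⟧ x ≡ value c x
    ⟦expr⟧ c p@(x , y , z) =
      trans (⟦horner⟧ 0F n (λ i → horner 1F n λ j → horner 2F n λ k → const (c i j k)) p) (eval-cong x λ i →
      trans (⟦horner⟧ 1F n (λ j → horner 2F n λ k → const (c i j k)) p) (eval-cong y λ j →
      ⟦horner⟧ 2F n (λ k → const (c i j k)) p))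

    value-minus : ∀ c d x → value c x + - value d x ≡ value (λ i j k → c i j k + - d i j k) x
    value-minus c d (x , y , z) =
      trans (eval-tabulate-minus (λ i → eval (tabulate λ j → eval (tabulate (c i j)) z) y)
                                 (λ i → eval (tabulate λ j → eval (tabulate (d i j)) z) y) x) (eval-cong x λ i →
      trans (eval-tabulate-minus (λ j → eval (tabulate (c i j)) z) (λ j → eval (tabulate (d i j)) z) y) (eval-cong y λ j →
      eval-tabulate-minus (c i j) (d i j) z))

    vanishing-tabulate : (f : Fin n → Fin q) → (∀ x → eval (tabulate f) x ≡ 0#) → ∀ i → f i ≡ 0#
    vanishing-tabulate f eq = Allₚ.tabulate⁻ (vanishing (tabulate f) (subst (ℕ._≤ q) (sym (length-tabulate f)) n≤q) eq)

    -- Every variable has degree below n ≤ q, so the variables can be peeled off one at a time by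
    -- the univariate statement.
    value-zero : ∀ c → (∀ x → value c x ≡ 0#) → ∀ i j k → c i j k ≡ 0#
    value-zero c eq i j = vanishing-tabulate (c i j) λ z →
      vanishing-tabulate _ (λ y → vanishing-tabulate _ (λ x → eq (x , y , z)) i) j

    decode : Fin (q ℕ.^ (n ℕ.* (n ℕ.* n))) → Coefficients
    decode a i j k = finToFun a (combine i (combine j k))

    decode-injective : ∀ {a b} → (∀ i j k → decode a i j k ≡ decode b i j k) → a ≡ b
    decode-injective {a} {b} eq = begin
      a                             ≡⟨ Finₚ.funToFin-finToFin {n ℕ.* (n ℕ.* n)} {q} a ⟨
      funToFin (finToFun {q} {N} a) ≡⟨ funToFin-cong {N} {q} same ⟩
      funToFin (finToFun {q} {N} b) ≡⟨ Finₚ.funToFin-finToFin {n ℕ.* (n ℕ.* n)} {q} b ⟩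
      b                             ∎
      where
      open ≡-Reasoning
      N = n ℕ.* (n ℕ.* n)
      same : ∀ l → finToFun {q} {N} a l ≡ finToFun {q} {N} b l
      same l with i , jk , refl ← Finₚ.combine-surjective {n} l
             with j , k , refl ← Finₚ.combine-surjective {n} jk = eq i j k

    -- Pigeonhole in place of linear algebra: there are q^(n³) coefficient families but only q^|P|
    -- patterns of values on P, so two different families agree on P. Their difference vanishes
    -- there, and by `value-zero` it is not the zero function.
    interpolation : 1 ℕ.< q → (P : List V) → length P ℕ.< n ℕ.* (n ℕ.* n) →
      Σ[ f ∈ Expr (n ℕ.+ (n ℕ.+ (n ℕ.+ 0))) ] ((∃[ y ] ⟦ f ⟧ y ≢ 0#) × (∀ {x} → x ∈ P → ⟦ f ⟧ x ≡ 0#))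
    interpolation 1<q P P<n³
      with a , b , a<b , eq ← Finₚ.pigeonhole (ℕₚ.^-monoʳ-< q 1<q P<n³)
             (λ a → funToFin (λ p → value (decode a) (lookup P p)))
      = expr c , nonzero , vanishes
      where
      c : Coefficients
      c i j k = decode a i j k + - decode b i j k
      agree : ∀ p → value (decode a) (lookup P p) ≡ value (decode b) (lookup P p)
      agree p = trans (sym (Finₚ.finToFun-funToFin _ p)) (trans (cong (λ l → finToFun l p) eq) (Finₚ.finToFun-funToFin _ p))
      vanishes : ∀ {x} → x ∈ P → ⟦ expr c ⟧ x ≡ 0#
      vanishes {x} x∈P = trans (⟦expr⟧ c x) (trans (sym (value-minus (decode a) (decode b) x))
        (x≡y⇒x-y≡0 (subst (λ y → value (decode a) y ≡ value (decode b) y) (sym (lookup-index x∈P)) (agree (index x∈P)))))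
      nonzero : ∃[ y ] ⟦ expr c ⟧ y ≢ 0#
      nonzero with any-V? (λ y → ¬? (⟦ expr c ⟧ y ≟ 0#))
      ... | yes found = found
      ... | no  none  = ⊥-elim (Finₚ.<⇒≢ a<b (decode-injective λ i j k → x-y≡0⇒x≡y (value-zero c
              (λ y → trans (sym (⟦expr⟧ c y)) (decidable-stable (_ ≟ 0#) (λ ne → none (y , ne)))) i j k)))

-- The field of residues modulo a prime

module Residues (q : ℕ) .{{_ : NonZero q}} where

  private
    infixl 6 _+_
    infixl 7 _*_
    _+_ = _+F_ q
    _*_ = _*F_ q

  residue : ℕ → Fin q
  residue n = n mod q

  toℕ-residue : ∀ n → toℕ (residue n) ≡ n % q
  toℕ-residue n = Finₚ.toℕ-fromℕ< (m%n<n n q)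

  residue-cong : ∀ {m n} → m % q ≡ n % q → residue m ≡ residue n
  residue-cong {m} {n} eq = Finₚ.toℕ-injective (trans (toℕ-residue m) (trans eq (sym (toℕ-residue n))))

  residue-toℕ : ∀ x → residue (toℕ x) ≡ x
  residue-toℕ x = Finₚ.toℕ-injective (trans (toℕ-residue (toℕ x)) (m<n⇒m%n≡m (Finₚ.toℕ<n x)))

  residue-+ : ∀ m n → residue m + residue n ≡ residue (m ℕ.+ n)
  residue-+ m n rewrite toℕ-residue m | toℕ-residue n = residue-cong (sym (%-distribˡ-+ m n q))

  residue-* : ∀ m n → residue m * residue n ≡ residue (m ℕ.* n)
  residue-* m n rewrite toℕ-residue m | toℕ-residue n = residue-cong (sym (%-distribˡ-* m n q))

  -_ : Fin q → Fin q
  - x = residue (q ∸ toℕ x)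

  -- Every element is the residue of a natural number, so a ring identity can be inherited from ℕ.
  lift₃ : ∀ (f g : Fin q → Fin q → Fin q → Fin q) →
    (∀ k m n → f (residue k) (residue m) (residue n) ≡ g (residue k) (residue m) (residue n)) → ∀ x y z → f x y z ≡ g x y z
  lift₃ f g eq x y z =
    subst (λ x → f x y z ≡ g x y z) (residue-toℕ x)
      (subst (λ y → f _ y z ≡ g _ y z) (residue-toℕ y)
        (subst (λ z → f _ _ z ≡ g _ _ z) (residue-toℕ z) (eq (toℕ x) (toℕ y) (toℕ z))))

  +-assoc : ∀ x y z → (x + y) + z ≡ x + (y + z)
  +-assoc = lift₃ (λ x y z → (x + y) + z) (λ x y z → x + (y + z)) λ k m n →
    trans (cong (_+ residue n) (residue-+ k m)) (trans (residue-+ (k ℕ.+ m) n) (trans (cong residue (ℕₚ.+-assoc k m n))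
      (sym (trans (cong (residue k +_) (residue-+ m n)) (residue-+ k (m ℕ.+ n))))))

  *-assoc : ∀ x y z → (x * y) * z ≡ x * (y * z)
  *-assoc = lift₃ (λ x y z → (x * y) * z) (λ x y z → x * (y * z)) λ k m n →
    trans (cong (_* residue n) (residue-* k m)) (trans (residue-* (k ℕ.* m) n) (trans (cong residue (ℕₚ.*-assoc k m n))
      (sym (trans (cong (residue k *_) (residue-* m n)) (residue-* k (m ℕ.* n))))))

  +-comm : ∀ x y → x + y ≡ y + x
  +-comm x y = cong residue (ℕₚ.+-comm (toℕ x) (toℕ y))

  *-comm : ∀ x y → x * y ≡ y * x
  *-comm x y = cong residue (ℕₚ.*-comm (toℕ x) (toℕ y))

  distribˡ : ∀ x y z → x * (y + z) ≡ x * y + x * z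
  distribˡ = lift₃ (λ x y z → x * (y + z)) (λ x y z → x * y + x * z) λ k m n →
    trans (cong (residue k *_) (residue-+ m n)) (trans (residue-* k (m ℕ.+ n)) (trans (cong residue (ℕₚ.*-distribˡ-+ k m n))
      (sym (trans (cong₂ _+_ (residue-* k m) (residue-* k n)) (residue-+ (k ℕ.* m) (k ℕ.* n))))))

  +-identityˡ : ∀ x → residue 0 + x ≡ x
  +-identityˡ x = trans (cong (residue 0 +_) (sym (residue-toℕ x))) (trans (residue-+ 0 (toℕ x)) (residue-toℕ x))

  *-identityˡ : ∀ x → residue 1 * x ≡ x
  *-identityˡ x = trans (cong (residue 1 *_) (sym (residue-toℕ x)))
    (trans (residue-* 1 (toℕ x)) (trans (cong residue (ℕₚ.*-identityˡ (toℕ x))) (residue-toℕ x)))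

  residue-q : residue q ≡ residue 0
  residue-q = residue-cong (trans (n%n≡0 q) (sym (m*n%n≡0 0 q)))

  -‿inverseʳ : ∀ x → x + (- x) ≡ residue 0
  -‿inverseʳ x = trans (cong (_+ (- x)) (sym (residue-toℕ x))) (trans (residue-+ (toℕ x) (q ∸ toℕ x))
    (trans (cong residue (ℕₚ.m+[n∸m]≡n (ℕₚ.<⇒≤ (Finₚ.toℕ<n x)))) residue-q))

  isCommutativeRing : IsCommutativeRing _≡_ _+_ _*_ -_ (residue 0) (residue 1)
  isCommutativeRing = record
    { isRing = record
      { +-isAbelianGroup = record
        { isGroup = record
          { isMonoid = record
            { isSemigroup = record
              { isMagma = record { isEquivalence = isEquivalence ; ∙-cong = cong₂ _+_ }
              ; assoc = +-assoc }
            ; identity = +-identityˡ , λ x → trans (+-comm x _) (+-identityˡ x) }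
          ; inverse = (λ x → trans (+-comm _ x) (-‿inverseʳ x)) , -‿inverseʳ
          ; ⁻¹-cong = cong -_ }
        ; comm = +-comm }
      ; *-cong = cong₂ _*_
      ; *-assoc = *-assoc
      ; *-identity = *-identityˡ , λ x → trans (*-comm x _) (*-identityˡ x)
      ; distrib = distribˡ , λ x y z → trans (*-comm _ x) (trans (distribˡ x y z) (cong₂ _+_ (*-comm x y) (*-comm x z))) }
    ; *-comm = *-comm }

  residue-*q : ∀ m → residue (m ℕ.* q) ≡ residue 0
  residue-*q m = residue-cong (trans (m*n%n≡0 m q) (sym (m*n%n≡0 0 q)))

  residue≢0 : ∀ n → suc n ℕ.< q → residue (suc n) ≢ residue 0
  residue≢0 n n<q eq with () ← trans (trans (sym (m<n⇒m%n≡m n<q)) (sym (toℕ-residue (suc n))))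
                                 (trans (cong toℕ eq) (trans (toℕ-residue 0) (m*n%n≡0 0 q)))

  fold-residue : ∀ n → fold (residue 0) (λ x → residue 1 + x) n ≡ residue n
  fold-residue zero    = refl
  fold-residue (suc n) = trans (cong (residue 1 +_) (fold-residue n)) (residue-+ 1 n)

  commutativeRing : CommutativeRing _ _
  commutativeRing = record { isCommutativeRing = isCommutativeRing }

  -- Bézout for q and x gives either 1 + b x = a q, so that -b is the inverse, or 1 + a q = b x, so
  -- that b is.
  inverse : Prime q → ∀ x → x ≢ residue 0 → ∃[ y ] x * y ≡ residue 1
  inverse q-prime x x≢0 = go (toℕ x) refl
    where
    open IntegerCoefficients commutativeRing using (solve; _:=_; _:+_; _:*_; :-_; con)
    open ≡-Reasoning
    go : ∀ m → toℕ x ≡ m → ∃[ y ] x * y ≡ residue 1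
    go zero    eq = ⊥-elim (x≢0 (trans (sym (residue-toℕ x)) (cong residue eq)))
    go (suc m) eq with coprime-Bézout (prime⇒coprime q-prime (subst (ℕ._< q) eq (Finₚ.toℕ<n x)))
    ... | Bézout.+- a b identity = - residue b , (begin
      x * (- residue b)
        ≡⟨ solve 2 (λ x y → x :* (:- y) := con (ℤ.+ 1) :+ :- (con (ℤ.+ 1) :+ y :* x)) refl x (residue b) ⟩
      residue 1 + (- (residue 1 + residue b * x))
        ≡⟨ cong (λ y → residue 1 + (- (residue 1 + residue b * y))) (trans (sym (residue-toℕ x)) (cong residue eq)) ⟩
      residue 1 + (- (residue 1 + residue b * residue (suc m)))
        ≡⟨ cong (λ y → residue 1 + (- y)) (trans (cong (residue 1 +_) (residue-* b (suc m))) (residue-+ 1 _)) ⟩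
      residue 1 + (- residue (1 ℕ.+ b ℕ.* suc m))
        ≡⟨ cong (λ y → residue 1 + (- y)) (trans (cong residue identity) (residue-*q a)) ⟩
      residue 1 + (- residue 0)
        ≡⟨ solve 0 (con (ℤ.+ 1) :+ :- con (ℤ.+ 0) := con (ℤ.+ 1)) refl ⟩
      residue 1 ∎)
    ... | Bézout.-+ a b identity = residue b , (begin
      x * residue b                       ≡⟨ *-comm x (residue b) ⟩
      residue b * x                       ≡⟨ cong (residue b *_) (trans (sym (residue-toℕ x)) (cong residue eq)) ⟩
      residue b * residue (suc m)         ≡⟨ residue-* b (suc m) ⟩
      residue (b ℕ.* suc m)               ≡⟨ cong residue identity ⟨
      residue (1 ℕ.+ a ℕ.* q)             ≡⟨ residue-+ 1 (a ℕ.* q) ⟨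
      residue 1 + residue (a ℕ.* q)       ≡⟨ cong (residue 1 +_) (residue-*q a) ⟩
      residue 1 + residue 0               ≡⟨ residue-+ 1 0 ⟩
      residue 1                           ∎)

  primeField : Prime q → PrimeField q
  primeField q-prime = record
    { _+_ = _+_ ; _*_ = _*_ ; -_ = -_ ; 0# = residue 0 ; 1# = residue 1
    ; isCommutativeRing = isCommutativeRing
    ; inverse = inverse q-prime
    ; nat≢0 = λ n n<q eq → residue≢0 n n<q (trans (sym (fold-residue (suc n))) eq) }

-- Lines and planes

module Lines {q : ℕ} (K : PrimeField q) {Line : Set} (base dir : Line → Fin q × Fin q × Fin q)
             (dir≢0 : ∀ ℓ → dir ℓ ≢ Trivariate.0ᵥ K) where
  open FieldProperties K
  open Univariate K
  open Trivariate K
  open Tangency K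

  point : Line → Fin q → V
  point ℓ t = base ℓ +ᵥ t ·ᵥ dir ℓ

  _on_ : V → Line → Set
  p on ℓ = ∃[ t ] p ≡ point ℓ t

  SameLine : Line → Line → Set
  SameLine a b = ∀ p → p on a ⇔ p on b

  LinIndep : V → V → Set
  LinIndep u v = ∀ a b → a ·ᵥ u +ᵥ b ·ᵥ v ≡ 0ᵥ → a ≡ 0# × b ≡ 0#

  _≟ᵥ_ : (u v : V) → Dec (u ≡ v)
  _≟ᵥ_ = ≡-dec _≟_ (≡-dec _≟_ _≟_)

  on? : ∀ p ℓ → Dec (p on ℓ)
  on? p ℓ = Finₚ.any? λ t → p ≟ᵥ point ℓ t

  point-on : ∀ ℓ t → point ℓ t on ℓ
  point-on ℓ t = t , refl

  point-injective : ∀ ℓ {s t} → point ℓ s ≡ point ℓ t → s ≡ t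
  point-injective ℓ {s} {t} eq with nonzero-coord (dir≢0 ℓ)
  ... | i , ne = x-y≡0⇒x≡y (*-nonzeroˡ ne (begin
    coord i (dir ℓ) * (s + - t)
      ≡⟨ solve 4 (λ b d s t → d :* (s :- t) := (b :+ s :* d) :- (b :+ t :* d)) refl (coord i (base ℓ)) (coord i (dir ℓ)) s t ⟩
    (coord i (base ℓ) + s * coord i (dir ℓ)) + - (coord i (base ℓ) + t * coord i (dir ℓ))
      ≡⟨ x≡y⇒x-y≡0 (trans (sym (coord-point s)) (trans (cong (coord i) eq) (coord-point t))) ⟩
    0# ∎))
    where
    open ≡-Reasoning
    coord-point : ∀ t → coord i (point ℓ t) ≡ coord i (base ℓ) + t * coord i (dir ℓ)
    coord-point t = trans (coord-+ᵥ i (base ℓ) _) (cong (coord i (base ℓ) +_) (coord-·ᵥ i t (dir ℓ)))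

  rebase : ∀ ℓ s t → point ℓ t ≡ point ℓ s +ᵥ (t + - s) ·ᵥ dir ℓ
  rebase ℓ s t = trans (cong (point ℓ) (solve 2 (λ s t → t := s :+ (t :- s)) refl s t)) (sym (+ᵥ-+ᵥ (base ℓ) s (t + - s) (dir ℓ)))

  ·ᵥ-·ᵥ : ∀ s t v → s ·ᵥ (t ·ᵥ v) ≡ (s * t) ·ᵥ v
  ·ᵥ-·ᵥ s t (v₁ , v₂ , v₃) = cong₂ _,_ (eq v₁) (cong₂ _,_ (eq v₂) (eq v₃))
    where
    eq : ∀ v → s * (t * v) ≡ s * t * v
    eq v = solve 3 (λ s t v → s :* (t :* v) := s :* t :* v) refl s t v

  1·ᵥ : ∀ v → 1# ·ᵥ v ≡ v
  1·ᵥ (v₁ , v₂ , v₃) = cong₂ _,_ (*-identityˡ v₁) (cong₂ _,_ (*-identityˡ v₂) (*-identityˡ v₃))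

  parallel-sym : ∀ {u v} → u ≢ 0ᵥ → Parallel u v → Parallel v u
  parallel-sym {u} {v} u≢0 (s , refl) with inverse s (λ s≡0 → u≢0 (trans (cong (_·ᵥ v) s≡0) (0·ᵥ v)))
    where
    0·ᵥ : ∀ v → 0# ·ᵥ v ≡ 0ᵥ
    0·ᵥ (v₁ , v₂ , v₃) = cong₂ _,_ (zeroˡ v₁) (cong₂ _,_ (zeroˡ v₂) (zeroˡ v₃))
  ... | r , sr≡1 = r , sym (trans (·ᵥ-·ᵥ r s v) (trans (cong (_·ᵥ v) (trans (*-comm r s) sr≡1)) (1·ᵥ v)))

  through : ∀ ℓ {p} → p on ℓ → ∀ r → (p +ᵥ r ·ᵥ dir ℓ) on ℓ
  through ℓ (s , refl) r = s + r , +ᵥ-+ᵥ (base ℓ) s r (dir ℓ)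

  from-point : ∀ ℓ {p x} → x on ℓ → p on ℓ → ∃[ r ] p ≡ x +ᵥ r ·ᵥ dir ℓ
  from-point ℓ (s , refl) (t , refl) = t + - s , rebase ℓ s t

  parallel⇒⊆ : ∀ {x} a b → x on a → x on b → Parallel (dir a) (dir b) → ∀ p → p on a → p on b
  parallel⇒⊆ {x} a b x∈a x∈b (c , eq) p p∈a with r , refl ← from-point a x∈a p∈a =
    subst (_on b) (cong (x +ᵥ_) (trans (sym (·ᵥ-·ᵥ r c (dir b))) (cong (r ·ᵥ_) (sym eq)))) (through b x∈b (r * c))

  Distinct : Line → Line → Set
  Distinct a b = ¬ SameLine a b

  -- Two lines with a common point and parallel directions consist of the same points.
  ∦ : ∀ {x} a b → x on a → x on b → Distinct a b ⊎ Distinct b a → ¬ Parallel (dir a) (dir b)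
  ∦ {x} a b x∈a x∈b distinct ∥ = [ (λ d → d same) , (λ d → d λ p → mk⇔ (Equivalence.from (same p)) (Equivalence.to (same p))) ]′ distinct
    where
    same : SameLine a b
    same p = mk⇔ (parallel⇒⊆ a b x∈a x∈b ∥ p) (parallel⇒⊆ b a x∈b x∈a (parallel-sym (dir≢0 a) ∥) p)

  -- Two different common points give (t - s) dir a = r dir b with t - s invertible, contrary to
  -- `∦`.
  meet-once : ∀ {a b} → Distinct a b ⊎ Distinct b a → ∀ {s t} → point a s on b → point a t on b → s ≡ t
  meet-once {a} {b} distinct {s} {t} s∈ t∈ with s ≟ t
  ... | yes eq = eq
  ... | no s≢t with inverse (t + - s) (λ eq → s≢t (sym (x-y≡0⇒x≡y eq))) | from-point b s∈ t∈
  ...   | d , inv | r , eq = ⊥-elim (∦ a b (s , refl) s∈ distinct (d * r , (begin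
    dir a                          ≡⟨ 1·ᵥ (dir a) ⟨
    1# ·ᵥ dir a                    ≡⟨ cong (_·ᵥ dir a) (trans (*-comm d (t + - s)) inv) ⟨
    (d * (t + - s)) ·ᵥ dir a       ≡⟨ ·ᵥ-·ᵥ d (t + - s) (dir a) ⟨
    d ·ᵥ ((t + - s) ·ᵥ dir a)      ≡⟨ cong (d ·ᵥ_) (ext λ i → cancel i) ⟩
    d ·ᵥ (r ·ᵥ dir b)              ≡⟨ ·ᵥ-·ᵥ d r (dir b) ⟩
    (d * r) ·ᵥ dir b               ∎)))
    where
    open ≡-Reasoning
    cancel : ∀ i → coord i ((t + - s) ·ᵥ dir a) ≡ coord i (r ·ᵥ dir b)
    cancel i = begin
      coord i ((t + - s) ·ᵥ dir a)
        ≡⟨ solve 2 (λ x y → y := (x :+ y) :- x) refl (coord i (point a s)) _ ⟩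
      (coord i (point a s) + coord i ((t + - s) ·ᵥ dir a)) + - coord i (point a s)
        ≡⟨ cong (_+ - coord i (point a s)) 
             (trans (sym (coord-+ᵥ i (point a s) _)) (trans (cong (coord i) (trans (sym (rebase a s t)) eq)) (coord-+ᵥ i (point a s) _))) ⟩
      (coord i (point a s) + coord i (r ·ᵥ dir b)) + - coord i (point a s)
        ≡⟨ solve 2 (λ x y → (x :+ y) :- x := y) refl (coord i (point a s)) _ ⟩
      coord i (r ·ᵥ dir b) ∎

  ∦⇒linIndep : ∀ {u v} → v ≢ 0ᵥ → ¬ Parallel u v → LinIndep u v
  ∦⇒linIndep {u} {v} v≢0 u∦v a b eq = a≡0 , b≡0
    where
    open ≡-Reasoning
    eqᵢ : ∀ i → a * coord i u + b * coord i v ≡ 0#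
    eqᵢ i = trans (sym (coord-lin i a u b v)) (trans (cong (coord i) eq) (coord-0 i))
      where
      coord-0 : ∀ i → coord i 0ᵥ ≡ 0#
      coord-0 0F = refl
      coord-0 1F = refl
      coord-0 2F = refl
    a≡0 : a ≡ 0#
    a≡0 with a ≟ 0#
    ... | yes eq = eq
    ... | no a≢0 with inverse a a≢0
    ...   | c , inv = ⊥-elim (u∦v (- (c * b) , ext λ i → begin
      coord i u
        ≡⟨ *-identityˡ _ ⟨
      1# * coord i u
        ≡⟨ cong (_* coord i u) inv ⟨
      a * c * coord i u
        ≡⟨ solve 5 (λ a c b x y → a :* c :* x := c :* (a :* x :+ b :* y) :+ (:- (c :* b)) :* y) refl a c b (coord i u) (coord i v) ⟩
      c * (a * coord i u + b * coord i v) + - (c * b) * coord i v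
        ≡⟨ cong (λ y → c * y + - (c * b) * coord i v) (eqᵢ i) ⟩
      c * 0# + - (c * b) * coord i v
        ≡⟨ solve 2 (λ c y → c :* con (ℤ.+ 0) :+ y := y) refl c _ ⟩
      - (c * b) * coord i v
        ≡⟨ coord-·ᵥ i _ v ⟨
      coord i (- (c * b) ·ᵥ v) ∎))
    b≡0 : b ≡ 0#
    b≡0 with i , ne ← nonzero-coord v≢0 = *-nonzeroˡ ne (begin
      coord i v * b                     ≡⟨ solve 3 (λ b x y → y :* b := con (ℤ.+ 0) :* x :+ b :* y) refl b (coord i u) (coord i v) ⟩
      0# * coord i u + b * coord i v    ≡⟨ cong (λ a → a * coord i u + b * coord i v) a≡0 ⟨
      a * coord i u + b * coord i v     ≡⟨ eqᵢ i ⟩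
      0#                                ∎)

  open Incidences {Line} {V} {q} point point-injective {_on_} on? point-on public

  -- The lines of the collection in the tangent plane along a rich line

  -- The direction `e` witnesses that `point ℓ t₀` is noncritical. The plane to be found passes
  -- through this point, parallel to the kernel of the gradient there.
  module Pencil {m : ℕ} (f : Expr m) (2m+4≤q : 2 ℕ.+ (suc m ℕ.+ suc m) ℕ.≤ q)
           {L : List Line} (distinct : AllPairs Distinct L) {μ : ℕ} (3≤μ : 3 ℕ.≤ μ)
           (f≡0 : ∀ {a} → a ∈ L → ∀ {p} → p on a → ⟦ f ⟧ p ≡ 0#)
           {ℓ : Line} (ℓ∈L : ℓ ∈ L) (2m+2≤ : suc m ℕ.+ suc m ℕ.≤ length (rich μ L ℓ))
           {t₀ : Fin q} {e : V} (e≢0 : ⟦ ∂ e f ⟧ (point ℓ t₀) ≢ 0#) where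

    private
      b = point ℓ t₀
      v = dir ℓ

    m<q : suc m ℕ.≤ q
    m<q = ℕₚ.≤-trans (ℕₚ.m≤n+m _ (2 ℕ.+ suc m)) 2m+4≤q

    vanishes-through : ∀ {a x} → a ∈ L → x on a → VanishesOn f x (dir a)
    vanishes-through {a} a∈L x∈a r = f≡0 a∈L (through a x∈a r)

    -- At least three lines of `L` pass through the point; besides `ℓ` there are two that supply the
    -- directions.
    rich⇒Rich : ∀ {t} → t ∈ rich μ L ℓ → Rich f v (point ℓ t)
    rich⇒Rich {t} t∈ with two-others (∈-filter⁺ (on? (point ℓ t)) ℓ∈L (point-on ℓ t))
        (AllPairsₚ.filter⁺ (on? (point ℓ t)) distinct)
        (ℕₚ.≤-trans 3≤μ (proj₂ (∈-filter⁻ (λ t → μ ℕ.≤? multiplicity L (point ℓ t)) {xs = allFin q} t∈)))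
    ... | a , c , a∈ , c∈ , ℓa , ℓc , ac
      with a∈L , x∈a ← ∈-filter⁻ (on? (point ℓ t)) {xs = L} a∈ | c∈L , x∈c ← ∈-filter⁻ (on? (point ℓ t)) {xs = L} c∈ =
      dir a , dir c , ∦ a ℓ x∈a (t , refl) ([ inj₂ , inj₁ ]′ ℓa) , ∦ c a x∈c x∈a (inj₂ ac) ,
      ∦ c ℓ x∈c (t , refl) ([ inj₂ , inj₁ ]′ ℓc) , vanishes-through a∈L x∈a , vanishes-through c∈L x∈c

    -- Testing noncriticality with the one fixed direction `e` limits the loss to the zeros of a
    -- single univariate polynomial.
    good : List (Fin q)
    good = filter (λ t → ¬? (⟦ ∂ e f ⟧ (point ℓ t) ≟ 0#)) (rich μ L ℓ)

    good-count : length (rich μ L ℓ) ℕ.≤ length good ℕ.+ suc m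
    good-count = nonroots (suc m) (λ t → ⟦ ∂ e f ⟧ (point ℓ t))
      (restrict (∂ e f) (base ℓ) v , ℕₚ.≤-trans (length-restrict (∂ e f) (base ℓ) v) (s≤s ℕₚ.pred[n]≤n) , eval-restrict (∂ e f) (base ℓ) v)
      e≢0 (rich μ L ℓ) (filter⁺ _ (allFin⁺ q))

    tangent-at-b : ∀ {t} → t ∈ good → ∀ {u} → ⟦ ∂ u f ⟧ (point ℓ t) ≡ 0# → ⟦ ∂ u f ⟧ b ≡ 0#
    tangent-at-b {t} t∈ {u} u≡0 = tangent-plane-constant f b v (dir≢0 ℓ) 2m+4≤q (vanishes-through ℓ∈L (t₀ , refl))
      -- `tangent-plane-constant` counts parameters from its base point, here `b`, so the rich
      -- parameters are shifted by t₀.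
      (map (λ t → t + - t₀) (rich μ L ℓ)) (map⁺ shift-injective (filter⁺ _ (allFin⁺ q)))
      (ℕₚ.≤-trans 2m+2≤ (ℕₚ.≤-reflexive (sym (length-map _ (rich μ L ℓ)))))
      (Allₚ.map⁺ (All.tabulate λ {t} t∈ → subst (Rich f v) (rebase ℓ t₀ t) (rich⇒Rich t∈)))
      e e≢0 (t + - t₀) u
      (λ eq → proj₂ (∈-filter⁻ (λ t → ¬? (⟦ ∂ e f ⟧ (point ℓ t) ≟ 0#)) {xs = rich μ L ℓ} t∈) (trans (cong ⟦ ∂ e f ⟧ (rebase ℓ t₀ t)) eq))
      (trans (cong ⟦ ∂ u f ⟧ (sym (rebase ℓ t₀ t))) u≡0)
      where
      shift-injective : ∀ {s t} → s + - t₀ ≡ t + - t₀ → s ≡ t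
      shift-injective {s} {t} eq = trans (solve 2 (λ s r → s := (s :- r) :+ r) refl s t₀)
        (trans (cong (_+ t₀) eq) (solve 2 (λ s r → (s :- r) :+ r := s) refl t t₀))

    -- The plane needs a second direction besides `v`, and any further line of `L` through a good
    -- point supplies one. A good point exists because at most m + 1 of the 2m + 2 or more rich
    -- points are discarded.
    transversal : ∃[ u ] (¬ Parallel u v × ⟦ ∂ u f ⟧ b ≡ 0#)
    transversal = go good (λ t∈ → t∈) good-count
      where
      first : ∀ {t} → t ∈ good → Rich f v (point ℓ t) → ∃[ u ] (¬ Parallel u v × ⟦ ∂ u f ⟧ b ≡ 0#)
      first {t} t∈ (u , _ , u∦v , _ , _ , f≡0-u , _) = u , u∦v , tangent-at-b t∈ (tangent f m<q (point ℓ t) f≡0-u)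
      go : ∀ ts → (∀ {t} → t ∈ ts → t ∈ good) → length (rich μ L ℓ) ℕ.≤ length ts ℕ.+ suc m → ∃[ u ] (¬ Parallel u v × ⟦ ∂ u f ⟧ b ≡ 0#)
      go []       _   le = ⊥-elim (ℕₚ.<-irrefl refl (ℕₚ.≤-trans (s≤s (ℕₚ.m≤n+m (suc m) m)) (ℕₚ.≤-trans 2m+2≤ le)))
      go (t ∷ ts) sub _  = first (sub (here refl))
        (rich⇒Rich (proj₁ (∈-filter⁻ (λ t → ¬? (⟦ ∂ e f ⟧ (point ℓ t) ≟ 0#)) {xs = rich μ L ℓ} (sub (here refl)))))

    meets-good? : ∀ a → Dec (Any (λ t → point ℓ t on a) good)
    meets-good? a = any? (λ t → on? (point ℓ t) a) good

    pencil : List Line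
    pencil = filter meets-good? L

    pencil-⊆ : pencil ⊆ L
    pencil-⊆ = filter-⊆ meets-good? L

    -- A line of the pencil meets `ℓ` in a good point, where the gradient kills its direction. By
    -- constancy of the tangent plane the gradient at `b` kills it too, so it is a combination of
    -- `u` and `v`; the meeting point differs from `b` by a multiple of `v`.
    pencil-planar : ∃[ u ] (LinIndep u v × All (λ a → ∀ p → p on a → ∃[ α ] ∃[ β ] p ≡ b +ᵥ α ·ᵥ u +ᵥ β ·ᵥ v) pencil)
    pencil-planar = spanned transversal
      where
      combine-steps : ∀ b s r α β w v → b +ᵥ s ·ᵥ v +ᵥ r ·ᵥ (α ·ᵥ w +ᵥ β ·ᵥ v) ≡ b +ᵥ (r * α) ·ᵥ w +ᵥ (s + r * β) ·ᵥ v
      combine-steps (b₁ , b₂ , b₃) s r α β (w₁ , w₂ , w₃) (v₁ , v₂ , v₃) =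
        cong₂ _,_ (eq b₁ w₁ v₁) (cong₂ _,_ (eq b₂ w₂ v₂) (eq b₃ w₃ v₃))
        where
        eq : ∀ b w v → b + s * v + r * (α * w + β * v) ≡ b + r * α * w + (s + r * β) * v
        eq b w v = solve 7 (λ b w v s r α β → b :+ s :* v :+ r :* (α :* w :+ β :* v) := b :+ r :* α :* w :+ (s :+ r :* β) :* v) refl b w v s r α β
      in-plane : ∀ {a p w t} → ∃[ α ] ∃[ β ] dir a ≡ α ·ᵥ w +ᵥ β ·ᵥ v → ∃[ r ] p ≡ point ℓ t +ᵥ r ·ᵥ dir a →
        ∃[ α ] ∃[ β ] p ≡ b +ᵥ α ·ᵥ w +ᵥ β ·ᵥ v
      in-plane {w = w} {t} (α , β , dir≡) (r , p≡) = r * α , (t + - t₀) + r * β ,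
        trans p≡ (trans (cong₂ (λ x u → x +ᵥ r ·ᵥ u) (rebase ℓ t₀ t) dir≡) (combine-steps b (t + - t₀) r α β w v))
      planar : ∀ {w} → ¬ Parallel w v → ⟦ ∂ w f ⟧ b ≡ 0# → ∀ {a} → a ∈ L → ∃[ t ] (t ∈ good × point ℓ t on a) →
        ∀ p → p on a → ∃[ α ] ∃[ β ] p ≡ b +ᵥ α ·ᵥ w +ᵥ β ·ᵥ v
      planar w∦v w≡0 {a} a∈L (t , t∈ , x∈a) p p∈a = in-plane
        (kernel-span f b e≢0 (dir≢0 ℓ) w∦v w≡0 (tangent f m<q b (vanishes-through ℓ∈L (t₀ , refl))) (dir a)
          (tangent-at-b t∈ (tangent f m<q (point ℓ t) (vanishes-through a∈L x∈a))))
        (from-point a x∈a p∈a)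
      spanned : ∃[ u ] (¬ Parallel u v × ⟦ ∂ u f ⟧ b ≡ 0#) →
        ∃[ u ] (LinIndep u v × All (λ a → ∀ p → p on a → ∃[ α ] ∃[ β ] p ≡ b +ᵥ α ·ᵥ u +ᵥ β ·ᵥ v) pencil)
      spanned (w , w∦v , w≡0) = w , ∦⇒linIndep (dir≢0 ℓ) w∦v , All.tabulate λ {a} a∈ → planar w∦v w≡0
        (proj₁ (∈-filter⁻ meets-good? {xs = L} a∈)) (find (proj₂ (∈-filter⁻ meets-good? {xs = L} a∈)))

    pencil-length : μ ℕ.* length good ℕ.≤ length good ℕ.+ length pencil
    pencil-length = pencil-count ℓ ℓ∈L distinct (filter⁺ _ (filter⁺ _ (allFin⁺ q))) meet-once
      (All.tabulate λ {t} t∈ → proj₂ (∈-filter⁻ (λ t → μ ℕ.≤? multiplicity L (point ℓ t)) {xs = allFin q}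
        (proj₁ (∈-filter⁻ (λ t → ¬? (⟦ ∂ e f ⟧ (point ℓ t) ≟ 0#)) {xs = rich μ L ℓ} t∈))))

-- The three alternatives for a covering point set

allPairs-⊆ : ∀ {A : Set} {D : A → A → Set} {xs ys} → xs ⊆ ys → AllPairs D ys → AllPairs D xs
allPairs-⊆ []            []         = []
allPairs-⊆ (y ∷ʳ xs⊆)    (_ ∷ ds)   = allPairs-⊆ xs⊆ ds
allPairs-⊆ (refl ∷ xs⊆)  (d ∷ ds)   = All-resp-⊆ xs⊆ d ∷ allPairs-⊆ xs⊆ ds

module Covering {q : ℕ} (K : PrimeField q) {Line : Set} (base dir : Line → Fin q × Fin q × Fin q)
                (dir≢0 : ∀ ℓ → dir ℓ ≢ Trivariate.0ᵥ K) where
  open FieldProperties K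
  open Univariate K
  open Trivariate K
  open Tangency K
  open Interpolation K
  open Lines K base dir dir≢0

  degree : ℕ → ℕ
  degree n = n ℕ.+ (n ℕ.+ (n ℕ.+ 0))

  -- `g` will be the number of good points on one line; the second inequality is |S| ≥ (μ - 1) g,
  -- freed of subtraction.
  ManyCoplanar : List Line → ℕ → ℕ → Set
  ManyCoplanar L μ r = ∃[ S ] ∃[ g ] (S ⊆ L × r ℕ.≤ g × μ ℕ.* g ℕ.≤ g ℕ.+ length S ×
    (∃[ b ] ∃[ u ] ∃[ v ] (LinIndep u v × All (λ a → ∀ p → p on a → ∃[ α ] ∃[ β ] p ≡ b +ᵥ α ·ᵥ u +ᵥ β ·ᵥ v) S)))

  module _ (n : ℕ) (2m+4≤q : 2 ℕ.+ (suc (degree n) ℕ.+ suc (degree n)) ℕ.≤ q)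
           {R : ℕ} (2m+2≤R : suc (degree n) ℕ.+ suc (degree n) ℕ.≤ R) {μ : ℕ} (3≤μ : 3 ℕ.≤ μ) (P : List V) where

    rich-lines-coplanar : ∀ L → AllPairs Distinct L → 0 ℕ.< length L → All (λ a → R ℕ.≤ length (rich μ L a)) L →
      All (λ a → ∀ t → point a t ∈ P) L → length P ℕ.< n ℕ.* (n ℕ.* n) → ManyCoplanar L μ (R ∸ suc (degree n))
    rich-lines-coplanar L@(a₀ ∷ _) distinct _ allRich L⊆P P<n³ = from-interpolant (interpolation n n≤q 1<q P P<n³)
      where
      m<q : suc (degree n) ℕ.≤ q
      m<q = ℕₚ.≤-trans (ℕₚ.m≤n+m _ (2 ℕ.+ suc (degree n))) 2m+4≤q
      n≤q : n ℕ.≤ q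
      n≤q = ℕₚ.≤-trans (ℕₚ.m≤m+n n _) (ℕₚ.<⇒≤ m<q)
      1<q : 1 ℕ.< q
      1<q = ℕₚ.≤-trans (s≤s (s≤s z≤n)) 2m+4≤q
      -- The interpolating polynomial vanishes on P, but the differentiation is run for the union of
      -- the lines: the noncritical point has to lie on a line of `L`.
      Z : V → Set
      Z p = Any (p on_) L
      Z? : ∀ p → Dec (Z p)
      Z? p = any? (on? p) L
      Z⇒∈P : ∀ {p} → Z p → p ∈ P
      Z⇒∈P z with a , a∈L , t , refl ← find z = All.lookup L⊆P a∈L t
      from-noncritical : Σ[ k ∈ ℕ ] Σ[ g ∈ Expr k ] (k ℕ.≤ degree n × (∀ x → Z x → ⟦ g ⟧ x ≡ 0#) ×
        (∃[ x ] (Z x × ∃[ i ] ⟦ ∂ (basis i) g ⟧ x ≢ 0#))) → ManyCoplanar L μ (R ∸ suc (degree n))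
      from-noncritical (k , g , k≤m , g≡0 , x , z , i , ne) = at-line (find z)
        where
        2k≤2m : suc k ℕ.+ suc k ℕ.≤ suc (degree n) ℕ.+ suc (degree n)
        2k≤2m = ℕₚ.+-mono-≤ (s≤s k≤m) (s≤s k≤m)
        at-line : ∃[ ℓ ] (ℓ ∈ L × x on ℓ) → ManyCoplanar L μ (R ∸ suc (degree n))
        at-line (ℓ , ℓ∈L , t₀ , refl) = pencil , length good , pencil-⊆ , enough , pencil-length , point ℓ t₀ ,
            proj₁ pencil-planar , dir ℓ , proj₂ pencil-planar
          where
          R≤rich = All.lookup allRich ℓ∈L
          2k≤rich = ℕₚ.≤-trans 2k≤2m (ℕₚ.≤-trans 2m+2≤R R≤rich)
          2k+4≤q = ℕₚ.≤-trans (s≤s (s≤s 2k≤2m)) 2m+4≤q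
          g≡0′ : ∀ {a} → a ∈ L → ∀ {p} → p on a → ⟦ g ⟧ p ≡ 0#
          g≡0′ {a} a∈L {p} p∈a = g≡0 p (lose a∈L p∈a)
          open Pencil g 2k+4≤q distinct 3≤μ g≡0′ ℓ∈L 2k≤rich {t₀} ne
          enough : R ∸ suc (degree n) ℕ.≤ length good
          enough = ℕₚ.≤-trans (ℕₚ.∸-mono (ℕₚ.≤-trans R≤rich good-count) (s≤s k≤m)) (ℕₚ.≤-reflexive (ℕₚ.m+n∸n≡m (length good) (suc k)))
      from-interpolant : Σ[ f ∈ Expr (degree n) ] ((∃[ y ] ⟦ f ⟧ y ≢ 0#) × (∀ {x} → x ∈ P → ⟦ f ⟧ x ≡ 0#)) → ManyCoplanar L μ (R ∸ suc (degree n))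
      from-interpolant (f , (y , ne) , f≡0) =
        from-noncritical (noncritical Z? {point a₀ 0#} (here (point-on a₀ 0#)) (degree n) f m<q (λ x z → f≡0 (Z⇒∈P z)) y ne)

    -- If |P| is too small to obstruct interpolation, either the pruning deletes every line and the
    -- potential bounds |P| from below, or the survivors yield a plane. The coplanar lines found
    -- among the survivors belong to `L` as well.
    trichotomy : ∀ L → AllPairs Distinct L → All (λ a → ∀ t → point a t ∈ P) L →
      length L ℕ.* (q ∸ R) ℕ.≤ μ ℕ.* length P ⊎ n ℕ.* (n ℕ.* n) ℕ.≤ length P ⊎ ManyCoplanar L μ (R ∸ suc (degree n))
    trichotomy L distinct L⊆P with n ℕ.* (n ℕ.* n) ℕ.≤? length P
    ... | yes large = inj₂ (inj₁ large)
    ... | no  small = [ (λ found → inj₂ (inj₂ (coplanar found))) , (λ le → inj₁ (ℕₚ.≤-trans le (potential≤ P μ R L))) ]′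
                        (prune P μ R (length L) L refl L⊆P)
      where
      coplanar : Σ[ L′ ∈ List Line ] (L′ ⊆ L × 0 ℕ.< length L′ × All (λ a → R ℕ.≤ length (rich μ L′ a)) L′) →
        ManyCoplanar L μ (R ∸ suc (degree n))
      coplanar (L′ , L′⊆L , 0<L′ , allRich) = widen (rich-lines-coplanar L′
          (allPairs-⊆ L′⊆L distinct) 0<L′ allRich (All-resp-⊆ L′⊆L L⊆P) (ℕₚ.≰⇒> small))
        where
        widen : ManyCoplanar L′ μ (R ∸ suc (degree n)) → ManyCoplanar L μ (R ∸ suc (degree n))
        widen (S , g , S⊆L′ , rest) = S , g , ⊆-trans S⊆L′ L′⊆L , rest

-- Choice of parameters and the cubic bound

floor-bounds : ∀ q k .{{_ : NonZero k}} → (k ℕ.* (q / k) ℕ.≤ q) × (q ℕ.< k ℕ.+ k ℕ.* (q / k))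
floor-bounds q k = subst (ℕ._≤ q) (ℕₚ.*-comm (q / k) k) (m/n*n≤m q k) ,
  subst₂ ℕ._<_ (sym (m≡m%n+[m/n]*n q k)) (cong (k ℕ.+_) (ℕₚ.*-comm (q / k) k)) (ℕₚ.+-monoˡ-< ((q / k) ℕ.* k) (m%n<n q k))

cube-≤ : ∀ {q} k n → q ℕ.≤ k ℕ.* n → q ℕ.^ 3 ℕ.≤ k ℕ.^ 3 ℕ.* (n ℕ.* (n ℕ.* n))
cube-≤ k n le = ℕₚ.≤-trans (ℕₚ.^-monoˡ-≤ 3 le) (ℕₚ.≤-reflexive (eq k n))
  where
  eq : ∀ k n → k ℕ.* n ℕ.* (k ℕ.* n ℕ.* (k ℕ.* n ℕ.* 1)) ≡ k ℕ.* (k ℕ.* (k ℕ.* 1)) ℕ.* (n ℕ.* (n ℕ.* n))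
  eq = solve-∀

-- The factor 2 k₁ collects the losses in q ≤ 2 (q ∸ R) and q² ≤ k₁ ℓ.
sparse-bound : ∀ q k₁ μ ℓ p R → 2 ℕ.* R ℕ.≤ q → q ℕ.* q ℕ.≤ k₁ ℕ.* ℓ → ℓ ℕ.* (q ∸ R) ℕ.≤ μ ℕ.* p → q ℕ.^ 3 ℕ.≤ 2 ℕ.* k₁ ℕ.* μ ℕ.* p
sparse-bound q k₁ μ ℓ p R 2R≤q q²≤ le = begin
  q ℕ.^ 3                                 ≡⟨ cube q ⟩
  q ℕ.* (q ℕ.* q)                         ≤⟨ ℕₚ.*-mono-≤ q≤ q²≤ ⟩
  2 ℕ.* (q ∸ R) ℕ.* (k₁ ℕ.* ℓ)            ≡⟨ rearrange (q ∸ R) k₁ ℓ ⟩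
  2 ℕ.* k₁ ℕ.* (ℓ ℕ.* (q ∸ R))            ≤⟨ ℕₚ.*-monoʳ-≤ (2 ℕ.* k₁) le ⟩
  2 ℕ.* k₁ ℕ.* (μ ℕ.* p)                 ≡⟨ ℕₚ.*-assoc (2 ℕ.* k₁) μ p ⟨
  2 ℕ.* k₁ ℕ.* μ ℕ.* p                   ∎
  where
  open ℕₚ.≤-Reasoning
  cube : ∀ q → q ℕ.* (q ℕ.* (q ℕ.* 1)) ≡ q ℕ.* (q ℕ.* q)
  cube = solve-∀
  rearrange : ∀ r k ℓ → 2 ℕ.* r ℕ.* (k ℕ.* ℓ) ≡ 2 ℕ.* k ℕ.* (ℓ ℕ.* r)
  rearrange = solve-∀
  2R : ∀ R → 2 ℕ.* R ≡ R ℕ.+ R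
  2R = solve-∀
  R+R≤q : R ℕ.+ R ℕ.≤ q
  R+R≤q = subst (ℕ._≤ q) (2R R) 2R≤q
  q≤ : q ℕ.≤ 2 ℕ.* (q ∸ R)
  q≤ = begin
    q                      ≡⟨ ℕₚ.m+[n∸m]≡n (ℕₚ.≤-trans (ℕₚ.m≤m+n R R) R+R≤q) ⟨
    R ℕ.+ (q ∸ R)          ≤⟨ ℕₚ.+-monoˡ-≤ (q ∸ R) (ℕₚ.m+n≤o⇒m≤o∸n R R+R≤q) ⟩
    (q ∸ R) ℕ.+ (q ∸ R)    ≡⟨ 2R (q ∸ R) ⟨
    2 ℕ.* (q ∸ R)          ∎

-- The number 4 + 3n is one more than the degree bound 3 (n + 1). Subtracted from R, about q/2, it
-- leaves g ≥ q/4. Then s ≤ K₀ q ≤ 4 K₀ g is incompatible with (4 K₀ + 2) g ≤ s unless g = 0. The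
-- multiplicity 4 K₀ + 3 is chosen for this and is also at least 3.
coplanar-contradiction : ∀ q K₀ R n g s → 48 ℕ.* suc n ℕ.≤ q → q ℕ.≤ 2 ℕ.* R ℕ.+ 1 →
  R ∸ (4 ℕ.+ 3 ℕ.* n) ℕ.≤ g → (4 ℕ.* K₀ ℕ.+ 3) ℕ.* g ℕ.≤ g ℕ.+ s → s ℕ.≤ K₀ ℕ.* q → ⊥
coplanar-contradiction q K₀ R n g s n≤ q≤ R≤ μg≤ s≤ = ℕₚ.<-irrefl refl (begin-strict
  0              <⟨ ℕₚ.≤-trans (s≤s z≤n) n≤ ⟩
  q              ≤⟨ q≤4g ⟩
  4 ℕ.* g        ≡⟨ cong (4 ℕ.*_) g≡0 ⟩
  0              ∎)
  where
  open ℕₚ.≤-Reasoning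
  R≤′ : R ℕ.≤ 4 ℕ.+ 3 ℕ.* n ℕ.+ g
  R≤′ = ℕₚ.≤-trans (ℕₚ.m≤n+m∸n R (4 ℕ.+ 3 ℕ.* n)) (ℕₚ.+-monoʳ-≤ (4 ℕ.+ 3 ℕ.* n) R≤)
  q≤4g : q ℕ.≤ 4 ℕ.* g
  q≤4g = ℕₚ.+-cancelʳ-≤ q q (4 ℕ.* g) (begin
    q ℕ.+ q                                          ≤⟨ ℕₚ.+-mono-≤ q≤ q≤ ⟩
    2 ℕ.* R ℕ.+ 1 ℕ.+ (2 ℕ.* R ℕ.+ 1)                ≡⟨ double R ⟩
    4 ℕ.* R ℕ.+ 2                                    ≤⟨ ℕₚ.+-monoˡ-≤ 2 (ℕₚ.*-monoʳ-≤ 4 R≤′) ⟩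
    4 ℕ.* (4 ℕ.+ 3 ℕ.* n ℕ.+ g) ℕ.+ 2                ≤⟨ ℕₚ.m≤m+n _ (30 ℕ.+ 36 ℕ.* n) ⟩
    4 ℕ.* (4 ℕ.+ 3 ℕ.* n ℕ.+ g) ℕ.+ 2 ℕ.+ (30 ℕ.+ 36 ℕ.* n) ≡⟨ slack n g ⟩
    4 ℕ.* g ℕ.+ 48 ℕ.* suc n                         ≤⟨ ℕₚ.+-monoʳ-≤ (4 ℕ.* g) n≤ ⟩
    4 ℕ.* g ℕ.+ q                                    ∎)
    where
    double : ∀ R → 2 ℕ.* R ℕ.+ 1 ℕ.+ (2 ℕ.* R ℕ.+ 1) ≡ 4 ℕ.* R ℕ.+ 2
    double = solve-∀
    slack : ∀ n g → 4 ℕ.* (4 ℕ.+ 3 ℕ.* n ℕ.+ g) ℕ.+ 2 ℕ.+ (30 ℕ.+ 36 ℕ.* n) ≡ 4 ℕ.* g ℕ.+ 48 ℕ.* suc n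
    slack = solve-∀
  g≡0 : g ≡ 0
  g≡0 = ℕₚ.n≤0⇒n≡0 (ℕₚ.≤-trans (ℕₚ.m≤m+n g (g ℕ.+ 0)) (ℕₚ.+-cancelʳ-≤ ((4 ℕ.* K₀ ℕ.+ 1) ℕ.* g) (2 ℕ.* g) 0 (begin
    2 ℕ.* g ℕ.+ (4 ℕ.* K₀ ℕ.+ 1) ℕ.* g     ≡⟨ split K₀ g ⟩
    (4 ℕ.* K₀ ℕ.+ 3) ℕ.* g                               ≤⟨ μg≤ ⟩
    g ℕ.+ s                                ≤⟨ ℕₚ.+-monoʳ-≤ g (ℕₚ.≤-trans s≤ (ℕₚ.*-monoʳ-≤ K₀ q≤4g)) ⟩
    g ℕ.+ K₀ ℕ.* (4 ℕ.* g)                 ≡⟨ collect K₀ g ⟩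
    (4 ℕ.* K₀ ℕ.+ 1) ℕ.* g                 ∎)))
    where
    split : ∀ K₀ g → 2 ℕ.* g ℕ.+ (4 ℕ.* K₀ ℕ.+ 1) ℕ.* g ≡ (4 ℕ.* K₀ ℕ.+ 3) ℕ.* g
    split = solve-∀
    collect : ∀ K₀ g → g ℕ.+ K₀ ℕ.* (4 ℕ.* g) ≡ (4 ℕ.* K₀ ℕ.+ 1) ℕ.* g
    collect = solve-∀

module CubicBound {q : ℕ} (K : PrimeField q) {Line : Set} (base dir : Line → Fin q × Fin q × Fin q)
                  (dir≢0 : ∀ ℓ → dir ℓ ≢ Trivariate.0ᵥ K) where
  open Trivariate K using (V; _+ᵥ_; _·ᵥ_)
  open Lines K base dir dir≢0 using (point; _on_; LinIndep; Distinct)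
  open Covering K base dir dir≢0

  -- The interpolation parameter is q / 48, where 48 leaves ample room in every comparison of the
  -- degree with q and q/2. The factor 96 = 2 · 48 absorbs the rounding, and `B` will be 96³.
  cubic-bound : ∀ K₀ k₁ B → (∀ n → q ℕ.≤ 96 ℕ.* n → q ℕ.^ 3 ℕ.≤ B ℕ.* (n ℕ.* (n ℕ.* n))) →
    ∀ L → AllPairs Distinct L → q ℕ.* q ℕ.≤ k₁ ℕ.* length L →
    (∀ b u v S → LinIndep u v → S ⊆ L → All (λ a → ∀ p → p on a → ∃[ α ] ∃[ β ] p ≡ b +ᵥ α ·ᵥ u +ᵥ β ·ᵥ v) S → length S ℕ.≤ K₀ ℕ.* q) →
    ∀ P → 1 ℕ.≤ length P → All (λ a → ∀ t → point a t ∈ P) L →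
    q ℕ.^ 3 ℕ.≤ (2 ℕ.* k₁ ℕ.* (4 ℕ.* K₀ ℕ.+ 3) ℕ.+ B) ℕ.* length P
  cubic-bound K₀ k₁ B cube L distinct q²≤ wolff P 1≤P points = by-size (q / 48) refl
    where
    open ℕₚ.≤-Reasoning
    A = 2 ℕ.* k₁ ℕ.* (4 ℕ.* K₀ ℕ.+ 3)
    firstˡ : ∀ {x} → x ℕ.≤ A ℕ.* length P → x ℕ.≤ (A ℕ.+ B) ℕ.* length P
    firstˡ le = ℕₚ.≤-trans le (ℕₚ.*-monoˡ-≤ (length P) (ℕₚ.m≤m+n A B))
    secondʳ : ∀ {x} → x ℕ.≤ B ℕ.* length P → x ℕ.≤ (A ℕ.+ B) ℕ.* length P
    secondʳ le = ℕₚ.≤-trans le (ℕₚ.*-monoˡ-≤ (length P) (ℕₚ.m≤n+m B A))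
    bounds = floor-bounds q 48
    by-size : ∀ n → q / 48 ≡ n → q ℕ.^ 3 ℕ.≤ (A ℕ.+ B) ℕ.* length P
    -- For q < 48 there is no positive interpolation parameter; q³ ≤ B suffices, as P is nonempty.
    by-size zero    eq = secondʳ (begin
      q ℕ.^ 3                     ≤⟨ cube 1 (ℕₚ.≤-trans (ℕₚ.<⇒≤ (proj₂ bounds)) (subst (λ n → 48 ℕ.+ 48 ℕ.* n ℕ.≤ 96) (sym eq) (ℕₚ.m≤m+n 48 48))) ⟩
      B ℕ.* 1                     ≤⟨ ℕₚ.*-monoʳ-≤ B 1≤P ⟩
      B ℕ.* length P              ∎)
    by-size (suc n) eq = [ (λ sparse → firstˡ (sparse-bound q k₁ (4 ℕ.* K₀ ℕ.+ 3) (length L) (length P) R (proj₁ R-bounds) q²≤ sparse))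
                         , [ (λ large → secondʳ (ℕₚ.≤-trans (cube (suc n) q≤96n) (ℕₚ.*-monoʳ-≤ B large)))
                           , (λ coplanar → ⊥-elim (impossible coplanar)) ]′ ]′
                         (trichotomy (suc n) 2m+4≤q {R} 2m+2≤R {4 ℕ.* K₀ ℕ.+ 3} (ℕₚ.m≤n+m 3 (4 ℕ.* K₀)) P L distinct points)
      where
      R = q / 2
      R-bounds = floor-bounds q 2
      48n≤q : 48 ℕ.* suc n ℕ.≤ q
      48n≤q = subst (λ n → 48 ℕ.* n ℕ.≤ q) eq (proj₁ bounds)
      q≤2R+1 : q ℕ.≤ 2 ℕ.* R ℕ.+ 1
      q≤2R+1 = ℕₚ.≤-pred (ℕₚ.≤-trans (proj₂ R-bounds) (ℕₚ.≤-reflexive (shape R)))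
        where
        shape : ∀ R → 2 ℕ.+ 2 ℕ.* R ≡ suc (2 ℕ.* R ℕ.+ 1)
        shape = solve-∀
      q≤96n : q ℕ.≤ 96 ℕ.* suc n
      q≤96n = begin
        q                              ≤⟨ ℕₚ.<⇒≤ (proj₂ bounds) ⟩
        48 ℕ.+ 48 ℕ.* (q / 48)         ≡⟨ cong (λ n → 48 ℕ.+ 48 ℕ.* n) eq ⟩
        48 ℕ.+ 48 ℕ.* suc n            ≤⟨ ℕₚ.m≤m+n _ (48 ℕ.* n) ⟩
        48 ℕ.+ 48 ℕ.* suc n ℕ.+ 48 ℕ.* n ≡⟨ shape n ⟩
        96 ℕ.* suc n                   ∎
        where
        shape : ∀ n → 48 ℕ.+ 48 ℕ.* suc n ℕ.+ 48 ℕ.* n ≡ 96 ℕ.* suc n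
        shape = solve-∀
      degree≡ : ∀ n → suc n ℕ.+ (suc n ℕ.+ (suc n ℕ.+ 0)) ≡ 3 ℕ.+ 3 ℕ.* n
      degree≡ = solve-∀
      2m+4≤q : 2 ℕ.+ (suc (degree (suc n)) ℕ.+ suc (degree (suc n))) ℕ.≤ q
      2m+4≤q = ℕₚ.≤-trans (ℕₚ.≤-trans (ℕₚ.m≤m+n _ (38 ℕ.+ 42 ℕ.* n)) (ℕₚ.≤-reflexive (shape n))) 48n≤q
        where
        shape : ∀ n → 2 ℕ.+ (suc (suc n ℕ.+ (suc n ℕ.+ (suc n ℕ.+ 0))) ℕ.+ suc (suc n ℕ.+ (suc n ℕ.+ (suc n ℕ.+ 0)))) ℕ.+ (38 ℕ.+ 42 ℕ.* n) ≡ 48 ℕ.* suc n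
        shape = solve-∀
      2m+2≤R : suc (degree (suc n)) ℕ.+ suc (degree (suc n)) ℕ.≤ R
      2m+2≤R = ℕₚ.*-cancelˡ-≤ 2 (ℕₚ.+-cancelʳ-≤ 1 _ _
        (ℕₚ.≤-trans (ℕₚ.≤-trans (ℕₚ.m≤m+n _ (31 ℕ.+ 36 ℕ.* n)) (ℕₚ.≤-reflexive (shape n))) (ℕₚ.≤-trans 48n≤q q≤2R+1)))
        where
        shape : ∀ n → 2 ℕ.* (suc (suc n ℕ.+ (suc n ℕ.+ (suc n ℕ.+ 0))) ℕ.+ suc (suc n ℕ.+ (suc n ℕ.+ (suc n ℕ.+ 0)))) ℕ.+ 1 ℕ.+ (31 ℕ.+ 36 ℕ.* n) ≡ 48 ℕ.* suc n
        shape = solve-∀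
      impossible : ManyCoplanar L (4 ℕ.* K₀ ℕ.+ 3) (R ∸ suc (degree (suc n))) → ⊥
      impossible (S , g , S⊆L , R≤ , μg≤ , b , u , v , independent , coplanar) =
        coplanar-contradiction q K₀ R n g (length S) 48n≤q q≤2R+1
          (subst (λ m → R ∸ suc m ℕ.≤ g) (degree≡ n) R≤) μg≤ (wolff b u v S independent S⊆L coplanar)

-- Transfer to the rational statement

open import Defs
open import Data.Rational as ℚ using (ℚ; 0ℚ; _<_; _≤_; _*_; mkℚ; ↥_; *≤*; 1ℚ; ½)
import Data.Rational.Properties as ℚₚ
import Data.Rational.Solver as ℚSolver

covering-bound : ∀ q .{{_ : NonZero q}} → Prime q → ∀ K₀ k₁ B →
  (∀ n → q ℕ.≤ 96 ℕ.* n → q ^ 3 ℕ.≤ B ℕ.* (n ℕ.* (n ℕ.* n))) →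
  ∀ (L : List (Line q)) → DistinctLines q L → q ℕ.* q ℕ.≤ k₁ ℕ.* length L →
  (∀ (Π : Plane q) (S : List (Line q)) → S ⊆ L → All (λ ℓ → LineInPlane q ℓ Π) S → length S ℕ.≤ K₀ ℕ.* q) →
  ∀ (P : List (Pt q)) → ContainsLines q P L → q ^ 3 ℕ.≤ (2 ℕ.* k₁ ℕ.* (4 ℕ.* K₀ ℕ.+ 3) ℕ.+ B) ℕ.* length P
covering-bound q q-prime K₀ k₁ B cube L distinct q²≤ wolff P P⊇ =
  -- For the residue operations, incidence, distinctness and independence agree definitionally with
  -- the notions of the statement; only the data of a plane have to be packed.
  CubicBound.cubic-bound (Residues.primeField q q-prime) Line.base Line.dir Line.dir≢0 K₀ k₁ B cube L distinct q²≤
    (λ b u v S independent → wolff (plane b u v independent) S) P (nonempty L (λ ℓ∈ → P⊇ _ ℓ∈) q²≤)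
    (All.tabulate λ {ℓ} ℓ∈L t → P⊇ ℓ ℓ∈L _ (t , refl))
  where
  inhabited : ∀ {x} {xs : List (Pt q)} → x ∈ xs → 1 ℕ.≤ length xs
  inhabited (here _)  = s≤s z≤n
  inhabited (there _) = s≤s z≤n
  -- As q > 0, the lower bound on the number of lines excludes the empty list, and any line supplies
  -- a point.
  nonempty : ∀ M → (∀ {ℓ} → ℓ ∈ M → ∀ p → OnLine q ℓ p → p ∈ P) → q ℕ.* q ℕ.≤ k₁ ℕ.* length M → 1 ℕ.≤ length P
  nonempty []      _    le = ⊥-elim (ℕₚ.<-irrefl refl (ℕₚ.≤-trans (ℕₚ.*-mono-≤ (ℕ.>-nonZero⁻¹ q) (ℕ.>-nonZero⁻¹ q))
    (ℕₚ.≤-trans le (ℕₚ.≤-reflexive (ℕₚ.*-zeroʳ k₁)))))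
  nonempty (ℓ ∷ _) P⊇ℓ _  = inhabited (P⊇ℓ (here refl) _ (0 mod q , refl))

ℕ→ℚ-mkℚ : ∀ n → ℕ→ℚ n ≡ mkℚ (ℤ.+ n) 0 (Coprimality.sym (1-coprimeTo n))
ℕ→ℚ-mkℚ n = ℚₚ.normalize-coprime (Coprimality.sym (1-coprimeTo n))

ℕ→ℚ-mono : ∀ {m n} → m ℕ.≤ n → ℕ→ℚ m ≤ ℕ→ℚ n
ℕ→ℚ-mono {m} {n} m≤n = subst₂ _≤_ (sym (ℕ→ℚ-mkℚ m)) (sym (ℕ→ℚ-mkℚ n)) (*≤* (ℤₚ.*-monoʳ-≤-nonNeg (ℤ.+ 1) {ℤ.+ m} {ℤ.+ n} (ℤ.+≤+ m≤n)))

ℕ→ℚ-cancel : ∀ {m n} → ℕ→ℚ m ≤ ℕ→ℚ n → m ℕ.≤ n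
ℕ→ℚ-cancel {m} {n} le = ℤₚ.drop‿+≤+ (ℤₚ.*-cancelʳ-≤-pos (ℤ.+ m) (ℤ.+ n) (ℤ.+ 1)
  (ℚₚ.drop-*≤* (subst₂ _≤_ (ℕ→ℚ-mkℚ m) (ℕ→ℚ-mkℚ n) le)))

ℕ→ℚ-* : ∀ m n → ℕ→ℚ (m ℕ.* n) ≡ ℕ→ℚ m * ℕ→ℚ n
ℕ→ℚ-* m n = trans (cong (ℚ._/ 1) (ℤₚ.pos-* m n)) (sym (cong₂ _*_ (ℕ→ℚ-mkℚ m) (ℕ→ℚ-mkℚ n)))

ℕ→ℚ-^ : ∀ m n → ℕ→ℚ (m ^ n) ≡ ℕ→ℚ m ^ℚ n
ℕ→ℚ-^ m zero    = refl
ℕ→ℚ-^ m (suc n) = trans (ℕ→ℚ-* m (m ^ n)) (cong (ℕ→ℚ m *_) (ℕ→ℚ-^ m n))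

0≤ℕ→ℚ : ∀ n → 0ℚ ≤ ℕ→ℚ n
0≤ℕ→ℚ n = ℕ→ℚ-mono {0} {n} z≤n

-- reciprocal k is 1/(k + 1).
reciprocal : ℕ → ℚ
reciprocal k = mkℚ (ℤ.+ 1) k (1-coprimeTo (suc k))

0<reciprocal : ∀ k → 0ℚ < reciprocal k
0<reciprocal k = ℚₚ.positive⁻¹ (reciprocal k)

reciprocal-inverse : ∀ k → reciprocal k * ℕ→ℚ (suc k) ≡ 1ℚ
reciprocal-inverse k = trans (cong (reciprocal k *_) (ℕ→ℚ-mkℚ (suc k))) (ℚₚ.*-inverseʳ (reciprocal k))

-- Dropping a denominator, which is at least 1, cannot decrease a nonnegative fraction.
natural-upper : ∀ p → p ≤ ℕ→ℚ ℤ.∣ ↥ p ∣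
natural-upper (mkℚ (ℤ.+ n) d c) = subst (mkℚ (ℤ.+ n) d c ≤_) (sym (ℕ→ℚ-mkℚ n))
  (*≤* (ℤₚ.*-monoˡ-≤-nonNeg (ℤ.+ n) {ℤ.+ 1} {ℤ.+ suc d} (ℤ.+≤+ (s≤s z≤n))))
natural-upper p@(mkℚ ℤ.-[1+ n ] d c) = ℚₚ.≤-trans (ℚₚ.<⇒≤ (ℚₚ.negative⁻¹ p)) (0≤ℕ→ℚ (suc n))

-- A positive numerator is at least 1. `mkℚ` stores the denominator minus one, which is the argument
-- that `reciprocal` takes.
reciprocal-lower : ∀ p → 0ℚ < p → Σ[ k ∈ ℕ ] reciprocal k ≤ p
reciprocal-lower (mkℚ ℤ.+[1+ n ] d c) _   = d , *≤* (ℤₚ.*-monoʳ-≤-nonNeg (ℤ.+ suc d) {ℤ.+ 1} {ℤ.+ suc n} (ℤ.+≤+ (s≤s z≤n)))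
reciprocal-lower (mkℚ ℤ.+0       d c) 0<p = ⊥-elim (ℤₚ.<-irrefl refl (ℚₚ.drop-*<* 0<p))
reciprocal-lower p@(mkℚ ℤ.-[1+ n ] d c) 0<p = ⊥-elim (ℚₚ.<-asym 0<p (ℚₚ.negative⁻¹ p))

*-monoˡ : ∀ {p q r} → 0ℚ ≤ r → p ≤ q → r * p ≤ r * q
*-monoˡ {r = r} 0≤r = ℚₚ.*-monoˡ-≤-nonNeg r {{ℚ.nonNegative 0≤r}}

*-monoʳ : ∀ {p q r} → 0ℚ ≤ r → p ≤ q → p * r ≤ q * r
*-monoʳ {r = r} 0≤r = ℚₚ.*-monoʳ-≤-nonNeg r {{ℚ.nonNegative 0≤r}}

0≤^ℚ : ∀ {p} → 0ℚ ≤ p → ∀ n → 0ℚ ≤ p ^ℚ n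
0≤^ℚ 0≤p zero    = ℚₚ.<⇒≤ (ℚₚ.positive⁻¹ 1ℚ)
0≤^ℚ {p} 0≤p (suc n) = subst (_≤ p * p ^ℚ n) (ℚₚ.*-zeroʳ p) (*-monoˡ 0≤p (0≤^ℚ 0≤p n))

^ℚ-mono : ∀ {p q} → 0ℚ ≤ p → p ≤ q → ∀ n → p ^ℚ n ≤ q ^ℚ n
^ℚ-mono 0≤p p≤q zero    = ℚₚ.≤-refl
^ℚ-mono 0≤p p≤q (suc n) = ℚₚ.≤-trans (*-monoˡ 0≤p (^ℚ-mono 0≤p p≤q n)) (*-monoʳ (0≤^ℚ (ℚₚ.≤-trans 0≤p p≤q) n) p≤q)

-- For ε = 1/2 the relation GeqPow reads c⁴ q¹² ≤ x⁴, the fourth power of c q³ ≤ x.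
cube-bound⇒GeqPow : ∀ M q x → q ^ 3 ℕ.≤ suc M ℕ.* x → GeqPow x (reciprocal M) q ½
cube-bound⇒GeqPow M q x le = subst (_≤ ℕ→ℚ x ^ℚ 4) (regroup (reciprocal M) (ℕ→ℚ q)) (^ℚ-mono 0≤ root 4)
  where
  open ℚₚ.≤-Reasoning
  open ℚSolver.+-*-Solver
  c = reciprocal M
  0≤c = ℚₚ.<⇒≤ (0<reciprocal M)
  0≤ : 0ℚ ≤ c * ℕ→ℚ q ^ℚ 3
  0≤ = subst (_≤ c * ℕ→ℚ q ^ℚ 3) (ℚₚ.*-zeroʳ c) (*-monoˡ 0≤c (0≤^ℚ (0≤ℕ→ℚ q) 3))
  root : c * ℕ→ℚ q ^ℚ 3 ≤ ℕ→ℚ x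
  root = begin
    c * ℕ→ℚ q ^ℚ 3              ≡⟨ cong (c *_) (ℕ→ℚ-^ q 3) ⟨
    c * ℕ→ℚ (q ^ 3)             ≤⟨ *-monoˡ 0≤c (ℕ→ℚ-mono le) ⟩
    c * ℕ→ℚ (suc M ℕ.* x)       ≡⟨ cong (c *_) (ℕ→ℚ-* (suc M) x) ⟩
    c * (ℕ→ℚ (suc M) * ℕ→ℚ x)   ≡⟨ ℚₚ.*-assoc c (ℕ→ℚ (suc M)) (ℕ→ℚ x) ⟨
    c * ℕ→ℚ (suc M) * ℕ→ℚ x     ≡⟨ cong (_* ℕ→ℚ x) (reciprocal-inverse M) ⟩
    1ℚ * ℕ→ℚ x                  ≡⟨ ℚₚ.*-identityˡ (ℕ→ℚ x) ⟩
    ℕ→ℚ x                       ∎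
  regroup : ∀ c Q → (c * Q ^ℚ 3) ^ℚ 4 ≡ c ^ℚ 4 * Q ^ℚ 12
  regroup = solve 2 (λ c Q → let Q³ = Q :* (Q :* (Q :* con 1ℚ)); y = c :* Q³; Q⁶ = λ z → Q :* (Q :* (Q :* (Q :* (Q :* (Q :* z))))) in
    y :* (y :* (y :* (y :* con 1ℚ))) := (c :* (c :* (c :* (c :* con 1ℚ)))) :* Q⁶ (Q⁶ (con 1ℚ))) refl

theorem8p1 : Σ[ ε ∈ ℚ ] (0ℚ < ε × (∀ (C₀ c₁ C₁ : ℚ) → 0ℚ < C₀ → 0ℚ < c₁ → 0ℚ < C₁ →
    Σ[ c ∈ ℚ ] (0ℚ < c × (∀ (q : ℕ) .{{_ : NonZero q}} → Prime q →
    ∀ (L : List (Line q)) → DistinctLines q L →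
    c₁ * ℕ→ℚ (q ^ 2) ≤ ℕ→ℚ (length L) →
    ℕ→ℚ (length L) ≤ C₁ * ℕ→ℚ (q ^ 2) →
    Wolff q C₀ L →
    ∀ (P : List (Pt q)) → Unique P → ContainsLines q P L →
    GeqPow (length P) c q ε))))
theorem8p1 = ½ , ℚₚ.positive⁻¹ ½ , λ C₀ c₁ C₁ _ 0<c₁ _ → constant C₀ C₁ (reciprocal-lower c₁ 0<c₁)
  where
  open ℚₚ.≤-Reasoning
  constant : ∀ {c₁} C₀ C₁ → Σ[ k ∈ ℕ ] reciprocal k ≤ c₁ → Σ[ c ∈ ℚ ] (0ℚ < c × (∀ (q : ℕ) .{{_ : NonZero q}} → Prime q →
    ∀ (L : List (Line q)) → DistinctLines q L → c₁ * ℕ→ℚ (q ^ 2) ≤ ℕ→ℚ (length L) → ℕ→ℚ (length L) ≤ C₁ * ℕ→ℚ (q ^ 2) →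
    Wolff q C₀ L → ∀ (P : List (Pt q)) → Unique P → ContainsLines q P L → GeqPow (length P) c q ½))
  constant {c₁} C₀ _ (k , r≤c₁) = reciprocal M , 0<reciprocal M , λ q q-prime L distinct many _ wolff P _ P⊇ →
      cube-bound⇒GeqPow M q (length P) (ℕₚ.≤-trans
        (covering-bound q q-prime K₀ (suc k) (96 ^ 3) (cube-≤ 96) L distinct (square q (length L) many)
          (λ Π S S⊆L planar → ℕ→ℚ-cancel (ℚₚ.≤-trans (wolff Π S S⊆L planar) (planar-bound q))) P P⊇)
        -- `reciprocal M` is 1/(M + 1), so the constant M is relaxed to M + 1.
        (ℕₚ.*-monoˡ-≤ (length P) (ℕₚ.n≤1+n M)))
    where
    K₀ = ℤ.∣ ↥ C₀ ∣
    M = 2 ℕ.* suc k ℕ.* (4 ℕ.* K₀ ℕ.+ 3) ℕ.+ 96 ^ 3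
    planar-bound : ∀ q → C₀ * ℕ→ℚ q ≤ ℕ→ℚ (K₀ ℕ.* q)
    planar-bound q = ℚₚ.≤-trans (*-monoʳ (0≤ℕ→ℚ q) (natural-upper C₀)) (ℚₚ.≤-reflexive (sym (ℕ→ℚ-* K₀ q)))
    square : ∀ q ℓ → c₁ * ℕ→ℚ (q ^ 2) ≤ ℕ→ℚ ℓ → q ℕ.* q ℕ.≤ suc k ℕ.* ℓ
    square q ℓ many = subst (λ s → q ℕ.* s ℕ.≤ suc k ℕ.* ℓ) (ℕₚ.*-identityʳ q) (ℕ→ℚ-cancel (begin
      ℕ→ℚ (q ^ 2)                                    ≡⟨ ℚₚ.*-identityˡ _ ⟨
      1ℚ * ℕ→ℚ (q ^ 2)                               ≡⟨ cong (_* ℕ→ℚ (q ^ 2)) (trans (ℚₚ.*-comm (ℕ→ℚ (suc k)) (reciprocal k)) (reciprocal-inverse k)) ⟨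
      ℕ→ℚ (suc k) * reciprocal k * ℕ→ℚ (q ^ 2)       ≡⟨ ℚₚ.*-assoc (ℕ→ℚ (suc k)) (reciprocal k) (ℕ→ℚ (q ^ 2)) ⟩
      ℕ→ℚ (suc k) * (reciprocal k * ℕ→ℚ (q ^ 2))     ≤⟨ *-monoˡ (0≤ℕ→ℚ (suc k)) (ℚₚ.≤-trans (*-monoʳ (0≤ℕ→ℚ (q ^ 2)) r≤c₁) many) ⟩
      ℕ→ℚ (suc k) * ℕ→ℚ ℓ                            ≡⟨ ℕ→ℚ-* (suc k) ℓ ⟨
      ℕ→ℚ (suc k ℕ.* ℓ)                              ∎))
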